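{- Let $q$ be a prime power with $q\equiv1\pmod4$, $n$ an odd prime and $Q=\frac{q^n-1}{q-1}$. Write the product of the distinct primes dividing $Q$ as $k p_1\cdots p_s$ with $p_1,\dots,p_s$ distinct primes (not dividing $k$), and set $\delta=1-\sum_{i=1}^s\frac1{p_i}$. Assume $\delta>0$ and $$q^{\frac n2-1}>\sqrt2\left(\frac{s-1}{\delta}+2\right)W(k).$$ Then $\mathcal{N}_0(q^n-1)>0$.
   Context: For a divisor $m$ of $q^n-1$, $\xi\in\mathbb{F}_{q^n}^*$ is $m$-free if $\xi=\zeta^d$ with $d\mid m$, $\zeta\in\mathbb{F}_{q^n}^*$ implies $d=1$. $\mathcal{N}_0(m)$ is the number of $m$-free $\xi\in\mathbb{F}_{q^n}^*$ with $\mathrm{Tr}(\xi^2)=0$, where $\mathrm{Tr}:\mathbb{F}_{q^n}\to\mathbb{F}_q$ is the trace. $W(m)=2^{\nu(m)}$ with $\nu(m)$ the number of distinct prime divisors of $m$. -}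

module Defs where

open import Level using (0ℓ)
open import Data.Nat as ℕ using (ℕ; zero; suc; _^_; _∸_; _≤_; _%_)
open import Data.Nat.DivMod using (_/_)
open import Data.Nat.Divisibility using (_∣_; _∣?_)
open import Data.Nat.Primality using (Prime; prime?)
open import Data.Fin using (Fin)
open import Data.List using (List; []; _∷_; length; filter; upTo)
open import Data.List.Relation.Unary.All using (All)
open import Data.List.Relation.Unary.AllPairs using (AllPairs)
open import Data.Product using (Σ; ∃; _×_; _,_)
open import Data.Integer using (+_)
open import Data.Rational as ℚ using (ℚ; 0ℚ; 1ℚ; 1/_; ≢-nonZero)
open import Data.Rational.Properties using (_≟_)
open import Relation.Nullary using (¬_; yes; no)
open import Relation.Nullary.Decidable using (_×-dec_)
open import Relation.Binary.PropositionalEquality using (_≡_; _≢_) renaming (setoid to ≡-setoid)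
open import Algebra.Bundles using (CommutativeRing)
open import Function.Bundles using (Bijection; _⇔_)

IsPrimePower : ℕ → Set
IsPrimePower q = Σ ℕ λ p → Σ ℕ λ e → Prime p × 1 ≤ e × q ≡ p ^ e

-- number of distinct prime divisors of m (for m ≥ 1), and W(m) = 2^ν(m)
ν : ℕ → ℕ
ν m = length (filter (λ p → prime? p ×-dec (p ∣? m)) (upTo (suc m)))

W : ℕ → ℕ
W m = 2 ^ ν m

SquareFree : ℕ → Set
SquareFree r = ∀ p → Prime p → ¬ (p ℕ.* p ∣ r)

IsRadicalOf : ℕ → ℕ → Set
IsRadicalOf r Q = SquareFree r × (∀ p → Prime p → (p ∣ r ⇔ p ∣ Q))

ℕ→ℚ : ℕ → ℚ
ℕ→ℚ n = (+ n) ℚ./ 1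

recipℕ : ℕ → ℚ
recipℕ zero = 0ℚ
recipℕ (suc n) = (+ 1) ℚ./ suc n

sumRecip : List ℕ → ℚ
sumRecip [] = 0ℚ
sumRecip (p ∷ ps) = recipℕ p ℚ.+ sumRecip ps

-- multiplicative inverse in ℚ, (only used at nonzero arguments)
invℚ : ℚ → ℚ
invℚ x with x ≟ 0ℚ
... | yes _ = 0ℚ
... | no x≢0 = 1/_ x {{≢-nonZero x≢0}}

record FiniteField (N : ℕ) : Set₁ where
  field
    commRing : CommutativeRing 0ℓ 0ℓ
  open CommutativeRing commRing public
  field
    nontrivial : ¬ (1# ≈ 0#)
    inverses   : ∀ x → ¬ (x ≈ 0#) → ∃ λ y → x * y ≈ 1#
    enumerate  : Bijection (≡-setoid (Fin N)) (CommutativeRing.setoid commRing)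

module _ {N : ℕ} (F : FiniteField N) where
  open FiniteField F

  pow : Carrier → ℕ → Carrier
  pow x zero = 1#
  pow x (suc k) = x * pow x k

  -- Tr : F_{q^n} → F_q,  Tr(x) = Σ_{i<n} x^{q^i}  (computed inside F_{q^n})
  trace : (q n : ℕ) → Carrier → Carrier
  trace q zero x = 0#
  trace q (suc i) x = pow x (q ^ i) + trace q i x

  Free : ℕ → Carrier → Set
  Free m ξ = ∀ d ζ → d ∣ m → ξ ≈ pow ζ d → d ≡ 1

  N₀-positive : (q n m : ℕ) → Set
  N₀-positive q n m = ∃ λ ξ → ¬ (ξ ≈ 0#) × Free m ξ × trace q n (ξ * ξ) ≈ 0#

-- natural division a / b (only used with b ≠ 0; returns 0 when b = 0)
divℕ : ℕ → ℕ → ℕ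
divℕ a zero = 0
divℕ a (suc b) = a / suc b

{-# OPTIONS --safe #-}

-- Tr(ξ²) = 0 only depends on the class of ξ in G = F_{q^n}^* / F_q^*, which is cyclic of odd order
-- Q = (q^n - 1)/(q - 1), and a Q-free ξ can be scaled by F_q^* to a primitive element.  Since squaring
-- permutes G and preserves Q-freeness, it suffices to find a generator of G = ℤ/Q in the set D of the
-- classes with Tr = 0.  D is the Singer difference set: |D| = (q^(n-1) - 1)/(q - 1), and any two
-- translates of D meet in at least (q^(n-2) - 1)/(q - 1) points.
--
-- In place of Gauss sums, write c_d for the Ramanujan sums with d squarefree (integer-valued, multiplicative
-- in d, c_p = p [p ∣ x] - 1) and X_d = Σ_{x ∈ D} c_d(x).  As c_d * c_d = Q c_d for the convolution on ℤ/Q,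
-- Cauchy–Schwarz and the difference set property give X_d² ≤ φ(d)² q^(n-2) for d > 1.  Expanding the
-- indicator of the k-free elements in the c_d and sieving by p_1, …, p_s then gives the criterion, with
-- q^(n/2-1) rounded up to an integer.
module Submission where

open import Defs
open import Data.Fin as Fin using (Fin; zero; suc; toℕ; punchIn; punchOut)
import Data.Fin.Properties as Fin
open import Data.List using (List; []; _∷_; length; filter; upTo)
open import Data.List.Membership.Propositional using (_∈_)
open import Data.List.Membership.Propositional.Properties using (∈-filter⁺; ∈-upTo⁺)
open import Data.List.Relation.Unary.All as All using (All; []; _∷_)
import Data.List.Relation.Unary.All.Properties as All
open import Data.List.Relation.Unary.AllPairs using (AllPairs; []; _∷_)
import Data.List.Relation.Unary.AllPairs.Properties as AllPairs
open import Data.Nat as ℕ using (ℕ; zero; suc; NonZero)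
open import Data.Nat.Coprimality using (Coprime; coprime-Bézout; coprime⇒gcd≡1)
open import Data.Nat.Divisibility
open import Data.Nat.GCD using (module Bézout; gcd; gcd-GCD; gcd[m,n]∣m; gcd[m,n]∣n)
open import Data.Nat.ListAction using (product)
open import Data.Nat.Primality
import Data.Nat.Properties as ℕ
import Data.Nat.Tactic.RingSolver as ℕ
open import Data.Product using (∃; _×_; _,_; proj₁; proj₂)
open import Data.Sum using (_⊎_; inj₁; inj₂)
open import Function using (_∘_; Bijection; Equivalence)
open import Relation.Nullary using (Dec; yes; no; ¬_; contradiction)
open import Relation.Nullary.Decidable using (map′; _×-dec_; ¬?)

-- Only a lower bound for the intersections of translates of D enters. It suffices because c_d has
-- total 0 for d > 1: a constant can be subtracted from the autocorrelation of D, and what is left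
-- is non-negative with total |D|² - Q (q^(n-2) - 1)/(q - 1) = q^(n-2). Cauchy-Schwarz applied to
-- c_d and D themselves would be far too weak; D is correlated with c_d beforehand, which keeps only
-- its components of order d. Let b be the integer that replaces q^(n/2-1). Every X_d with d > 1
-- costs at most φ(d) b. The k-free indicator has W(k) - 1 such terms, and the b saved against W(k)
-- b pays for the rounding. The primes p_i cost (1 - 1/p_i) W(k) b each, in total (s - 1 + δ) W(k)
-- b, while the main term and its error are multiplied by δ. Dividing by δ gives (s - 1)/δ + 1 from
-- the p_i and 1 from k: this is the constant (s - 1)/δ + 2. Q is odd as a sum of n odd powers of q,
-- n itself being odd.

module FiniteSums where
  open import Data.Integer using (ℤ; +_; -_; _+_; _*_; _-_; _≤_; 0ℤ; 1ℤ; +≤+; -[1+_]; _<_; +<+)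
  open import Data.Integer.Properties
  open import Data.Integer.Tactic.RingSolver using (solve-∀)
  open import Relation.Binary.PropositionalEquality

  -- Finite integer sums, periodic functions and indicators.

  Σ< : ℕ → (ℕ → ℤ) → ℤ
  Σ< zero    f = 0ℤ
  Σ< (suc n) f = Σ< n f + f n

  -- A function on ℤ/m is encoded as a function on ℕ of period m, so that translations are plain
  -- additions and no residues are formed.
  Periodic : ℕ → (ℕ → ℤ) → Set
  Periodic m f = ∀ x → f (x ℕ.+ m) ≡ f x

  Σ-cong : ∀ n {f g} → (∀ x → x ℕ.< n → f x ≡ g x) → Σ< n f ≡ Σ< n g
  Σ-cong zero    e = refl
  Σ-cong (suc n) e = cong₂ _+_ (Σ-cong n (λ x x<n → e x (ℕ.m<n⇒m<1+n x<n))) (e n (ℕ.n<1+n n))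

  Σ-ext : ∀ n {f g} → (∀ x → f x ≡ g x) → Σ< n f ≡ Σ< n g
  Σ-ext n e = Σ-cong n (λ x _ → e x)

  Σ-mono : ∀ n {f g} → (∀ x → x ℕ.< n → f x ≤ g x) → Σ< n f ≤ Σ< n g
  Σ-mono zero    e = ≤-refl
  Σ-mono (suc n) e = +-mono-≤ (Σ-mono n (λ x x<n → e x (ℕ.m<n⇒m<1+n x<n))) (e n (ℕ.n<1+n n))

  Σ-const : ∀ n c → Σ< n (λ _ → c) ≡ + n * c
  Σ-const zero    c = sym (*-zeroˡ c)
  Σ-const (suc n) c = trans (cong (_+ c) (Σ-const n c)) (lemma (+ n) c)
    where
    lemma : ∀ n c → n * c + c ≡ (1ℤ + n) * c
    lemma = solve-∀

  Σ-zero : ∀ n → Σ< n (λ _ → 0ℤ) ≡ 0ℤ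
  Σ-zero n = trans (Σ-const n 0ℤ) (*-zeroʳ (+ n))

  Σ-+ : ∀ n f g → Σ< n (λ x → f x + g x) ≡ Σ< n f + Σ< n g
  Σ-+ zero    f g = refl
  Σ-+ (suc n) f g = trans (cong (_+ (f n + g n)) (Σ-+ n f g)) (lemma (Σ< n f) (Σ< n g) (f n) (g n))
    where
    lemma : ∀ a b c d → (a + b) + (c + d) ≡ (a + c) + (b + d)
    lemma = solve-∀

  Σ-*ˡ : ∀ n c f → Σ< n (λ x → c * f x) ≡ c * Σ< n f
  Σ-*ˡ zero    c f = sym (*-zeroʳ c)
  Σ-*ˡ (suc n) c f = trans (cong (_+ c * f n) (Σ-*ˡ n c f)) (sym (*-distribˡ-+ c _ _))

  Σ-*ʳ : ∀ n c f → Σ< n (λ x → f x * c) ≡ Σ< n f * c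
  Σ-*ʳ n c f = trans (Σ-ext n (λ x → *-comm (f x) c)) (trans (Σ-*ˡ n c f) (*-comm c _))

  Σ-minus : ∀ n f g → Σ< n (λ x → f x - g x) ≡ Σ< n f - Σ< n g
  Σ-minus zero    f g = refl
  Σ-minus (suc n) f g = trans (cong (_+ (f n - g n)) (Σ-minus n f g)) (lemma (Σ< n f) (Σ< n g) (f n) (g n))
    where
    lemma : ∀ a b c d → (a - b) + (c - d) ≡ (a + c) - (b + d)
    lemma = solve-∀

  Σ-swap : ∀ m n (f : ℕ → ℕ → ℤ) → Σ< m (λ x → Σ< n (f x)) ≡ Σ< n (λ y → Σ< m (λ x → f x y))
  Σ-swap zero    n f = sym (Σ-zero n)
  Σ-swap (suc m) n f =
    trans (cong (_+ Σ< n (f m)) (Σ-swap m n f)) (sym (Σ-+ n (λ y → Σ< m (λ x → f x y)) (f m)))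

  Σ-nonneg : ∀ n {f} → (∀ x → x ℕ.< n → 0ℤ ≤ f x) → 0ℤ ≤ Σ< n f
  Σ-nonneg n {f} e = subst (_≤ Σ< n f) (Σ-zero n) (Σ-mono n e)

  Σ-head : ∀ n f → Σ< (suc n) f ≡ f 0 + Σ< n (λ x → f (suc x))
  Σ-head zero    f = trans (+-identityˡ (f 0)) (sym (+-identityʳ (f 0)))
  Σ-head (suc n) f = trans (cong (_+ f (suc n)) (Σ-head n f)) (+-assoc (f 0) _ _)

  Σ-split : ∀ m n f → Σ< (m ℕ.+ n) f ≡ Σ< m f + Σ< n (λ x → f (m ℕ.+ x))
  Σ-split m zero    f rewrite ℕ.+-identityʳ m = sym (+-identityʳ (Σ< m f))
  Σ-split m (suc n) f rewrite ℕ.+-suc m n =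
    trans (cong (_+ f (m ℕ.+ n)) (Σ-split m n f)) (+-assoc (Σ< m f) _ _)

  -- A step of the shift trades the term `f u` for `f (n + u)`, and these are equal by periodicity.
  Σ-shift : ∀ n f u → Periodic n f → Σ< n (λ x → f (x ℕ.+ u)) ≡ Σ< n f
  Σ-shift n f zero    per = Σ-ext n (λ x → cong f (ℕ.+-identityʳ x))
  Σ-shift n f (suc u) per = begin
    Σ< n (λ x → f (x ℕ.+ suc u))          ≡⟨ Σ-ext n (λ x → cong f (ℕ.+-suc x u)) ⟩
    Σ< n (λ x → f (suc x ℕ.+ u))          ≡⟨ lemma (f u) _ ⟩
    f u + Σ< n (λ x → f (suc x ℕ.+ u)) - f u ≡⟨ cong (_- f u) (Σ-head n (λ x → f (x ℕ.+ u))) ⟨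
    Σ< n (λ x → f (x ℕ.+ u)) + f (n ℕ.+ u) - f u
      ≡⟨ cong (λ w → Σ< n (λ x → f (x ℕ.+ u)) + w - f u) (trans (cong f (ℕ.+-comm n u)) (per u)) ⟩
    Σ< n (λ x → f (x ℕ.+ u)) + f u - f u  ≡⟨ lemma′ _ (f u) ⟩
    Σ< n (λ x → f (x ℕ.+ u))              ≡⟨ Σ-shift n f u per ⟩
    Σ< n f                                ∎
    where
    open ≡-Reasoning
    lemma : ∀ a b → b ≡ a + b - a
    lemma = solve-∀
    lemma′ : ∀ b a → b + a - a ≡ b
    lemma′ = solve-∀

  Σ-periodic : ∀ m n f → Periodic n f → Σ< (m ℕ.* n) f ≡ + m * Σ< n f
  Σ-periodic zero    n f per = sym (*-zeroˡ (Σ< n f))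
  Σ-periodic (suc m) n f per = begin
    Σ< (n ℕ.+ m ℕ.* n) f                             ≡⟨ Σ-split n (m ℕ.* n) f ⟩
    Σ< n f + Σ< (m ℕ.* n) (λ x → f (n ℕ.+ x))        ≡⟨ cong (_+_ (Σ< n f))
      (Σ-ext (m ℕ.* n) (λ x → trans (cong f (ℕ.+-comm n x)) (per x))) ⟩
    Σ< n f + Σ< (m ℕ.* n) f                          ≡⟨ cong (_+_ (Σ< n f)) (Σ-periodic m n f per) ⟩
    Σ< n f + + m * Σ< n f                            ≡⟨ lemma (+ m) (Σ< n f) ⟩
    + suc m * Σ< n f                                 ∎
    where
    open ≡-Reasoning
    lemma : ∀ m s → s + m * s ≡ (1ℤ + m) * s
    lemma = solve-∀

  Σ-positive : ∀ n f → 0ℤ < Σ< n f → ∃ λ x → x ℕ.< n × 0ℤ < f x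
  Σ-positive zero    f (+<+ ())
  Σ-positive (suc n) f pos with 0ℤ <? f n
  ... | yes fn>0 = n , ℕ.n<1+n n , fn>0
  ... | no  fn≯0 with Σ-positive n f (<-≤-trans pos (≤-trans (+-monoʳ-≤ (Σ< n f) (≮⇒≥ fn≯0)) (≤-reflexive (+-identityʳ _))))
  ... | x , x<n , fx>0 = x , ℕ.m<n⇒m<1+n x<n , fx>0

  0≤i² : ∀ i → 0ℤ ≤ i * i
  0≤i² (+ n)                = subst (0ℤ ≤_) (pos-* n n) (+≤+ ℕ.z≤n)
  0≤i² -[1+ n ] = +≤+ ℕ.z≤n

  -- Cauchy–Schwarz, from Σ_s Σ_t (f s * g t - f t * g s)² ≥ 0.
  cauchy-schwarz : ∀ n (f g : ℕ → ℤ) →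
    Σ< n (λ t → f t * g t) * Σ< n (λ t → f t * g t) ≤ Σ< n (λ t → f t * f t) * Σ< n (λ t → g t * g t)
  cauchy-schwarz n f g = *-cancelˡ-≤-pos (A * A) (B * C) (+ 2)
    (0≤i-j⇒j≤i {+ 2 * (B * C)} {+ 2 * (A * A)} (subst (0ℤ ≤_) expand
      (Σ-nonneg n {λ s → Σ< n (λ t → X s t * X s t)} (λ s _ → Σ-nonneg n {λ t → X s t * X s t} (λ t _ → 0≤i² (X s t))))))
    where
    open ≡-Reasoning
    A B C : ℤ
    A = Σ< n (λ t → f t * g t)
    B = Σ< n (λ t → f t * f t)
    C = Σ< n (λ t → g t * g t)

    X : ℕ → ℕ → ℤ
    X s t = f s * g t - f t * g s

    square : ∀ a b c d → (a * b - c * d) * (a * b - c * d) ≡ ((a * a) * (b * b) + (d * d) * (c * c)) - (+ 2 * (a * d)) * (c * b)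
    square = solve-∀

    u v w : ℕ → ℕ → ℤ
    u s t = (f s * f s) * (g t * g t)
    v s t = (g s * g s) * (f t * f t)
    w s t = (+ 2 * (f s * g s)) * (f t * g t)

    inner : ∀ s → Σ< n (λ t → X s t * X s t)
                ≡ ((f s * f s) * C + (g s * g s) * B) - (+ 2 * (f s * g s)) * A
    inner s = begin
      Σ< n (λ t → X s t * X s t)                 ≡⟨ Σ-ext n (λ t → square (f s) (g t) (f t) (g s)) ⟩
      Σ< n (λ t → (u s t + v s t) - w s t)       ≡⟨ Σ-minus n (λ t → u s t + v s t) (w s) ⟩
      Σ< n (λ t → u s t + v s t) - Σ< n (w s)
        ≡⟨ cong₂ _-_ (trans (Σ-+ n (u s) (v s))
             (cong₂ _+_ (Σ-*ˡ n (f s * f s) (λ t → g t * g t)) (Σ-*ˡ n (g s * g s) (λ t → f t * f t))))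
             (Σ-*ˡ n (+ 2 * (f s * g s)) (λ t → f t * g t)) ⟩
      ((f s * f s) * C + (g s * g s) * B) - (+ 2 * (f s * g s)) * A ∎

    collect : ∀ a b c → (b * c + c * b) - ((+ 2 * a) * a) ≡ + 2 * (b * c) - + 2 * (a * a)
    collect = solve-∀

    expand : Σ< n (λ s → Σ< n (λ t → X s t * X s t)) ≡ + 2 * (B * C) - + 2 * (A * A)
    expand = begin
      Σ< n (λ s → Σ< n (λ t → X s t * X s t)) ≡⟨ Σ-ext n inner ⟩
      Σ< n (λ s → ((f s * f s) * C + (g s * g s) * B) - (+ 2 * (f s * g s)) * A)
        ≡⟨ Σ-minus n (λ s → (f s * f s) * C + (g s * g s) * B) (λ s → (+ 2 * (f s * g s)) * A) ⟩
      Σ< n (λ s → (f s * f s) * C + (g s * g s) * B) - Σ< n (λ s → (+ 2 * (f s * g s)) * A)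
        ≡⟨ cong₂ _-_ (trans (Σ-+ n (λ s → (f s * f s) * C) (λ s → (g s * g s) * B))
             (cong₂ _+_ (Σ-*ʳ n C (λ s → f s * f s)) (Σ-*ʳ n B (λ s → g s * g s))))
             (trans (Σ-*ʳ n A (λ s → + 2 * (f s * g s))) (cong (_* A) (Σ-*ˡ n (+ 2) (λ s → f s * g s)))) ⟩
      (B * C + C * B) - ((+ 2 * A) * A) ≡⟨ collect A B C ⟩
      + 2 * (B * C) - + 2 * (A * A) ∎

  ind : ∀ {P : Set} → Dec P → ℤ
  ind (yes _) = 1ℤ
  ind (no _)  = 0ℤ

  ind-cong : ∀ {P Q : Set} (d : Dec P) (e : Dec Q) → (P → Q) → (Q → P) → ind d ≡ ind e
  ind-cong (yes p) (yes q) f g = refl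
  ind-cong (yes p) (no ¬q) f g = contradiction (f p) ¬q
  ind-cong (no ¬p) (yes q) f g = contradiction (g q) ¬p
  ind-cong (no ¬p) (no ¬q) f g = refl

  ind-yes : ∀ {P : Set} (d : Dec P) → P → ind d ≡ 1ℤ
  ind-yes (yes _) p = refl
  ind-yes (no ¬p) p = contradiction p ¬p

  ind-no : ∀ {P : Set} (d : Dec P) → ¬ P → ind d ≡ 0ℤ
  ind-no (yes p) ¬p = contradiction p ¬p
  ind-no (no _)  ¬p = refl

  ind-0or1 : ∀ {P : Set} (d : Dec P) → (ind d ≡ 0ℤ × ¬ P) ⊎ (ind d ≡ 1ℤ × P)
  ind-0or1 (yes p) = inj₂ (refl , p)
  ind-0or1 (no ¬p) = inj₁ (refl , ¬p)

  ind≢0 : ∀ {P : Set} (d : Dec P) → ind d ≢ 0ℤ → P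
  ind≢0 (yes p) _   = p
  ind≢0 (no _)  0≢0 = contradiction refl 0≢0

  0≤ind : ∀ {P : Set} (d : Dec P) → 0ℤ ≤ ind d
  0≤ind (yes _) = +≤+ ℕ.z≤n
  0≤ind (no _)  = +≤+ ℕ.z≤n

  Σ-single : ∀ n j (f : ℕ → ℤ) → j ℕ.< n → (∀ x → x ℕ.< n → x ≢ j → f x ≡ 0ℤ) → Σ< n f ≡ f j
  Σ-single (suc n) j f j<1+n off with j ℕ.≟ n
  ... | yes refl = trans (cong (_+ f n) (trans (Σ-cong n (λ x x<n → off x (ℕ.m<n⇒m<1+n x<n) (λ eq → ℕ.<-irrefl eq x<n))) (Σ-zero n))) (+-identityˡ (f n))
  ... | no  j≢n  = trans (cong₂ _+_ (Σ-single n j f (ℕ.≤∧≢⇒< (ℕ.<⇒≤pred j<1+n) j≢n) (λ x x<n → off x (ℕ.m<n⇒m<1+n x<n)))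
                                    (off n (ℕ.n<1+n n) (λ eq → j≢n (sym eq))))
                         (+-identityʳ (f j))

-- Ramanujan sums of squarefree modulus and their convolution identity.

module RamanujanSums where
  open FiniteSums
  open import Data.Integer using (ℤ; +_; -_; _+_; _*_; _-_; _≤_; 0ℤ; 1ℤ; ∣_∣; -[1+_]; -≤+)
  open import Data.Integer.Properties
  open import Data.Integer.Tactic.RingSolver using (solve-∀)
  open import Relation.Binary.PropositionalEquality

  ∣-cancelʳ-+ : ∀ {p a b} → p ∣ b → p ∣ a ℕ.+ b → p ∣ a
  ∣-cancelʳ-+ {p} {a} {b} p∣b p∣a+b = ∣m+n∣m⇒∣n (subst (p ∣_) (ℕ.+-comm a b) p∣a+b) p∣b

  prime-∣-prime : ∀ {p r} → Prime p → Prime r → p ∣ r → p ≡ r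
  prime-∣-prime pp pr p∣r with prime⇒irreducible pr p∣r
  ... | inj₁ p≡1 = contradiction (subst Prime p≡1 pp) ¬prime[1]
  ... | inj₂ p≡r = p≡r

  prime-∤⇒coprime : ∀ {p d} → Prime p → ¬ p ∣ d → Coprime p d
  prime-∤⇒coprime pp p∤d (i∣p , i∣d) with prime⇒irreducible pp i∣p
  ... | inj₁ i≡1 = i≡1
  ... | inj₂ i≡p = contradiction (subst (_∣ _) i≡p i∣d) p∤d

  prime-∤-product : ∀ {p} → Prime p → ∀ {T} → All (λ r → ¬ p ∣ r) T → ¬ p ∣ product T
  prime-∤-product pp []       p∣1 = ¬prime[1] (subst Prime (∣1⇒≡1 p∣1) pp)
  prime-∤-product pp {r ∷ T} (p∤r ∷ p∤T) p∣ with euclidsLemma r (product T) pp p∣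
  ... | inj₁ p∣r = p∤r p∣r
  ... | inj₂ p∣T = prime-∤-product pp p∤T p∣T

  ∣-product : ∀ T → All (_∣ product T) T
  ∣-product []      = []
  ∣-product (r ∷ T) = m∣m*n (product T) ∷ All.map (∣n⇒∣m*n r) (∣-product T)

  -- The congruence u ≡ 1 (mod p) is stated without subtraction.
  coprime⇒≡1 : ∀ {p d} .{{_ : NonZero p}} → Coprime p d → ∃ λ u → d ∣ u × ∃ λ a → ∃ λ b → u ℕ.+ a ℕ.* p ≡ 1 ℕ.+ b ℕ.* p
  coprime⇒≡1 {suc p} {d} cop with coprime-Bézout cop
  ... | Bézout.-+ x y eq = y ℕ.* d , n∣m*n y , 0 , x , trans (ℕ.+-identityʳ (y ℕ.* d)) (sym eq)
  -- Here `1 + y * d` is a multiple of the modulus `suc p`, so `y * d` is -1; the factor `p`, which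
  -- is also -1, turns it into 1.
  ... | Bézout.+- x y eq = p ℕ.* y ℕ.* d , n∣m*n (p ℕ.* y) , x , y ℕ.* d , (begin
      p ℕ.* y ℕ.* d ℕ.+ x ℕ.* suc p          ≡⟨ cong (p ℕ.* y ℕ.* d ℕ.+_) (sym eq) ⟩
      p ℕ.* y ℕ.* d ℕ.+ (1 ℕ.+ y ℕ.* d)      ≡⟨ lemma p y d ⟩
      1 ℕ.+ y ℕ.* d ℕ.* suc p                ∎)
    where
    open ≡-Reasoning
    lemma : ∀ p y d → p ℕ.* y ℕ.* d ℕ.+ (1 ℕ.+ y ℕ.* d) ≡ 1 ℕ.+ y ℕ.* d ℕ.* (1 ℕ.+ p)
    lemma = ℕ.solve-∀

  dv : ℕ → ℕ → ℤ
  dv p t = ind (p ∣? t)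

  dv-cong : ∀ p {s t} → (p ∣ s → p ∣ t) → (p ∣ t → p ∣ s) → dv p s ≡ dv p t
  dv-cong p {s} {t} = ind-cong (p ∣? s) (p ∣? t)

  dv-+ : ∀ {p u} → p ∣ u → ∀ t → dv p (t ℕ.+ u) ≡ dv p t
  dv-+ {p} p∣u t = dv-cong p (∣-cancelʳ-+ p∣u) (λ p∣t → ∣m∣n⇒∣m+n p∣t p∣u)

  Σ-dv : ∀ p .{{_ : NonZero p}} t → Σ< p (λ j → dv p (j ℕ.+ t)) ≡ 1ℤ
  Σ-dv p@(suc _) t = begin
    Σ< p (λ j → dv p (j ℕ.+ t)) ≡⟨ Σ-shift p (dv p) t (dv-+ ∣-refl) ⟩
    Σ< p (dv p)                 ≡⟨ Σ-single p 0 (dv p) ℕ.z<s (λ { zero _ 0≢0 → contradiction refl 0≢0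
                                     ; (suc x) x<p _ → ind-no (p ∣? suc x) (λ p∣x → ℕ.<⇒≱ x<p (∣⇒≤ p∣x)) }) ⟩
    dv p 0                      ≡⟨ ind-yes (p ∣? 0) (p ∣0) ⟩
    1ℤ                          ∎
    where open ≡-Reasoning

  -- c p is the Ramanujan sum of prime modulus p, that is, the sum of all additive characters of exact order p.
  c : ℕ → ℕ → ℤ
  c p t = + p * dv p t - 1ℤ

  -- For distinct primes this is the Ramanujan sum of modulus `product T`, by multiplicativity.
  -- Moduli are kept as lists so that inductions remove one prime at a time.
  cT : List ℕ → ℕ → ℤ
  cT []      t = 1ℤ
  cT (p ∷ T) t = c p t * cT T t

  -- Euler's function at `product T` for distinct primes: the number of characters of that exact
  -- order.
  φ : List ℕ → ℕ
  φ []      = 1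
  φ (p ∷ T) = (p ℕ.∸ 1) ℕ.* φ T

  c-periodic : ∀ {p u} → p ∣ u → Periodic u (c p)
  c-periodic {p} p∣u t = cong (λ e → + p * e - 1ℤ) (dv-+ p∣u t)

  cT-periodic : ∀ {u T} → All (_∣ u) T → Periodic u (cT T)
  cT-periodic []          t = refl
  cT-periodic (p∣u ∷ T∣u) t = cong₂ _*_ (c-periodic p∣u t) (cT-periodic T∣u t)

  periodic-* : ∀ {u f} → Periodic u f → ∀ j → Periodic (j ℕ.* u) f
  periodic-* {u} {f} per zero    x = cong f (ℕ.+-identityʳ x)
  periodic-* {u} {f} per (suc j) x = begin
    f (x ℕ.+ (u ℕ.+ j ℕ.* u)) ≡⟨ cong f (lemma x u (j ℕ.* u)) ⟩
    f (x ℕ.+ j ℕ.* u ℕ.+ u)   ≡⟨ per (x ℕ.+ j ℕ.* u) ⟩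
    f (x ℕ.+ j ℕ.* u)         ≡⟨ periodic-* per j x ⟩
    f x                       ∎
    where
    open ≡-Reasoning
    lemma : ∀ x u w → x ℕ.+ (u ℕ.+ w) ≡ x ℕ.+ w ℕ.+ u
    lemma = ℕ.solve-∀

  periodic-shift : ∀ {u f} → Periodic u f → ∀ z → Periodic u (λ x → f (x ℕ.+ z))
  periodic-shift {u} {f} per z x = trans (cong f (lemma x u z)) (per (x ℕ.+ z))
    where
    lemma : ∀ x u z → x ℕ.+ u ℕ.+ z ≡ x ℕ.+ z ℕ.+ u
    lemma = ℕ.solve-∀

  -- Makes the product affine in two divisibility indicators, each of total 1 over a full residue
  -- system; the bracket then sums to 0 and `+ p * c p z` remains. If `p` divides `s`, then
  -- `c p (s + z)` is `c p z`; otherwise the first factor is -1.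
  c-product : ∀ p s z → c p s * c p (s ℕ.+ z)
            ≡ (+ p * c p z) * dv p s + (1ℤ - + p * dv p (s ℕ.+ z))
  c-product p s z with ind-0or1 (p ∣? s)
  ... | inj₁ (e , _) = begin
    c p s * c p (s ℕ.+ z) ≡⟨ cong (λ w → (+ p * w - 1ℤ) * c p (s ℕ.+ z)) e ⟩
    (+ p * 0ℤ - 1ℤ) * (+ p * dv p (s ℕ.+ z) - 1ℤ) ≡⟨ lemma (+ p) (dv p (s ℕ.+ z)) (c p z) ⟩
    (+ p * c p z) * 0ℤ + (1ℤ - + p * dv p (s ℕ.+ z)) ≡⟨ cong (λ w → (+ p * c p z) * w + (1ℤ - + p * dv p (s ℕ.+ z))) e ⟨
    (+ p * c p z) * dv p s + (1ℤ - + p * dv p (s ℕ.+ z)) ∎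
    where
    open ≡-Reasoning
    lemma : ∀ p d k → (p * 0ℤ - 1ℤ) * (p * d - 1ℤ) ≡ (p * k) * 0ℤ + (1ℤ - p * d)
    lemma = solve-∀
  ... | inj₂ (e , p∣s) = begin
    c p s * c p (s ℕ.+ z) ≡⟨ cong₂ (λ w w′ → (+ p * w - 1ℤ) * (+ p * w′ - 1ℤ)) e d≡ ⟩
    (+ p * 1ℤ - 1ℤ) * (+ p * dv p z - 1ℤ) ≡⟨ lemma (+ p) (dv p z) ⟩
    (+ p * c p z) * 1ℤ + (1ℤ - + p * dv p z) ≡⟨ cong₂ (λ w w′ → (+ p * c p z) * w + (1ℤ - + p * w′)) (sym e) (sym d≡) ⟩
    (+ p * c p z) * dv p s + (1ℤ - + p * dv p (s ℕ.+ z)) ∎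
    where
    open ≡-Reasoning
    d≡ : dv p (s ℕ.+ z) ≡ dv p z
    d≡ = trans (cong (dv p) (ℕ.+-comm s z)) (dv-+ p∣s z)
    lemma : ∀ p d → (p * 1ℤ - 1ℤ) * (p * d - 1ℤ) ≡ (p * (p * d - 1ℤ)) * 1ℤ + (1ℤ - p * d)
    lemma = solve-∀

  module _ (p : ℕ) .{{_ : NonZero p}} (u a b : ℕ) (u≡1 : u ℕ.+ a ℕ.* p ≡ 1 ℕ.+ b ℕ.* p) where

    -- Since `u` is 1 modulo `p`, the progression `t + j * u` runs through the residues as `j` does.
    dv-multiple : ∀ t j → dv p (t ℕ.+ j ℕ.* u) ≡ dv p (j ℕ.+ t)
    dv-multiple t j = begin
      dv p (t ℕ.+ j ℕ.* u)                          ≡⟨ dv-+ (n∣m*n (j ℕ.* a)) (t ℕ.+ j ℕ.* u) ⟨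
      dv p (t ℕ.+ j ℕ.* u ℕ.+ j ℕ.* a ℕ.* p)        ≡⟨ cong (dv p) (lemma₁ t j u a p) ⟩
      dv p (t ℕ.+ j ℕ.* (u ℕ.+ a ℕ.* p))            ≡⟨ cong (λ w → dv p (t ℕ.+ j ℕ.* w)) u≡1 ⟩
      dv p (t ℕ.+ j ℕ.* (1 ℕ.+ b ℕ.* p))            ≡⟨ cong (dv p) (lemma₂ t j b p) ⟩
      dv p (j ℕ.+ t ℕ.+ j ℕ.* b ℕ.* p)              ≡⟨ dv-+ (n∣m*n (j ℕ.* b)) (j ℕ.+ t) ⟩
      dv p (j ℕ.+ t)                                ∎
      where
      open ≡-Reasoning
      lemma₁ : ∀ t j u a p → t ℕ.+ j ℕ.* u ℕ.+ j ℕ.* a ℕ.* p ≡ t ℕ.+ j ℕ.* (u ℕ.+ a ℕ.* p)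
      lemma₁ = ℕ.solve-∀
      lemma₂ : ∀ t j b p → t ℕ.+ j ℕ.* (1 ℕ.+ b ℕ.* p) ≡ j ℕ.+ t ℕ.+ j ℕ.* b ℕ.* p
      lemma₂ = ℕ.solve-∀

    Σ-dv-multiple : ∀ t → Σ< p (λ j → dv p (t ℕ.+ j ℕ.* u)) ≡ 1ℤ
    Σ-dv-multiple t = trans (Σ-ext p (dv-multiple t)) (Σ-dv p t)

    Σ-c-multiple : ∀ t → Σ< p (λ j → c p (t ℕ.+ j ℕ.* u)) ≡ 0ℤ
    Σ-c-multiple t = begin
      Σ< p (λ j → + p * dv p (t ℕ.+ j ℕ.* u) - 1ℤ)
        ≡⟨ Σ-minus p (λ j → + p * dv p (t ℕ.+ j ℕ.* u)) (λ _ → 1ℤ) ⟩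
      Σ< p (λ j → + p * dv p (t ℕ.+ j ℕ.* u)) - Σ< p (λ _ → 1ℤ)
        ≡⟨ cong₂ _-_ (trans (Σ-*ˡ p (+ p) (λ j → dv p (t ℕ.+ j ℕ.* u))) (cong (+ p *_) (Σ-dv-multiple t))) (Σ-const p 1ℤ) ⟩
      + p * 1ℤ - + p * 1ℤ ≡⟨ +-inverseʳ (+ p * 1ℤ) ⟩
      0ℤ ∎
      where open ≡-Reasoning

    Σ-c-correlation : ∀ z t → Σ< p (λ j → c p (t ℕ.+ j ℕ.* u) * c p (t ℕ.+ j ℕ.* u ℕ.+ z)) ≡ + p * c p z
    Σ-c-correlation z t = begin
      Σ< p (λ j → c p (s j) * c p (s j ℕ.+ z))
        ≡⟨ Σ-ext p (λ j → c-product p (s j) z) ⟩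
      Σ< p (λ j → (+ p * c p z) * dv p (s j) + (1ℤ - + p * dv p (s j ℕ.+ z)))
        ≡⟨ Σ-+ p (λ j → (+ p * c p z) * dv p (s j)) (λ j → 1ℤ - + p * dv p (s j ℕ.+ z)) ⟩
      Σ< p (λ j → (+ p * c p z) * dv p (s j)) + Σ< p (λ j → 1ℤ - + p * dv p (s j ℕ.+ z))
        ≡⟨ cong₂ _+_ (trans (Σ-*ˡ p (+ p * c p z) (λ j → dv p (s j))) (cong ((+ p * c p z) *_) (Σ-dv-multiple t)))
                     (Σ-minus p (λ _ → 1ℤ) (λ j → + p * dv p (s j ℕ.+ z))) ⟩
      (+ p * c p z) * 1ℤ + (Σ< p (λ _ → 1ℤ) - Σ< p (λ j → + p * dv p (s j ℕ.+ z)))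
        ≡⟨ cong₂ (λ x y → (+ p * c p z) * 1ℤ + (x - y)) (Σ-const p 1ℤ)
             (trans (Σ-*ˡ p (+ p) (λ j → dv p (s j ℕ.+ z))) (cong (+ p *_) shifted)) ⟩
      (+ p * c p z) * 1ℤ + (+ p * 1ℤ - + p * 1ℤ) ≡⟨ lemma (+ p * c p z) (+ p) ⟩
      + p * c p z ∎
      where
      open ≡-Reasoning
      s : ℕ → ℕ
      s j = t ℕ.+ j ℕ.* u
      swap : ∀ t w z → t ℕ.+ w ℕ.+ z ≡ t ℕ.+ z ℕ.+ w
      swap = ℕ.solve-∀
      shifted : Σ< p (λ j → dv p (s j ℕ.+ z)) ≡ 1ℤ
      shifted = trans (Σ-ext p (λ j → cong (dv p) (swap t (j ℕ.* u) z))) (Σ-dv-multiple (t ℕ.+ z))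
      lemma : ∀ x p → x * 1ℤ + (p * 1ℤ - p * 1ℤ) ≡ x
      lemma = solve-∀

  -- Averaging over the shifts by multiples of u only affects the factor H.
  Σ-average : ∀ N (p : ℕ) u (G H : ℕ → ℤ) κ → Periodic u G → Periodic N (λ t → G t * H t) →
    (∀ t → Σ< p (λ j → H (t ℕ.+ j ℕ.* u)) ≡ κ) → + p * Σ< N (λ t → G t * H t) ≡ κ * Σ< N G
  Σ-average N p u G H κ perG perGH avg = begin
    + p * Σ< N (λ t → G t * H t)                              ≡⟨ Σ-const p (Σ< N (λ t → G t * H t)) ⟨
    Σ< p (λ j → Σ< N (λ t → G t * H t))                       ≡⟨ Σ-ext p (λ j → Σ-shift N (λ t → G t * H t) (j ℕ.* u) perGH) ⟨
    Σ< p (λ j → Σ< N (λ t → G (t ℕ.+ j ℕ.* u) * H (t ℕ.+ j ℕ.* u)))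
      ≡⟨ Σ-ext p (λ j → Σ-ext N (λ t → cong (_* H (t ℕ.+ j ℕ.* u)) (periodic-* perG j t))) ⟩
    Σ< p (λ j → Σ< N (λ t → G t * H (t ℕ.+ j ℕ.* u)))         ≡⟨ Σ-swap p N (λ j t → G t * H (t ℕ.+ j ℕ.* u)) ⟩
    Σ< N (λ t → Σ< p (λ j → G t * H (t ℕ.+ j ℕ.* u)))
      ≡⟨ Σ-ext N (λ t → trans (Σ-*ˡ p (G t) (λ j → H (t ℕ.+ j ℕ.* u))) (cong (G t *_) (avg t))) ⟩
    Σ< N (λ t → G t * κ)                                      ≡⟨ Σ-*ʳ N κ G ⟩
    Σ< N G * κ                                                ≡⟨ *-comm (Σ< N G) κ ⟩
    κ * Σ< N G                                                ∎
    where open ≡-Reasoning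

  -- Chinese remainder theorem: shifts by multiples of `u` run through the residues modulo `p` and
  -- are invisible modulo the primes in `T`.
  shift-for : ∀ {p T} → Prime p → All Prime T → All (p ≢_) T →
    ∃ λ u → All (_∣ u) T × ∃ λ a → ∃ λ b → u ℕ.+ a ℕ.* p ≡ 1 ℕ.+ b ℕ.* p
  shift-for {p} {T} pp pT p≢T with coprime⇒≡1 {{prime⇒nonZero pp}} (prime-∤⇒coprime pp (prime-∤-product pp (All.zipWith (λ (pr , p≢r) p∣r → p≢r (prime-∣-prime pp pr p∣r)) (pT , p≢T))))
  ... | u , T∣u , ab = u , All.map (λ r∣ → ∣-trans r∣ T∣u) (∣-product T) , ab

  -- The identity `c_d * c_d = N c_d`, with correlation in place of convolution because Ramanujan
  -- sums are even. Instead of orthogonality of characters, the Chinese remainder shift averages the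
  -- factor at `p` while the others stay fixed; this costs a factor `p`, cancelled at the end.
  Σ-cT-correlation : ∀ N {T} → All Prime T → AllPairs _≢_ T → All (_∣ N) T → ∀ z →
    Σ< N (λ t → cT T t * cT T (t ℕ.+ z)) ≡ + N * cT T z
  Σ-cT-correlation N []        []         []          z = Σ-const N 1ℤ
  Σ-cT-correlation N {p ∷ T} (pp ∷ pT) (p≢T ∷ dT) (p∣N ∷ T∣N) z
    with u , T∣u , a , b , u≡1 ← shift-for pp pT p≢T =
    *-cancelˡ-≡ (+ p) (Σ< N (λ t → cT (p ∷ T) t * cT (p ∷ T) (t ℕ.+ z))) (+ N * cT (p ∷ T) z) {{prime⇒nonZero pp}} (begin
      + p * Σ< N (λ t → cT (p ∷ T) t * cT (p ∷ T) (t ℕ.+ z))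
        ≡⟨ cong (+ p *_) (Σ-ext N (λ t → lemma₁ (c p t) (cT T t) (c p (t ℕ.+ z)) (cT T (t ℕ.+ z)))) ⟩
      + p * Σ< N (λ t → G t * H t)
        ≡⟨ Σ-average N p u G H (+ p * c p z) perG perGH (Σ-c-correlation p {{prime⇒nonZero pp}} u a b u≡1 z) ⟩
      (+ p * c p z) * Σ< N G
        ≡⟨ cong ((+ p * c p z) *_) (Σ-cT-correlation N pT dT T∣N z) ⟩
      (+ p * c p z) * (+ N * cT T z)
        ≡⟨ lemma₂ (+ p) (c p z) (+ N) (cT T z) ⟩
      + p * (+ N * cT (p ∷ T) z) ∎)
    where
    open ≡-Reasoning
    G H : ℕ → ℤ
    G t = cT T t * cT T (t ℕ.+ z)
    H t = c p t * c p (t ℕ.+ z)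
    lemma₁ : ∀ a b c d → (a * b) * (c * d) ≡ (b * d) * (a * c)
    lemma₁ = solve-∀
    lemma₂ : ∀ p a n b → (p * a) * (n * b) ≡ p * (n * (a * b))
    lemma₂ = solve-∀
    perG : Periodic u G
    perG t = cong₂ _*_ (cT-periodic T∣u t) (periodic-shift (cT-periodic T∣u) z t)
    perGH : Periodic N (λ t → G t * H t)
    perGH t = cong₂ _*_ (cong₂ _*_ (cT-periodic T∣N t) (periodic-shift (cT-periodic T∣N) z t))
                        (cong₂ _*_ (c-periodic p∣N t) (periodic-shift (c-periodic p∣N) z t))

  -- One prime suffices: its factor has mean zero along the shifts `j * u`, which the remaining
  -- factors do not see.
  Σ-cT-zero : ∀ N {p T} → All Prime (p ∷ T) → AllPairs _≢_ (p ∷ T) → All (_∣ N) (p ∷ T) → Σ< N (cT (p ∷ T)) ≡ 0ℤ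
  Σ-cT-zero N {p} {T} (pp ∷ pT) (p≢T ∷ dT) (p∣N ∷ T∣N)
    with u , T∣u , a , b , u≡1 ← shift-for pp pT p≢T =
    *-cancelˡ-≡ (+ p) (Σ< N (cT (p ∷ T))) 0ℤ {{prime⇒nonZero pp}} (begin
      + p * Σ< N (cT (p ∷ T))          ≡⟨ cong (+ p *_) (Σ-ext N (λ t → *-comm (c p t) (cT T t))) ⟩
      + p * Σ< N (λ t → cT T t * c p t) ≡⟨ Σ-average N p u (cT T) (c p) 0ℤ (cT-periodic T∣u)
                                            (λ t → cong₂ _*_ (cT-periodic T∣N t) (c-periodic p∣N t))
                                            (Σ-c-multiple p {{prime⇒nonZero pp}} u a b u≡1) ⟩
      0ℤ * Σ< N (cT T)                 ≡⟨ *-zeroˡ (Σ< N (cT T)) ⟩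
      0ℤ                               ≡⟨ *-zeroʳ (+ p) ⟨
      + p * 0ℤ                         ∎)
    where open ≡-Reasoning

  prime⇒2≤ : ∀ {p} → Prime p → 2 ℕ.≤ p
  prime⇒2≤ pp = ℕ.nonTrivial⇒n>1 _ {{prime⇒nonTrivial pp}}

  c-∣ : ∀ {p t} → Prime p → p ∣ t → c p t ≡ + (p ℕ.∸ 1)
  c-∣ {suc p} {t} pp p∣t = trans (cong (λ e → + suc p * e - 1ℤ) (ind-yes (suc p ∣? t) p∣t)) (lemma (+ p))
    where
    lemma : ∀ p → (1ℤ + p) * 1ℤ - 1ℤ ≡ p
    lemma = solve-∀
  c-∣ {zero} pp p∣t = contradiction pp ¬prime[0]

  ∣c∣≤ : ∀ {p} → Prime p → ∀ t → ∣ c p t ∣ ℕ.≤ p ℕ.∸ 1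
  ∣c∣≤ {p} pp t with ind-0or1 (p ∣? t)
  ... | inj₁ (e , _)   = subst (λ w → ∣ w ∣ ℕ.≤ p ℕ.∸ 1) (sym (trans (cong (λ e → + p * e - 1ℤ) e) (cong (_- 1ℤ) (*-zeroʳ (+ p))))) (ℕ.∸-monoˡ-≤ 1 (prime⇒2≤ pp))
  ... | inj₂ (_ , p∣t) = ℕ.≤-reflexive (cong ∣_∣ (c-∣ pp p∣t))

  ∣cT∣≤ : ∀ {T} → All Prime T → ∀ t → ∣ cT T t ∣ ℕ.≤ φ T
  ∣cT∣≤ []        t = ℕ.≤-refl
  ∣cT∣≤ {p ∷ T} (pp ∷ pT) t = subst (ℕ._≤ φ (p ∷ T)) (sym (abs-* (c p t) (cT T t))) (ℕ.*-mono-≤ (∣c∣≤ pp t) (∣cT∣≤ pT t))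

  cT-0 : ∀ {T} → All Prime T → cT T 0 ≡ + φ T
  cT-0 []                   = refl
  cT-0 {p ∷ T} (pp ∷ pT) = trans (cong₂ _*_ (c-∣ pp (p ∣0)) (cT-0 pT)) (sym (pos-* (p ℕ.∸ 1) (φ T)))

  i≤∣i∣ : ∀ i → i ≤ + ∣ i ∣
  i≤∣i∣ (+ n)                = ≤-refl
  i≤∣i∣ -[1+ n ] = -≤+

-- Bounds for the sums of Ramanujan sums over a difference set.

module CharacterSumBounds where
  open FiniteSums
  open RamanujanSums
  open import Data.Integer using (ℤ; +_; -_; _+_; _*_; _-_; _≤_; 0ℤ; 1ℤ; +≤+; ∣_∣; -[1+_]; nonNegative; Positive; positive; +<+)
  open import Data.Integer.Properties
  open import Data.Integer.Tactic.RingSolver using (solve-∀)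
  open import Relation.Binary.PropositionalEquality
  open import Data.Nat using (_^_)

  ∣i∣²≡i² : ∀ i → + (∣ i ∣ ℕ.* ∣ i ∣) ≡ i * i
  ∣i∣²≡i² (+ n)                = pos-* n n
  ∣i∣²≡i² -[1+ n ] = refl

  m²≤n²⇒m≤n : ∀ {m n} → m ℕ.* m ℕ.≤ n ℕ.* n → m ℕ.≤ n
  m²≤n²⇒m≤n {m} {n} m²≤n² with m ℕ.≤? n
  ... | yes m≤n = m≤n
  ... | no  m≰n = contradiction m²≤n² (ℕ.<⇒≱ (ℕ.*-mono-< (ℕ.≰⇒> m≰n) (ℕ.≰⇒> m≰n)))

  -- e L x is the product of L if no p ∈ L divides x, and 0 otherwise.
  e : List ℕ → ℕ → ℤ
  e []      x = 1ℤ
  e (p ∷ L) x = (+ (p ℕ.∸ 1) - c p x) * e L x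

  -- A difference set up to inequalities: `l` bounds every autocorrelation from below, `m` bounds
  -- the total excess over `l`, and `b` stands for √m so that all estimates stay in the integers.
  module Sieve (N : ℕ) .{{_ : NonZero N}} (D : ℕ → ℤ) (perD : Periodic N D) (l : ℤ) (m b : ℕ)
    (correlation : ∀ z → l ≤ Σ< N (λ x → D x * D (x ℕ.+ z)))
    (total : Σ< N D * Σ< N D - + N * l ≤ + m) (m≤b² : m ℕ.≤ b ℕ.* b) where

    X : List ℕ → ℤ
    X T = Σ< N (λ x → D x * cT T x)

    -- The autocorrelation of `D`: for an indicator, the number of points shared with a translate.
    Λ : ℕ → ℤ
    Λ z = Σ< N (λ x → D x * D (x ℕ.+ z))

    Σ-Λ : Σ< N Λ ≡ Σ< N D * Σ< N D
    Σ-Λ = begin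
      Σ< N (λ z → Σ< N (λ x → D x * D (x ℕ.+ z)))   ≡⟨ Σ-swap N N (λ z x → D x * D (x ℕ.+ z)) ⟩
      Σ< N (λ x → Σ< N (λ z → D x * D (x ℕ.+ z)))   ≡⟨ Σ-ext N (λ x → Σ-*ˡ N (D x) (λ z → D (x ℕ.+ z))) ⟩
      Σ< N (λ x → D x * Σ< N (λ z → D (x ℕ.+ z)))
        ≡⟨ Σ-ext N (λ x → cong (D x *_) (trans (Σ-ext N (λ z → cong D (ℕ.+-comm x z))) (Σ-shift N D x perD))) ⟩
      Σ< N (λ x → D x * Σ< N D)                     ≡⟨ Σ-*ʳ N (Σ< N D) D ⟩
      Σ< N D * Σ< N D                               ∎
      where open ≡-Reasoning

    module _ {T : List ℕ} (pT : All Prime T) (dT : AllPairs _≢_ T) (T∣N : All (_∣ N) T) where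

      -- Up to reflection, `v` carries just the Fourier components of `D` at the characters of exact
      -- order `product T`. Pairing `cT T` with `v` instead of `D` keeps the other components out of
      -- Cauchy-Schwarz.
      v : ℕ → ℤ
      v t = Σ< N (λ x → D x * cT T (x ℕ.+ t))

      perC : Periodic N (cT T)
      perC = cT-periodic T∣N

      Σ-cT² : Σ< N (λ t → cT T t * cT T t) ≡ + N * + φ T
      Σ-cT² = begin
        Σ< N (λ t → cT T t * cT T t)          ≡⟨ Σ-ext N (λ t → cong (λ w → cT T t * cT T w) (sym (ℕ.+-identityʳ t))) ⟩
        Σ< N (λ t → cT T t * cT T (t ℕ.+ 0))  ≡⟨ Σ-cT-correlation N pT dT T∣N 0 ⟩
        + N * cT T 0                          ≡⟨ cong (+ N *_) (cT-0 pT) ⟩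
        + N * + φ T                           ∎
        where open ≡-Reasoning

      -- Correlating with `cT T` a second time only multiplies by `N`, so the pairing recovers
      -- `X T`, the value of `v` at 0.
      Σ-cT-v : Σ< N (λ t → cT T t * v t) ≡ + N * X T
      Σ-cT-v = begin
        Σ< N (λ t → cT T t * v t)
          ≡⟨ Σ-ext N (λ t → Σ-*ˡ N (cT T t) (λ x → D x * cT T (x ℕ.+ t))) ⟨
        Σ< N (λ t → Σ< N (λ x → cT T t * (D x * cT T (x ℕ.+ t))))
          ≡⟨ Σ-swap N N (λ t x → cT T t * (D x * cT T (x ℕ.+ t))) ⟩
        Σ< N (λ x → Σ< N (λ t → cT T t * (D x * cT T (x ℕ.+ t))))
          ≡⟨ Σ-ext N (λ x → trans (Σ-ext N (λ t → trans (lemma (cT T t) (D x) (cT T (x ℕ.+ t)))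
                                                         (cong (λ w → D x * (cT T t * cT T w)) (ℕ.+-comm x t))))
                                  (Σ-*ˡ N (D x) (λ t → cT T t * cT T (t ℕ.+ x)))) ⟩
        Σ< N (λ x → D x * Σ< N (λ t → cT T t * cT T (t ℕ.+ x)))
          ≡⟨ Σ-ext N (λ x → trans (cong (D x *_) (Σ-cT-correlation N pT dT T∣N x)) (lemma (D x) (+ N) (cT T x))) ⟩
        Σ< N (λ x → + N * (D x * cT T x))
          ≡⟨ Σ-*ˡ N (+ N) (λ x → D x * cT T x) ⟩
        + N * X T ∎
        where
        open ≡-Reasoning
        lemma : ∀ a b c → a * (b * c) ≡ b * (a * c)
        lemma = solve-∀

      -- With the summation variable moved by `x`, the factor `cT T (t + x)` meets
      -- `cT T (t + x + z)`, and the sum over `t` becomes an autocorrelation at lag `z` that does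
      -- not depend on `x`.
      v-recentred : ∀ x t → v t ≡ Σ< N (λ z → D (z ℕ.+ x) * cT T (t ℕ.+ x ℕ.+ z))
      v-recentred x t = trans
        (sym (Σ-shift N (λ y → D y * cT T (y ℕ.+ t)) x (λ y → cong₂ _*_ (perD y) (periodic-shift perC t y))))
        (Σ-ext N (λ z → cong (λ w → D (z ℕ.+ x) * cT T w) (lemma z x t)))
        where
        lemma : ∀ z x t → z ℕ.+ x ℕ.+ t ≡ t ℕ.+ x ℕ.+ z
        lemma = ℕ.solve-∀

      Σ-cT-v-shifted : ∀ x → Σ< N (λ t → cT T (x ℕ.+ t) * v t) ≡ + N * Σ< N (λ z → cT T z * D (x ℕ.+ z))
      Σ-cT-v-shifted x = begin
        Σ< N (λ t → cT T (x ℕ.+ t) * v t)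
          ≡⟨ Σ-ext N (λ t → cong₂ _*_ (cong (cT T) (ℕ.+-comm x t)) (v-recentred x t)) ⟩
        Σ< N (λ t → cT T (t ℕ.+ x) * Σ< N (λ z → D (z ℕ.+ x) * cT T (t ℕ.+ x ℕ.+ z)))
          ≡⟨ Σ-ext N (λ t → Σ-*ˡ N (cT T (t ℕ.+ x)) (λ z → D (z ℕ.+ x) * cT T (t ℕ.+ x ℕ.+ z))) ⟨
        Σ< N (λ t → Σ< N (λ z → cT T (t ℕ.+ x) * (D (z ℕ.+ x) * cT T (t ℕ.+ x ℕ.+ z))))
          ≡⟨ Σ-swap N N (λ t z → cT T (t ℕ.+ x) * (D (z ℕ.+ x) * cT T (t ℕ.+ x ℕ.+ z))) ⟩
        Σ< N (λ z → Σ< N (λ t → cT T (t ℕ.+ x) * (D (z ℕ.+ x) * cT T (t ℕ.+ x ℕ.+ z))))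
          ≡⟨ Σ-ext N (λ z → trans (Σ-ext N (λ t → lemma₁ (cT T (t ℕ.+ x)) (D (z ℕ.+ x)) (cT T (t ℕ.+ x ℕ.+ z))))
                                  (Σ-*ˡ N (D (z ℕ.+ x)) (λ t → cT T (t ℕ.+ x) * cT T (t ℕ.+ x ℕ.+ z)))) ⟩
        Σ< N (λ z → D (z ℕ.+ x) * Σ< N (λ t → cT T (t ℕ.+ x) * cT T (t ℕ.+ x ℕ.+ z)))
          ≡⟨ Σ-ext N (λ z → cong (D (z ℕ.+ x) *_) (trans
               (Σ-shift N (λ t → cT T t * cT T (t ℕ.+ z)) x (λ t → cong₂ _*_ (perC t) (periodic-shift perC z t)))
               (Σ-cT-correlation N pT dT T∣N z))) ⟩
        Σ< N (λ z → D (z ℕ.+ x) * (+ N * cT T z))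
          ≡⟨ Σ-ext N (λ z → trans (lemma₂ (D (z ℕ.+ x)) (+ N) (cT T z)) (cong (λ w → + N * (cT T z * D w)) (ℕ.+-comm z x))) ⟩
        Σ< N (λ z → + N * (cT T z * D (x ℕ.+ z)))
          ≡⟨ Σ-*ˡ N (+ N) (λ z → cT T z * D (x ℕ.+ z)) ⟩
        + N * Σ< N (λ z → cT T z * D (x ℕ.+ z)) ∎
        where
        open ≡-Reasoning
        lemma₁ : ∀ a b c → a * (b * c) ≡ b * (a * c)
        lemma₁ = solve-∀
        lemma₂ : ∀ a b c → a * (b * c) ≡ b * (c * a)
        lemma₂ = solve-∀

      -- A Parseval identity: the energy of `v` depends on `D` only through `Λ`, which is what the
      -- difference set property controls.
      Σ-v² : Σ< N (λ t → v t * v t) ≡ + N * Σ< N (λ z → cT T z * Λ z)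
      Σ-v² = begin
        Σ< N (λ t → v t * v t)
          ≡⟨ Σ-ext N (λ t → Σ-*ʳ N (v t) (λ x → D x * cT T (x ℕ.+ t))) ⟨
        Σ< N (λ t → Σ< N (λ x → (D x * cT T (x ℕ.+ t)) * v t))
          ≡⟨ Σ-swap N N (λ t x → (D x * cT T (x ℕ.+ t)) * v t) ⟩
        Σ< N (λ x → Σ< N (λ t → (D x * cT T (x ℕ.+ t)) * v t))
          ≡⟨ Σ-ext N (λ x → trans (Σ-ext N (λ t → *-assoc (D x) (cT T (x ℕ.+ t)) (v t)))
                                  (Σ-*ˡ N (D x) (λ t → cT T (x ℕ.+ t) * v t))) ⟩
        Σ< N (λ x → D x * Σ< N (λ t → cT T (x ℕ.+ t) * v t))
          ≡⟨ Σ-ext N (λ x → trans (cong (D x *_) (Σ-cT-v-shifted x)) (lemma (D x) (+ N) (Σ< N (λ z → cT T z * D (x ℕ.+ z))))) ⟩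
        Σ< N (λ x → + N * (D x * Σ< N (λ z → cT T z * D (x ℕ.+ z))))
          ≡⟨ Σ-*ˡ N (+ N) (λ x → D x * Σ< N (λ z → cT T z * D (x ℕ.+ z))) ⟩
        + N * Σ< N (λ x → D x * Σ< N (λ z → cT T z * D (x ℕ.+ z)))
          ≡⟨ cong (+ N *_) (Σ-ext N (λ x → Σ-*ˡ N (D x) (λ z → cT T z * D (x ℕ.+ z)))) ⟨
        + N * Σ< N (λ x → Σ< N (λ z → D x * (cT T z * D (x ℕ.+ z))))
          ≡⟨ cong (+ N *_) (Σ-swap N N (λ x z → D x * (cT T z * D (x ℕ.+ z)))) ⟩
        + N * Σ< N (λ z → Σ< N (λ x → D x * (cT T z * D (x ℕ.+ z))))
          ≡⟨ cong (+ N *_) (Σ-ext N (λ z → trans (Σ-ext N (λ x → lemma (D x) (cT T z) (D (x ℕ.+ z))))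
                                                 (Σ-*ˡ N (cT T z) (λ x → D x * D (x ℕ.+ z))))) ⟩
        + N * Σ< N (λ z → cT T z * Λ z) ∎
        where
        open ≡-Reasoning
        lemma : ∀ a b c → a * (b * c) ≡ b * (a * c)
        lemma = solve-∀

      -- Since Λ ≥ l and Σ cT = 0, only the excess Λ - l counts, and its total is at most m.
      Σ-cT-Λ≤ : Σ< N (cT T) ≡ 0ℤ → Σ< N (λ z → cT T z * Λ z) ≤ + φ T * + m
      Σ-cT-Λ≤ Σ≡0 = begin
        Σ< N (λ z → cT T z * Λ z)
          ≡⟨ +-identityʳ (Σ< N (λ z → cT T z * Λ z)) ⟨
        Σ< N (λ z → cT T z * Λ z) - 0ℤ
          ≡⟨ cong (λ w → Σ< N (λ z → cT T z * Λ z) - w) (trans (Σ-*ʳ N l (cT T)) (trans (cong (_* l) Σ≡0) (*-zeroˡ l))) ⟨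
        Σ< N (λ z → cT T z * Λ z) - Σ< N (λ z → cT T z * l)
          ≡⟨ Σ-minus N (λ z → cT T z * Λ z) (λ z → cT T z * l) ⟨
        Σ< N (λ z → cT T z * Λ z - cT T z * l)
          ≡⟨ Σ-ext N (λ z → lemma (cT T z) (Λ z) l) ⟩
        Σ< N (λ z → cT T z * (Λ z - l))
          ≤⟨ Σ-mono N (λ z _ → *-monoʳ-≤-nonNeg (Λ z - l) {{nonNegative (i≤j⇒0≤j-i {l} {Λ z} (correlation z))}}
               (≤-trans (i≤∣i∣ (cT T z)) (+≤+ (∣cT∣≤ pT z)))) ⟩
        Σ< N (λ z → + φ T * (Λ z - l))
          ≡⟨ Σ-*ˡ N (+ φ T) (λ z → Λ z - l) ⟩
        + φ T * Σ< N (λ z → Λ z - l)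
          ≡⟨ cong (+ φ T *_) (trans (Σ-minus N Λ (λ _ → l)) (cong₂ _-_ Σ-Λ (Σ-const N l))) ⟩
        + φ T * (Σ< N D * Σ< N D - + N * l)
          ≤⟨ *-monoˡ-≤-nonNeg (+ φ T) total ⟩
        + φ T * + m ∎
        where
        open ≤-Reasoning
        lemma : ∀ a b c → a * b - a * c ≡ a * (b - c)
        lemma = solve-∀

      -- One factor `φ T` is the energy of `cT T`, the other its pointwise bound, used against the
      -- excess of `Λ`.
      X²≤ : Σ< N (cT T) ≡ 0ℤ → X T * X T ≤ (+ φ T * + φ T) * + m
      X²≤ Σ≡0 = *-cancelˡ-≤-pos (X T * X T) ((+ φ T * + φ T) * + m) (+ N * + N) {{pos*pos}} (begin
        (+ N * + N) * (X T * X T)                  ≡⟨ lemma₁ (+ N) (X T) ⟩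
        (+ N * X T) * (+ N * X T)                  ≡⟨ cong₂ _*_ (sym Σ-cT-v) (sym Σ-cT-v) ⟩
        Σ< N (λ t → cT T t * v t) * Σ< N (λ t → cT T t * v t)
          ≤⟨ cauchy-schwarz N (cT T) v ⟩
        Σ< N (λ t → cT T t * cT T t) * Σ< N (λ t → v t * v t)
          ≡⟨ cong₂ _*_ Σ-cT² Σ-v² ⟩
        (+ N * + φ T) * (+ N * Σ< N (λ z → cT T z * Λ z))
          ≡⟨ lemma₂ (+ N) (+ φ T) (Σ< N (λ z → cT T z * Λ z)) ⟩
        (+ N * + N) * (+ φ T * Σ< N (λ z → cT T z * Λ z))
          ≤⟨ *-monoˡ-≤-nonNeg (+ N * + N) {{nonNegative (0≤i² (+ N))}} (*-monoˡ-≤-nonNeg (+ φ T) (Σ-cT-Λ≤ Σ≡0)) ⟩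
        (+ N * + N) * (+ φ T * (+ φ T * + m))      ≡⟨ lemma₃ (+ N) (+ φ T) (+ m) ⟩
        (+ N * + N) * ((+ φ T * + φ T) * + m)      ∎)
        where
        open ≤-Reasoning
        pos*pos : Positive (+ N * + N)
        pos*pos = subst Positive (pos-* N N) (positive (+<+ (ℕ.>-nonZero⁻¹ (N ℕ.* N) {{ℕ.m*n≢0 N N}})))
        lemma₁ : ∀ n x → (n * n) * (x * x) ≡ (n * x) * (n * x)
        lemma₁ = solve-∀
        lemma₂ : ∀ n f s → (n * f) * (n * s) ≡ (n * n) * (f * s)
        lemma₂ = solve-∀
        lemma₃ : ∀ n f m → (n * n) * (f * (f * m)) ≡ (n * n) * ((f * f) * m)
        lemma₃ = solve-∀

      ∣X∣≤ : Σ< N (cT T) ≡ 0ℤ → ∣ X T ∣ ℕ.≤ φ T ℕ.* b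
      ∣X∣≤ Σ≡0 = m²≤n²⇒m≤n (drop‿+≤+ (begin
        + (∣ X T ∣ ℕ.* ∣ X T ∣)          ≡⟨ ∣i∣²≡i² (X T) ⟩
        X T * X T                        ≤⟨ X²≤ Σ≡0 ⟩
        (+ φ T * + φ T) * + m            ≡⟨ trans (cong (_* + m) (sym (pos-* (φ T) (φ T)))) (sym (pos-* (φ T ℕ.* φ T) m)) ⟩
        + (φ T ℕ.* φ T ℕ.* m)            ≤⟨ +≤+ (ℕ.*-monoʳ-≤ (φ T ℕ.* φ T) m≤b²) ⟩
        + (φ T ℕ.* φ T ℕ.* (b ℕ.* b))    ≡⟨ cong +_ (lemma (φ T) b) ⟩
        + (φ T ℕ.* b ℕ.* (φ T ℕ.* b))    ∎))
        where
        open ≤-Reasoning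
        lemma : ∀ f b → f ℕ.* f ℕ.* (b ℕ.* b) ≡ f ℕ.* b ℕ.* (f ℕ.* b)
        lemma = ℕ.solve-∀

    -- A half-expanded sum: the primes in `L` still occur as sieve factors, those in `T` already as
    -- Ramanujan sums. Expanding a sieve factor either drops its prime or moves it to `T`.
    S : List ℕ → List ℕ → ℤ
    S L T = Σ< N (λ x → D x * (e L x * cT T x))

    S-[] : ∀ T → S [] T ≡ X T
    S-[] T = Σ-ext N (λ x → cong (D x *_) (*-identityˡ (cT T x)))

    S-∷ : ∀ p L T → S (p ∷ L) T ≡ + (p ℕ.∸ 1) * S L T - S L (p ∷ T)
    S-∷ p L T = begin
      Σ< N (λ x → D x * (((+ (p ℕ.∸ 1) - c p x) * e L x) * cT T x))
        ≡⟨ Σ-ext N (λ x → lemma (D x) (+ (p ℕ.∸ 1)) (c p x) (e L x) (cT T x)) ⟩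
      Σ< N (λ x → + (p ℕ.∸ 1) * (D x * (e L x * cT T x)) - D x * (e L x * (c p x * cT T x)))
        ≡⟨ Σ-minus N (λ x → + (p ℕ.∸ 1) * (D x * (e L x * cT T x))) (λ x → D x * (e L x * (c p x * cT T x))) ⟩
      Σ< N (λ x → + (p ℕ.∸ 1) * (D x * (e L x * cT T x))) - S L (p ∷ T)
        ≡⟨ cong (_- S L (p ∷ T)) (Σ-*ˡ N (+ (p ℕ.∸ 1)) (λ x → D x * (e L x * cT T x))) ⟩
      + (p ℕ.∸ 1) * S L T - S L (p ∷ T) ∎
      where
      open ≡-Reasoning
      lemma : ∀ d p c e t → d * (((p - c) * e) * t) ≡ p * (d * (e * t)) - d * (e * (c * t))
      lemma = solve-∀

    Admissible : ℕ → Set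
    Admissible p = Prime p × p ∣ N

    -- Full expansion gives one sum `X` for each of the `2 ^ length L` subsets of `L`. All their
    -- moduli exceed 1, since `r ∷ T` is non-empty, so `∣X∣≤` applies; the weights `p - 1` of
    -- dropped primes and the `φ` of moved ones multiply to the same product in every term.
    ∣S∣≤ : ∀ {L r T} → All Admissible L → AllPairs _≢_ L → All (λ p → All (p ≢_) (r ∷ T)) L →
      All Admissible (r ∷ T) → AllPairs _≢_ (r ∷ T) → ∣ S L (r ∷ T) ∣ ℕ.≤ φ L ℕ.* φ (r ∷ T) ℕ.* 2 ^ length L ℕ.* b
    ∣S∣≤ {[]} {r} {T} [] [] [] aT dT = begin
      ∣ S [] (r ∷ T) ∣              ≡⟨ cong ∣_∣ (S-[] (r ∷ T)) ⟩
      ∣ X (r ∷ T) ∣                 ≤⟨ ∣X∣≤ pT dT T∣N (Σ-cT-zero N pT dT T∣N) ⟩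
      φ (r ∷ T) ℕ.* b               ≡⟨ lemma (φ (r ∷ T)) b ⟩
      1 ℕ.* φ (r ∷ T) ℕ.* 1 ℕ.* b   ∎
      where
      open ℕ.≤-Reasoning
      pT = All.map (λ (pr , _) → pr) aT
      T∣N = All.map (λ (_ , r∣N) → r∣N) aT
      lemma : ∀ f b → f ℕ.* b ≡ 1 ℕ.* f ℕ.* 1 ℕ.* b
      lemma = ℕ.solve-∀
    ∣S∣≤ {p ∷ L} {r} {T} (ap ∷ aL) (p≢L ∷ dL) (p≢T ∷ L≢T) aT dT = begin
      ∣ S (p ∷ L) T′ ∣                                      ≡⟨ cong ∣_∣ (S-∷ p L T′) ⟩
      ∣ + (p ℕ.∸ 1) * S L T′ - S L (p ∷ T′) ∣               ≤⟨ ∣i-j∣≤∣i∣+∣j∣ (+ (p ℕ.∸ 1) * S L T′) (S L (p ∷ T′)) ⟩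
      ∣ + (p ℕ.∸ 1) * S L T′ ∣ ℕ.+ ∣ S L (p ∷ T′) ∣         ≡⟨ cong (ℕ._+ ∣ S L (p ∷ T′) ∣) (abs-* (+ (p ℕ.∸ 1)) (S L T′)) ⟩
      (p ℕ.∸ 1) ℕ.* ∣ S L T′ ∣ ℕ.+ ∣ S L (p ∷ T′) ∣
        ≤⟨ ℕ.+-mono-≤ (ℕ.*-monoʳ-≤ (p ℕ.∸ 1) (∣S∣≤ aL dL L≢T aT dT))
                      (∣S∣≤ aL dL (All.zipWith (λ (p≢x , x≢T) → (λ x≡p → p≢x (sym x≡p)) ∷ x≢T) (p≢L , L≢T)) (ap ∷ aT) (p≢T ∷ dT)) ⟩
      (p ℕ.∸ 1) ℕ.* (φ L ℕ.* φ T′ ℕ.* 2 ^ length L ℕ.* b) ℕ.+ φ L ℕ.* ((p ℕ.∸ 1) ℕ.* φ T′) ℕ.* 2 ^ length L ℕ.* b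
        ≡⟨ lemma (p ℕ.∸ 1) (φ L) (φ T′) (2 ^ length L) b ⟩
      φ (p ∷ L) ℕ.* φ T′ ℕ.* 2 ^ length (p ∷ L) ℕ.* b ∎
      where
      open ℕ.≤-Reasoning
      T′ = r ∷ T
      lemma : ∀ p l t w b → p ℕ.* (l ℕ.* t ℕ.* w ℕ.* b) ℕ.+ l ℕ.* (p ℕ.* t) ℕ.* w ℕ.* b ≡ p ℕ.* l ℕ.* t ℕ.* (2 ℕ.* w) ℕ.* b
      lemma = ℕ.solve-∀

    -- The empty subset gives the main term `φ L * Σ< N D`; the other `2 ^ length L - 1` terms are
    -- errors of at most `φ L * b`. The subtracted 1 is the summand `+ b`, which later absorbs the
    -- rounding of √m.
    S≥ : ∀ {L} → All Admissible L → AllPairs _≢_ L →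
      + φ L * (Σ< N D + + b - + (2 ^ length L) * + b) ≤ S L []
    S≥ {[]} [] [] = ≤-reflexive (trans (lemma (Σ< N D) (+ b))
      (sym (trans (S-[] []) (Σ-ext N (λ x → *-identityʳ (D x))))))
      where
      lemma : ∀ a b → 1ℤ * (a + b - 1ℤ * b) ≡ a
      lemma = solve-∀
    S≥ {p ∷ L} (ap ∷ aL) (p≢L ∷ dL) = begin
      + φ (p ∷ L) * (A + + b - + (2 ℕ.* w) * + b)
        ≡⟨ cong₂ (λ x y → x * (A + + b - y * + b)) (pos-* (p ℕ.∸ 1) (φ L)) (pos-* 2 w) ⟩
      (+ (p ℕ.∸ 1) * + φ L) * (A + + b - (+ 2 * + w) * + b)
        ≡⟨ lemma (+ (p ℕ.∸ 1)) (+ φ L) A (+ b) (+ w) ⟩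
      + (p ℕ.∸ 1) * (+ φ L * (A + + b - + w * + b)) - + φ L * + (p ℕ.∸ 1) * + w * + b
        ≤⟨ +-mono-≤ (*-monoˡ-≤-nonNeg (+ (p ℕ.∸ 1)) (S≥ aL dL)) (neg-mono-≤ (begin
             S L (p ∷ [])                                ≤⟨ i≤∣i∣ (S L (p ∷ [])) ⟩
             + ∣ S L (p ∷ []) ∣                          ≤⟨ +≤+ (∣S∣≤ aL dL (All.map (λ p≢x → (λ x≡p → p≢x (sym x≡p)) ∷ []) p≢L) (ap ∷ []) ([] ∷ [])) ⟩
             + (φ L ℕ.* φ (p ∷ []) ℕ.* w ℕ.* b)          ≡⟨ cast ⟩
             + φ L * + (p ℕ.∸ 1) * + w * + b             ∎)) ⟩
      + (p ℕ.∸ 1) * S L [] - S L (p ∷ [])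
        ≡⟨ S-∷ p L [] ⟨
      S (p ∷ L) [] ∎
      where
      open ≤-Reasoning
      A = Σ< N D
      w = 2 ^ length L
      cast : + (φ L ℕ.* φ (p ∷ []) ℕ.* w ℕ.* b) ≡ + φ L * + (p ℕ.∸ 1) * + w * + b
      cast = trans (pos-* (φ L ℕ.* φ (p ∷ []) ℕ.* w) b) (cong (_* + b) (trans (pos-* (φ L ℕ.* φ (p ∷ [])) w)
        (cong (_* + w) (trans (pos-* (φ L) (φ (p ∷ []))) (cong (λ x → + φ L * + x) (ℕ.*-identityʳ (p ℕ.∸ 1)))))))
      lemma : ∀ p l a b w → (p * l) * (a + b - (+ 2 * w) * b) ≡ p * (l * (a + b - w * b)) - l * p * w * b
      lemma = solve-∀

-- The rational inequalities behind the criterion.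

module RationalInequalities where
  open import Data.Integer as ℤ using (ℤ; +_)
  import Data.Integer.Properties as ℤ
  import Data.Integer.Tactic.RingSolver as ℤ
  open import Data.Maybe using (Maybe; just; nothing)
  open import Data.Rational
  open import Data.Rational.Properties
  import Data.Rational.Unnormalised as ℚᵘ
  import Data.Rational.Unnormalised.Properties as ℚᵘ
  open import Level using (0ℓ)
  open import Relation.Binary.PropositionalEquality
  import Tactic.RingSolver as Ring
  open import Tactic.RingSolver.Core.AlmostCommutativeRing using (AlmostCommutativeRing; fromCommutativeRing)

  ℚ-ring : AlmostCommutativeRing 0ℓ 0ℓ
  ℚ-ring = fromCommutativeRing +-*-commutativeRing isZero
    where
    isZero : ∀ x → Maybe (0ℚ ≡ x)
    isZero x with 0ℚ ≟ x
    ... | yes 0≡x = just 0≡x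
    ... | no _    = nothing

  ≤⇒≯ : ∀ {p q} → p ≤ q → ¬ q < p
  ≤⇒≯ p≤q q<p = <-irrefl refl (<-≤-trans q<p p≤q)

  -- On natural numbers this is `ℕ→ℚ` by definition, so the hypotheses of the criterion apply
  -- without conversion.
  ι : ℤ → ℚ
  ι i = i / 1

  ι-ᵘ : ∀ i → toℚᵘ (ι i) ℚᵘ.≃ ℚᵘ.mkℚᵘ i 0
  ι-ᵘ i = toℚᵘ-fromℚᵘ (ℚᵘ.mkℚᵘ i 0)

  ι-+ : ∀ i j → ι (i ℤ.+ j) ≡ ι i + ι j
  ι-+ i j = toℚᵘ-injective (begin
    toℚᵘ (ι (i ℤ.+ j))                       ≈⟨ ι-ᵘ (i ℤ.+ j) ⟩
    ℚᵘ.mkℚᵘ (i ℤ.+ j) 0                      ≈⟨ ℚᵘ.*≡* (lemma i j) ⟩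
    ℚᵘ.mkℚᵘ i 0 ℚᵘ.+ ℚᵘ.mkℚᵘ j 0             ≈⟨ ℚᵘ.+-cong (ι-ᵘ i) (ι-ᵘ j) ⟨
    toℚᵘ (ι i) ℚᵘ.+ toℚᵘ (ι j)               ≈⟨ toℚᵘ-homo-+ (ι i) (ι j) ⟨
    toℚᵘ (ι i + ι j)                         ∎)
    where
    open import Relation.Binary.Reasoning.Setoid ℚᵘ.≃-setoid
    lemma : ∀ i j → (i ℤ.+ j) ℤ.* (+ 1) ≡ (i ℤ.* + 1 ℤ.+ j ℤ.* + 1) ℤ.* + 1
    lemma = ℤ.solve-∀

  ι-* : ∀ i j → ι (i ℤ.* j) ≡ ι i * ι j
  ι-* i j = toℚᵘ-injective (begin
    toℚᵘ (ι (i ℤ.* j))                       ≈⟨ ι-ᵘ (i ℤ.* j) ⟩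
    ℚᵘ.mkℚᵘ (i ℤ.* j) 0                      ≈⟨ ℚᵘ.*≡* refl ⟩
    ℚᵘ.mkℚᵘ i 0 ℚᵘ.* ℚᵘ.mkℚᵘ j 0             ≈⟨ ℚᵘ.*-cong (ι-ᵘ i) (ι-ᵘ j) ⟨
    toℚᵘ (ι i) ℚᵘ.* toℚᵘ (ι j)               ≈⟨ toℚᵘ-homo-* (ι i) (ι j) ⟨
    toℚᵘ (ι i * ι j)                         ∎)
    where open import Relation.Binary.Reasoning.Setoid ℚᵘ.≃-setoid

  ι-neg : ∀ i → ι (ℤ.- i) ≡ - ι i
  ι-neg i = begin
    ι (ℤ.- i)                         ≡⟨ lemma (ι (ℤ.- i)) (ι i) ⟩
    ι (ℤ.- i) + ι i - ι i             ≡⟨ cong (_- ι i) (ι-+ (ℤ.- i) i) ⟨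
    ι (ℤ.- i ℤ.+ i) - ι i             ≡⟨ cong (λ w → ι w - ι i) (ℤ.+-inverseˡ i) ⟩
    0ℚ - ι i                          ≡⟨ +-identityˡ (- ι i) ⟩
    - ι i                             ∎
    where
    open ≡-Reasoning
    lemma : ∀ x y → x ≡ x + y - y
    lemma = Ring.solve-∀ ℚ-ring

  ι-minus : ∀ i j → ι (i ℤ.- j) ≡ ι i - ι j
  ι-minus i j = trans (ι-+ i (ℤ.- j)) (cong (_+_ (ι i)) (ι-neg j))

  ι-mono-≤ : ∀ {i j} → i ℤ.≤ j → ι i ≤ ι j
  ι-mono-≤ {i} {j} i≤j = toℚᵘ-cancel-≤ (ℚᵘ.≤-respˡ-≃ (ℚᵘ.≃-sym (ι-ᵘ i)) (ℚᵘ.≤-respʳ-≃ (ℚᵘ.≃-sym (ι-ᵘ j))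
    (ℚᵘ.*≤* (ℤ.*-monoʳ-≤-nonNeg (+ 1) i≤j))))

  ι-mono-< : ∀ {i j} → i ℤ.< j → ι i < ι j
  ι-mono-< {i} {j} i<j = toℚᵘ-cancel-< (ℚᵘ.<-respˡ-≃ (ℚᵘ.≃-sym (ι-ᵘ i)) (ℚᵘ.<-respʳ-≃ (ℚᵘ.≃-sym (ι-ᵘ j))
    (ℚᵘ.*<* (ℤ.*-monoʳ-<-pos (+ 1) i<j))))

  ι-cancel-< : ∀ {i j} → ι i < ι j → i ℤ.< j
  ι-cancel-< {i} {j} ιi<ιj with i ℤ.<? j
  ... | yes i<j = i<j
  ... | no  i≮j = contradiction ιi<ιj (≤⇒≯ (ι-mono-≤ {j} {i} (ℤ.≮⇒≥ i≮j)))

  ι-recip : ∀ p .{{_ : ℕ.NonZero p}} → ι (+ p) * recipℕ p ≡ 1ℚ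
  ι-recip (suc p) = toℚᵘ-injective (begin
    toℚᵘ (ι (+ suc p) * recipℕ (suc p))          ≈⟨ toℚᵘ-homo-* (ι (+ suc p)) (recipℕ (suc p)) ⟩
    toℚᵘ (ι (+ suc p)) ℚᵘ.* toℚᵘ (recipℕ (suc p)) ≈⟨ ℚᵘ.*-cong (ι-ᵘ (+ suc p)) (toℚᵘ-fromℚᵘ (ℚᵘ.mkℚᵘ (+ 1) p)) ⟩
    ℚᵘ.mkℚᵘ (+ suc p) 0 ℚᵘ.* ℚᵘ.mkℚᵘ (+ 1) p      ≈⟨ ℚᵘ.*≡* (lemma (+ p)) ⟩
    toℚᵘ 1ℚ                                       ∎)
    where
    open import Relation.Binary.Reasoning.Setoid ℚᵘ.≃-setoid
    lemma : ∀ p → (((+ 1) ℤ.+ p) ℤ.* + 1) ℤ.* + 1 ≡ + 1 ℤ.* (+ 1 ℤ.* ((+ 1) ℤ.+ p))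
    lemma = ℤ.solve-∀

  invℚ-inverse : ∀ {x} → 0ℚ < x → x * invℚ x ≡ 1ℚ
  invℚ-inverse {x} 0<x with x ≟ 0ℚ
  ... | yes x≡0 = contradiction (sym x≡0) (<⇒≢ 0<x)
  ... | no  x≢0 = *-inverseʳ x {{≢-nonZero x≢0}}

  ΣList : (ℕ → ℤ) → List ℕ → ℤ
  ΣList f []       = ℤ.0ℤ
  ΣList f (p ∷ ps) = f p ℤ.+ ΣList f ps

  -- Division by `p` bounds `h` by the average of `H` and `K` with weights 1/p and 1 - 1/p. Over the
  -- list these weights add up to `sumRecip ps` and `length ps - sumRecip ps`.
  ι-average : ∀ p .{{_ : ℕ.NonZero p}} {h H K} → + p ℤ.* h ℤ.≤ H ℤ.+ + (p ℕ.∸ 1) ℤ.* K →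
    ι h ≤ recipℕ p * ι H + (1ℚ - recipℕ p) * ι K
  ι-average p@(suc p-1) {h} {H} {K} ph≤ = *-cancelˡ-≤-pos (ι (+ p)) {{positive (ι-mono-< {+ 0} {+ p} (ℤ.+<+ ℕ.z<s))}} (begin
    ι (+ p) * ι h                                        ≡⟨ ι-* (+ p) h ⟨
    ι (+ p ℤ.* h)                                        ≤⟨ ι-mono-≤ {+ p ℤ.* h} {H ℤ.+ + p-1 ℤ.* K} ph≤ ⟩
    ι (H ℤ.+ + p-1 ℤ.* K)                                ≡⟨ cong ι (lemma₁ H (+ p-1) K) ⟩
    ι (H ℤ.+ (+ p ℤ.* K ℤ.- K))                          ≡⟨ trans (ι-+ H (+ p ℤ.* K ℤ.- K)) (cong (_+_ (ι H)) (trans (ι-minus (+ p ℤ.* K) K) (cong (_- ι K) (ι-* (+ p) K)))) ⟩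
    ι H + (ι (+ p) * ι K - ι K)                          ≡⟨ lemma₂ (ι H) (ι (+ p)) (ι K) ⟩
    1ℚ * ι H + (ι (+ p) - 1ℚ) * ι K                      ≡⟨ cong (λ w → w * ι H + (ι (+ p) - w) * ι K) (ι-recip p) ⟨
    ι (+ p) * recipℕ p * ι H + (ι (+ p) - ι (+ p) * recipℕ p) * ι K ≡⟨ lemma₃ (ι (+ p)) (recipℕ p) (ι H) (ι K) ⟩
    ι (+ p) * (recipℕ p * ι H + (1ℚ - recipℕ p) * ι K)   ∎)
    where
    open ≤-Reasoning
    lemma₁ : ∀ H p K → H ℤ.+ p ℤ.* K ≡ H ℤ.+ (((+ 1) ℤ.+ p) ℤ.* K ℤ.- K)
    lemma₁ = ℤ.solve-∀
    lemma₂ : ∀ H p K → H + (p * K - K) ≡ 1ℚ * H + (p - 1ℚ) * K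
    lemma₂ = Ring.solve-∀ ℚ-ring
    lemma₃ : ∀ p r H K → p * r * H + (p - p * r) * K ≡ p * (r * H + (1ℚ - r) * K)
    lemma₃ = Ring.solve-∀ ℚ-ring

  ι-ΣList≤ : ∀ {h H K} ps → All (λ p → ℕ.NonZero p × + p ℤ.* h p ℤ.≤ H ℤ.+ + (p ℕ.∸ 1) ℤ.* K) ps →
    ι (ΣList h ps) ≤ sumRecip ps * ι H + (ℕ→ℚ (length ps) - sumRecip ps) * ι K
  ι-ΣList≤ {h} {H} {K} [] [] = ≤-reflexive (lemma (ι H) (ι K))
    where
    lemma : ∀ H K → 0ℚ ≡ 0ℚ * H + (0ℚ - 0ℚ) * K
    lemma = Ring.solve-∀ ℚ-ring
  ι-ΣList≤ {h} {H} {K} (p ∷ ps) ((p≢0 , ph≤) ∷ rest) = begin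
    ι (h p ℤ.+ ΣList h ps)                     ≡⟨ ι-+ (h p) (ΣList h ps) ⟩
    ι (h p) + ι (ΣList h ps)                   ≤⟨ +-mono-≤ (ι-average p {{p≢0}} {h p} {H} {K} ph≤) (ι-ΣList≤ {h} {H} {K} ps rest) ⟩
    (r * ι H + (1ℚ - r) * ι K) + (σ * ι H + (ι s - σ) * ι K) ≡⟨ lemma r σ (ι H) (ι K) (ι s) ⟩
    (r + σ) * ι H + ((1ℚ + ι s) - (r + σ)) * ι K ≡⟨ cong (λ w → (r + σ) * ι H + (w - (r + σ)) * ι K) (ι-+ (+ 1) s) ⟨
    (r + σ) * ι H + (ι (+ suc (length ps)) - (r + σ)) * ι K ∎
    where
    open ≤-Reasoning
    r = recipℕ p
    σ = sumRecip ps
    s = + length ps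
    lemma : ∀ r σ H K s → (r * H + (1ℚ - r) * K) + (σ * H + (s - σ) * K) ≡ (r + σ) * H + ((1ℚ + s) - (r + σ)) * K
    lemma = Ring.solve-∀ ℚ-ring

  0≤x² : ∀ x → 0ℚ ≤ x * x
  0≤x² x with ≤-total 0ℚ x
  ... | inj₁ 0≤x = subst (_≤ x * x) (*-zeroʳ x) (*-monoˡ-≤-nonNeg x {{nonNegative 0≤x}} 0≤x)
  ... | inj₂ x≤0 = subst (_≤ x * x) (*-zeroʳ x) (*-monoˡ-≤-nonPos x {{nonPositive x≤0}} x≤0)

  p<q⇒0<q-p : ∀ {p q} → p < q → 0ℚ < q - p
  p<q⇒0<q-p {p} {q} p<q = subst (_< q - p) (+-inverseʳ p) (+-monoˡ-< (- p) p<q)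

  0<q-p⇒p<q : ∀ {p q} → 0ℚ < q - p → p < q
  0<q-p⇒p<q {p} {q} 0<q-p = subst₂ _<_ (+-identityˡ p) (lemma q p) (+-monoˡ-< p 0<q-p)
    where
    lemma : ∀ q p → q - p + p ≡ q
    lemma = Ring.solve-∀ ℚ-ring

  -- The bound replaces the irrational √m by the integer b = ⌈√m⌉ = c + 1; it uses 2cu ≤ c² + u² < 2m and u < b.
  u*b<m+b : ∀ {u c m} → ℕ→ℚ 2 * u * u < ℕ→ℚ m → c ℕ.* c ℕ.< m → m ℕ.≤ suc c ℕ.* suc c →
    u * ι (+ suc c) < ι (+ m) + ι (+ suc c)
  u*b<m+b {u} {c} {m} 2u²<m c²<m m≤b² = begin-strict
    u * ι (+ suc c)           ≡⟨ cong (u *_) (ι-+ (+ 1) (+ c)) ⟩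
    u * (1ℚ + C)              ≡⟨ lemma₁ u C ⟩
    C * u + u                 <⟨ +-mono-< Cu<m u<b ⟩
    ι (+ m) + ι (+ suc c)     ∎
    where
    open ≤-Reasoning
    C = ι (+ c)
    lemma₁ : ∀ u C → u * (1ℚ + C) ≡ C * u + u
    lemma₁ = Ring.solve-∀ ℚ-ring
    lemma₂ : ∀ C u → (1ℚ + 1ℚ) * (C * u) + (C - u) * (C - u) ≡ C * C + u * u
    lemma₂ = Ring.solve-∀ ℚ-ring
    lemma₃ : ∀ m → m + m ≡ (1ℚ + 1ℚ) * m
    lemma₃ = Ring.solve-∀ ℚ-ring
    u²<m : u * u < ι (+ m)
    u²<m = begin-strict
      u * u                     ≡⟨ +-identityʳ (u * u) ⟨
      u * u + 0ℚ                ≤⟨ +-monoʳ-≤ (u * u) (0≤x² u) ⟩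
      u * u + u * u             ≡⟨ lemma u ⟩
      ℕ→ℚ 2 * u * u             <⟨ 2u²<m ⟩
      ι (+ m)                   ∎
      where
      lemma : ∀ u → u * u + u * u ≡ (1ℚ + 1ℚ) * u * u
      lemma = Ring.solve-∀ ℚ-ring
    C²<m : C * C < ι (+ m)
    C²<m = subst (_< ι (+ m)) (trans (cong ι (ℤ.pos-* c c)) (ι-* (+ c) (+ c))) (ι-mono-< {+ (c ℕ.* c)} {+ m} (ℤ.+<+ c²<m))
    Cu<m : C * u < ι (+ m)
    Cu<m = *-cancelˡ-<-nonNeg (1ℚ + 1ℚ) (begin-strict
      (1ℚ + 1ℚ) * (C * u)                           ≡⟨ +-identityʳ ((1ℚ + 1ℚ) * (C * u)) ⟨
      (1ℚ + 1ℚ) * (C * u) + 0ℚ                      ≤⟨ +-monoʳ-≤ ((1ℚ + 1ℚ) * (C * u)) (0≤x² (C - u)) ⟩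
      (1ℚ + 1ℚ) * (C * u) + (C - u) * (C - u)       ≡⟨ lemma₂ C u ⟩
      C * C + u * u                                 <⟨ +-mono-< C²<m u²<m ⟩
      ι (+ m) + ι (+ m)                             ≡⟨ lemma₃ (ι (+ m)) ⟩
      (1ℚ + 1ℚ) * ι (+ m)                           ∎)
    B = ι (+ suc c)
    0≤B : 0ℚ ≤ B
    0≤B = ι-mono-≤ {+ 0} {+ suc c} (ℤ.+≤+ ℕ.z≤n)
    u<b : u < B
    u<b with u <? B
    ... | yes u<B = u<B
    ... | no  u≮B = contradiction u²<m (≤⇒≯ (begin
      ι (+ m)                   ≤⟨ ι-mono-≤ {+ m} {+ (suc c ℕ.* suc c)} (ℤ.+≤+ m≤b²) ⟩
      ι (+ (suc c ℕ.* suc c))   ≡⟨ trans (cong ι (ℤ.pos-* (suc c) (suc c))) (ι-* (+ suc c) (+ suc c)) ⟩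
      B * B                     ≤⟨ *-monoˡ-≤-nonNeg B {{nonNegative 0≤B}} (≮⇒≥ u≮B) ⟩
      B * u                     ≤⟨ *-monoʳ-≤-nonNeg u {{nonNegative (≤-trans 0≤B (≮⇒≥ u≮B))}} (≮⇒≥ u≮B) ⟩
      u * u                     ∎))

  -- With `K = f w b`, the difference `H - ΣList h ps` is at least `δ H - (s - σ) K`, where
  -- `s - σ = (s - 1) + δ`. The lower bound for `H` costs another `δ K`. Taking out the factor `f δ`
  -- leaves `A + b - u b` with `u = ((s - 1)/δ + 2) w`, which is positive by `u*b<m+b`.
  sieve-positive : ∀ ps {f w c m A H h} → let σ = sumRecip ps ; s = ℕ→ℚ (length ps) ; b = suc c in
    0ℚ < 1ℚ - σ →
    ℕ→ℚ 2 * (((s - 1ℚ) * invℚ (1ℚ - σ) + ℕ→ℚ 2) * ℕ→ℚ w) * (((s - 1ℚ) * invℚ (1ℚ - σ) + ℕ→ℚ 2) * ℕ→ℚ w) < ℕ→ℚ m →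
    c ℕ.* c ℕ.< m → m ℕ.≤ b ℕ.* b → + m ℤ.≤ A → 0 ℕ.< f →
    + f ℤ.* (A ℤ.+ + b ℤ.- + w ℤ.* + b) ℤ.≤ H →
    All (λ p → ℕ.NonZero p × + p ℤ.* h p ℤ.≤ H ℤ.+ + (p ℕ.∸ 1) ℤ.* (+ f ℤ.* + w ℤ.* + b)) ps →
    ΣList h ps ℤ.< H
  sieve-positive ps {f} {w} {c} {m} {A} {H} {h} 0<δ 2u²<m c²<m m≤b² m≤A 0<f H≥ each = ι-cancel-< {ΣList h ps} {H} (0<q-p⇒p<q (begin-strict
    0ℚ
      <⟨ positive⁻¹ (ι (+ f) * (δ * (a + B - u * B))) {{pos*pos⇒pos (ι (+ f)) {{positive (ι-mono-< {+ 0} {+ f} (ℤ.+<+ 0<f))}}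
           (δ * (a + B - u * B)) {{pos*pos⇒pos δ {{positive 0<δ}} (a + B - u * B) {{positive (p<q⇒0<q-p uB<)}}}}}} ⟩
    ι (+ f) * (δ * (a + B - u * B))
      ≡⟨ lemma₁ (ι (+ f)) δ a B (s - 1ℚ) (invℚ δ) W′ ⟩
    ι (+ f) * (δ * (a + B) - δ * W′ * B - (δ * invℚ δ * (s - 1ℚ) + δ) * W′ * B)
      ≡⟨ cong (λ x → ι (+ f) * (δ * (a + B) - δ * W′ * B - (x * (s - 1ℚ) + δ) * W′ * B)) (invℚ-inverse 0<δ) ⟩
    ι (+ f) * (δ * (a + B) - δ * W′ * B - (1ℚ * (s - 1ℚ) + δ) * W′ * B)
      ≡⟨ lemma₂ (ι (+ f)) σ a B s W′ ⟩
    δ * (ι (+ f) * (a + B - W′ * B)) - (s - σ) * (ι (+ f) * W′ * B)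
      ≤⟨ +-monoˡ-≤ (- ((s - σ) * (ι (+ f) * W′ * B))) (*-monoˡ-≤-nonNeg δ {{nonNegative (<⇒≤ 0<δ)}}
           (subst (_≤ ι H) cast₁ (ι-mono-≤ {+ f ℤ.* (A ℤ.+ + suc c ℤ.- + w ℤ.* + suc c)} {H} H≥))) ⟩
    δ * ι H - (s - σ) * (ι (+ f) * W′ * B)
      ≡⟨ lemma₃ σ (ι H) (s - σ) (ι (+ f) * W′ * B) ⟩
    ι H - (σ * ι H + (s - σ) * (ι (+ f) * W′ * B))
      ≤⟨ +-monoʳ-≤ (ι H) (neg-antimono-≤ (subst (λ x → ι (ΣList h ps) ≤ σ * ι H + (s - σ) * x) cast₂
           (ι-ΣList≤ {h} {H} {+ f ℤ.* + w ℤ.* + suc c} ps each))) ⟩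
    ι H - ι (ΣList h ps) ∎))
    where
    open ≤-Reasoning
    σ = sumRecip ps
    s = ℕ→ℚ (length ps)
    δ = 1ℚ - σ
    a = ι A
    B = ι (+ suc c)
    W′ = ℕ→ℚ w
    u = ((s - 1ℚ) * invℚ δ + ℕ→ℚ 2) * W′
    uB< : u * B < a + B
    uB< = <-≤-trans (u*b<m+b {u} {c} {m} 2u²<m c²<m m≤b²) (+-monoˡ-≤ B (ι-mono-≤ {+ m} {A} m≤A))
    cast₁ : ι (+ f ℤ.* (A ℤ.+ + suc c ℤ.- + w ℤ.* + suc c)) ≡ ι (+ f) * (a + B - W′ * B)
    cast₁ = trans (ι-* (+ f) (A ℤ.+ + suc c ℤ.- + w ℤ.* + suc c)) (cong (ι (+ f) *_)
      (trans (ι-minus (A ℤ.+ + suc c) (+ w ℤ.* + suc c)) (cong₂ _-_ (ι-+ A (+ suc c)) (ι-* (+ w) (+ suc c)))))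
    cast₂ : ι (+ f ℤ.* + w ℤ.* + suc c) ≡ ι (+ f) * W′ * B
    cast₂ = trans (ι-* (+ f ℤ.* + w) (+ suc c)) (cong (_* B) (ι-* (+ f) (+ w)))
    lemma₁ : ∀ f δ a B s i w → f * (δ * (a + B - ((s * i + (1ℚ + 1ℚ)) * w) * B)) ≡ f * (δ * (a + B) - δ * w * B - (δ * i * s + δ) * w * B)
    lemma₁ = Ring.solve-∀ ℚ-ring
    lemma₂ : ∀ f σ a B s w → f * ((1ℚ - σ) * (a + B) - (1ℚ - σ) * w * B - (1ℚ * (s - 1ℚ) + (1ℚ - σ)) * w * B)
      ≡ (1ℚ - σ) * (f * (a + B - w * B)) - (s - σ) * (f * w * B)
    lemma₂ = Ring.solve-∀ ℚ-ring
    lemma₃ : ∀ σ H x K → (1ℚ - σ) * H - x * K ≡ H - (σ * H + x * K)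
    lemma₃ = Ring.solve-∀ ℚ-ring

-- The sieve with weights on a difference set.

module Sieving where
  open FiniteSums
  open RamanujanSums
  open CharacterSumBounds
  open RationalInequalities using (ΣList; sieve-positive)
  open import Data.Integer using (ℤ; +_; -_; _+_; _*_; _-_; _≤_; _<_; 0ℤ; 1ℤ; +≤+; ∣_∣; nonNegative)
  open import Data.Integer.Properties
  open import Data.Integer.Tactic.RingSolver using (solve-∀)
  open import Data.Rational as ℚ using (0ℚ; 1ℚ)
  open import Relation.Binary.PropositionalEquality
  open import Data.Nat using (_^_)

  -- `suc c` is ⌈√m⌉; producing its predecessor expresses both bounds without subtraction.
  ceiling-√ : ∀ m → 0 ℕ.< m → ∃ λ c → c ℕ.* c ℕ.< m × m ℕ.≤ suc c ℕ.* suc c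
  ceiling-√ (suc zero)    _ = 0 , ℕ.z<s , ℕ.≤-refl
  ceiling-√ (suc (suc m)) _ with ceiling-√ (suc m) ℕ.z<s
  ... | c , c²<m , m≤b² with suc (suc m) ℕ.≤? suc c ℕ.* suc c
  ... | yes m′≤b² = c , ℕ.m<n⇒m<1+n c²<m , m′≤b²
  ... | no  m′≰b² = suc c , ℕ.≰⇒> m′≰b² , ℕ.≤-trans (ℕ.s≤s m≤b²) (ℕ.*-mono-< (ℕ.n<1+n (suc c)) (ℕ.n<1+n (suc c)))

  φ-positive : ∀ {L} → All Prime L → 0 ℕ.< φ L
  φ-positive []        = ℕ.z<s
  φ-positive (pp ∷ pL) = ℕ.*-mono-≤ (ℕ.∸-monoˡ-≤ 1 (prime⇒2≤ pp)) (φ-positive pL)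

  c≤ : ∀ {p} → Prime p → ∀ x → c p x ≤ + (p ℕ.∸ 1)
  c≤ {p} pp x = ≤-trans (i≤∣i∣ (c p x)) (+≤+ (∣c∣≤ pp x))

  0≤i*j : ∀ {i j} → 0ℤ ≤ i → 0ℤ ≤ j → 0ℤ ≤ i * j
  0≤i*j {i} {j} 0≤i 0≤j = subst (_≤ i * j) (*-zeroʳ i) (*-monoˡ-≤-nonNeg i {{nonNegative 0≤i}} 0≤j)

  0≤e : ∀ {L} → All Prime L → ∀ x → 0ℤ ≤ e L x
  0≤e []        x = +≤+ ℕ.z≤n
  0≤e {p ∷ L} (pp ∷ pL) x = 0≤i*j (i≤j⇒0≤j-i {c p x} (c≤ pp x)) (0≤e pL x)

  e≢0 : ∀ {L} → All Prime L → ∀ x → e L x ≢ 0ℤ → All (λ p → ¬ p ∣ x) L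
  e≢0 []        x _ = []
  e≢0 {p ∷ L} (pp ∷ pL) x e≢ =
    (λ p∣x → e≢ (trans (cong (_* e L x) (i≡j⇒i-j≡0 {+ (p ℕ.∸ 1)} {c p x} (sym (c-∣ pp p∣x)))) (*-zeroˡ (e L x))))
    ∷ e≢0 pL x (λ e≡0 → e≢ (trans (cong ((+ (p ℕ.∸ 1) - c p x) *_) e≡0) (*-zeroʳ (+ (p ℕ.∸ 1) - c p x))))

  0≤ΣList-dv : ∀ ps x → 0ℤ ≤ ΣList (λ p → dv p x) ps
  0≤ΣList-dv []       x = +≤+ ℕ.z≤n
  0≤ΣList-dv (p ∷ ps) x = +-mono-≤ (0≤ind (p ∣? x)) (0≤ΣList-dv ps x)

  ΣList-dv<1 : ∀ ps x → ΣList (λ p → dv p x) ps < 1ℤ → All (λ p → ¬ p ∣ x) ps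
  ΣList-dv<1 []       x _  = []
  ΣList-dv<1 (p ∷ ps) x <1 =
    (λ p∣x → <-irrefl refl (≤-<-trans (subst (λ d → 1ℤ ≤ d + rest) (sym (ind-yes (p ∣? x) p∣x))
        (≤-trans (≤-reflexive (sym (+-identityʳ 1ℤ))) (+-monoʳ-≤ 1ℤ (0≤ΣList-dv ps x)))) <1))
    ∷ ΣList-dv<1 ps x (≤-<-trans (≤-trans (≤-reflexive (sym (+-identityˡ rest))) (+-monoˡ-≤ rest (0≤ind (p ∣? x)))) <1)
    where
    rest = ΣList (λ p → dv p x) ps

  module _ (N : ℕ) .{{_ : NonZero N}} (D : ℕ → ℤ) (0≤D : ∀ x → 0ℤ ≤ D x) (perD : Periodic N D) (l : ℤ) (m : ℕ) (0<m : 0 ℕ.< m)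
    (correlation : ∀ z → l ≤ Σ< N (λ x → D x * D (x ℕ.+ z)))
    (total : Σ< N D * Σ< N D - + N * l ≤ + m) (m≤ΣD : + m ≤ Σ< N D) where

    module _ (ks ps : List ℕ) (pks : All Prime ks) (pps : All Prime ps) (dks : AllPairs _≢_ ks)
      (ks≢ps : All (λ p → All (_≢ p) ks) ps) (ks∣N : All (_∣ N) ks) (ps∣N : All (_∣ N) ps) where

      module Survivor (c₀ : ℕ) (m≤b² : m ℕ.≤ suc c₀ ℕ.* suc c₀) where
        open Sieve N D perD l m (suc c₀) correlation total m≤b²

        H : ℕ → ℤ
        H p = Σ< N (λ x → D x * (e ks x * dv p x))

        -- If some prime of `ps` divides `x`, the list sum is at least 1 and the last factor is at
        -- most 0; hence `F` is positive only at survivors. Being linear in the indicators, that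
        -- factor needs only one prime of `ps` at a time, unlike the full product over `ps`.
        F : ℕ → ℤ
        F x = D x * (e ks x * (1ℤ - ΣList (λ p → dv p x) ps))

        m<n⇒0<n-m : ∀ {i j} → i < j → 0ℤ < j - i
        m<n⇒0<n-m {i} {j} i<j = subst (_< j - i) (+-inverseʳ i) (+-monoˡ-< (- i) i<j)

        ΣList-H : ∀ qs → ΣList H qs ≡ Σ< N (λ x → D x * (e ks x * ΣList (λ p → dv p x) qs))
        ΣList-H []       = sym (trans (Σ-ext N (λ x → trans (cong (D x *_) (*-zeroʳ (e ks x))) (*-zeroʳ (D x)))) (Σ-zero N))
        ΣList-H (r ∷ qs) = begin
          H r + ΣList H qs ≡⟨ cong (_+_ (H r)) (ΣList-H qs) ⟩
          H r + Σ< N (λ x → D x * (e ks x * ΣList (λ p → dv p x) qs))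
            ≡⟨ Σ-+ N (λ x → D x * (e ks x * dv r x)) (λ x → D x * (e ks x * ΣList (λ p → dv p x) qs)) ⟨
          Σ< N (λ x → D x * (e ks x * dv r x) + D x * (e ks x * ΣList (λ p → dv p x) qs))
            ≡⟨ Σ-ext N (λ x → lemma (D x) (e ks x) (dv r x) (ΣList (λ p → dv p x) qs)) ⟩
          Σ< N (λ x → D x * (e ks x * ΣList (λ p → dv p x) (r ∷ qs))) ∎
          where
          open ≡-Reasoning
          lemma : ∀ d e a b → d * (e * a) + d * (e * b) ≡ d * (e * (a + b))
          lemma = solve-∀

        ΣF : Σ< N F ≡ S ks [] - ΣList H ps
        ΣF = begin
          Σ< N F ≡⟨ Σ-ext N (λ x → lemma (D x) (e ks x) (ΣList (λ p → dv p x) ps)) ⟩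
          Σ< N (λ x → D x * (e ks x * 1ℤ) - D x * (e ks x * ΣList (λ p → dv p x) ps))
            ≡⟨ Σ-minus N (λ x → D x * (e ks x * 1ℤ)) (λ x → D x * (e ks x * ΣList (λ p → dv p x) ps)) ⟩
          S ks [] - Σ< N (λ x → D x * (e ks x * ΣList (λ p → dv p x) ps)) ≡⟨ cong (_-_ (S ks [])) (ΣList-H ps) ⟨
          S ks [] - ΣList H ps ∎
          where
          open ≡-Reasoning
          lemma : ∀ d e a → d * (e * (1ℤ - a)) ≡ d * (e * 1ℤ) - d * (e * a)
          lemma = solve-∀

        -- By `p [p ∣ x] = 1 + c_p(x)`, the divisibility condition becomes one further Ramanujan
        -- sum.
        p*H : ∀ p → + p * H p ≡ S ks [] + S ks (p ∷ [])
        p*H p = begin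
          + p * H p ≡⟨ Σ-*ˡ N (+ p) (λ x → D x * (e ks x * dv p x)) ⟨
          Σ< N (λ x → + p * (D x * (e ks x * dv p x))) ≡⟨ Σ-ext N (λ x → lemma (+ p) (D x) (e ks x) (dv p x)) ⟩
          Σ< N (λ x → D x * (e ks x * 1ℤ) + D x * (e ks x * (c p x * 1ℤ)))
            ≡⟨ Σ-+ N (λ x → D x * (e ks x * 1ℤ)) (λ x → D x * (e ks x * (c p x * 1ℤ))) ⟩
          S ks [] + S ks (p ∷ []) ∎
          where
          open ≡-Reasoning
          lemma : ∀ p d e a → p * (d * (e * a)) ≡ d * (e * 1ℤ) + d * (e * ((p * a - 1ℤ) * 1ℤ))
          lemma = solve-∀

        aks : All Admissible ks
        aks = All.zip (pks , ks∣N)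

        p*H≤ : ∀ p → (Prime p × p ∣ N) × All (_≢ p) ks →
          NonZero p × + p * H p ≤ S ks [] + + (p ℕ.∸ 1) * (+ φ ks * + (2 ^ length ks) * + suc c₀)
        p*H≤ p (ap , ks≢p) = prime⇒nonZero (proj₁ ap) , (begin
          + p * H p                                       ≡⟨ p*H p ⟩
          S ks [] + S ks (p ∷ [])                         ≤⟨ +-monoʳ-≤ (S ks []) (i≤∣i∣ (S ks (p ∷ []))) ⟩
          S ks [] + + ∣ S ks (p ∷ []) ∣
            ≤⟨ +-monoʳ-≤ (S ks []) (+≤+ (∣S∣≤ aks dks (All.map (_∷ []) ks≢p) (ap ∷ []) ([] ∷ []))) ⟩
          S ks [] + + (φ ks ℕ.* ((p ℕ.∸ 1) ℕ.* 1) ℕ.* 2 ^ length ks ℕ.* suc c₀)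
            ≡⟨ cong (λ w → S ks [] + + w) (lemma (φ ks) (p ℕ.∸ 1) (2 ^ length ks) (suc c₀)) ⟩
          S ks [] + + ((p ℕ.∸ 1) ℕ.* (φ ks ℕ.* 2 ^ length ks ℕ.* suc c₀))
            ≡⟨ cong (_+_ (S ks [])) (trans (pos-* (p ℕ.∸ 1) (φ ks ℕ.* 2 ^ length ks ℕ.* suc c₀))
                 (cong (+ (p ℕ.∸ 1) *_) (trans (pos-* (φ ks ℕ.* 2 ^ length ks) (suc c₀)) (cong (_* + suc c₀) (pos-* (φ ks) (2 ^ length ks)))))) ⟩
          S ks [] + + (p ℕ.∸ 1) * (+ φ ks * + (2 ^ length ks) * + suc c₀) ∎)
          where
          open ≤-Reasoning
          lemma : ∀ f p w b → f ℕ.* (p ℕ.* 1) ℕ.* w ℕ.* b ≡ p ℕ.* (f ℕ.* w ℕ.* b)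
          lemma = ℕ.solve-∀

        p*H≤-ps : All (λ p → NonZero p × + p * H p ≤ S ks [] + + (p ℕ.∸ 1) * (+ φ ks * + (2 ^ length ks) * + suc c₀)) ps
        p*H≤-ps = All.map (λ {p} → p*H≤ p) (All.zip (All.zip (pps , ps∣N) , ks≢ps))

        S-ks≥ : + φ ks * (Σ< N D + + suc c₀ - + (2 ^ length ks) * + suc c₀) ≤ S ks []
        S-ks≥ = S≥ aks dks

        survives : ∀ x → 0ℤ < F x → D x ≢ 0ℤ × All (λ p → ¬ p ∣ x) ks × All (λ p → ¬ p ∣ x) ps
        survives x 0<F =
            (λ D≡0 → <⇒≢ 0<F (sym (trans (cong (_* (e ks x * w)) D≡0) (*-zeroˡ (e ks x * w)))))
          , e≢0 pks x (λ e≡0 → <⇒≢ 0<F (sym (trans (cong (λ y → D x * (y * w)) e≡0) (trans (cong (D x *_) (*-zeroˡ w)) (*-zeroʳ (D x))))))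
          , ΣList-dv<1 ps x small
          where
          w = 1ℤ - ΣList (λ p → dv p x) ps
          small : ΣList (λ p → dv p x) ps < 1ℤ
          small with ΣList (λ p → dv p x) ps <? 1ℤ
          ... | yes <1 = <1
          ... | no  ≮1 = contradiction 0<F (≤⇒≯ (subst (_≤ 0ℤ) (lemma (D x) (e ks x) w)
                  (neg-mono-≤ (0≤i*j (0≤D x) (0≤i*j (0≤e pks x) (neg-mono-≤ (i≤j⇒i-j≤0 {1ℤ} (≮⇒≥ ≮1))))))))
            where
            lemma : ∀ d e w → - (d * (e * - w)) ≡ d * (e * w)
            lemma = solve-∀

        survivor : ΣList H ps < S ks [] → ∃ λ x → x ℕ.< N × D x ≢ 0ℤ × All (λ p → ¬ p ∣ x) ks × All (λ p → ¬ p ∣ x) ps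
        survivor ΣH<S = let x , x<N , 0<F = Σ-positive N F (subst (0ℤ <_) (sym ΣF) (m<n⇒0<n-m ΣH<S)) in x , x<N , survives x 0<F

      sieve : let σ = sumRecip ps ; u = ((ℕ→ℚ (length ps) ℚ.- 1ℚ) ℚ.* invℚ (1ℚ ℚ.- σ) ℚ.+ ℕ→ℚ 2) ℚ.* ℕ→ℚ (2 ^ length ks) in
        0ℚ ℚ.< 1ℚ ℚ.- σ → ℕ→ℚ 2 ℚ.* u ℚ.* u ℚ.< ℕ→ℚ m →
        ∃ λ x → x ℕ.< N × D x ≢ 0ℤ × All (λ p → ¬ p ∣ x) ks × All (λ p → ¬ p ∣ x) ps
      sieve 0<δ 2u²<m =
        let c₀ , c²<m , m≤b² = ceiling-√ m 0<m in
        Survivor.survivor c₀ m≤b² (sieve-positive ps {φ ks} {2 ^ length ks} {c₀} {m} {Σ< N D}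
          0<δ 2u²<m c²<m m≤b² m≤ΣD (φ-positive pks) (Survivor.S-ks≥ c₀ m≤b²) (Survivor.p*H≤-ps c₀ m≤b²))

-- Finite fields: reindexing, Fermat, Frobenius and roots of polynomials.

module FiniteFields where
  open import Algebra.Bundles using (CommutativeMonoid)
  import Algebra.Properties.CommutativeMonoid.Sum as MonoidSum
  open import Data.Fin.Permutation using (permutation)
  open import Data.Nat.Combinatorics using (_C_; nCk≡n!/k![n-k]!; k![n∸k]!∣n!; nCn≡1)
  open import Data.Nat.DivMod using (m/n*n≡m)
  open import Data.Nat.Properties using (_!*_!≢0)
  open import Data.Vec.Functional using (init; last)
  open import Relation.Binary.PropositionalEquality as ≡ using (_≡_)
  open import Data.Nat using (_!)

  prime-∤-! : ∀ {p k} → Prime p → k ℕ.< p → ¬ p ∣ k !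
  prime-∤-! {p} {zero}  pp k<p p∣1 = ¬prime[1] (≡.subst Prime (∣1⇒≡1 p∣1) pp)
  prime-∤-! {p} {suc k} pp k<p p∣k! with euclidsLemma (suc k) (k !) pp p∣k!
  ... | inj₁ p∣1+k = ℕ.<⇒≱ k<p (∣⇒≤ p∣1+k)
  ... | inj₂ p∣k!′ = prime-∤-! pp (ℕ.<⇒≤ k<p) p∣k!′

  prime-∣-C : ∀ {p k} → Prime p → 0 ℕ.< k → k ℕ.< p → p ∣ p C k
  prime-∣-C {p@(suc p-1)} {k@(suc k-1)} pp 0<k k<p with euclidsLemma (p C k) (k ! ℕ.* (p ℕ.∸ k) !) pp p∣
    where
    p! : (p C k) ℕ.* (k ! ℕ.* (p ℕ.∸ k) !) ≡ p !
    p! = ≡.trans (≡.cong (ℕ._* (k ! ℕ.* (p ℕ.∸ k) !)) (nCk≡n!/k![n-k]! (ℕ.<⇒≤ k<p)))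
      (m/n*n≡m {{k !* (p ℕ.∸ k) !≢0}} (k![n∸k]!∣n! (ℕ.<⇒≤ k<p)))
    p∣ : p ∣ (p C k) ℕ.* (k ! ℕ.* (p ℕ.∸ k) !)
    p∣ = ≡.subst (p ∣_) (≡.sym p!) (m∣m*n (p-1 !))
  ... | inj₁ p∣C = p∣C
  ... | inj₂ p∣d with euclidsLemma (k !) ((p ℕ.∸ k) !) pp p∣d
  ... | inj₁ p∣k! = contradiction p∣k! (prime-∤-! pp k<p)
  ... | inj₂ p∣[p-k]! = contradiction p∣[p-k]! (prime-∤-! pp (ℕ.s≤s (ℕ.m∸n≤m p-1 k-1)))

  -- Writing the number of elements as `suc M` makes `M` the order of the multiplicative group.
  module Field {M : ℕ} (F : FiniteField (suc M)) where
    open FiniteField F hiding (zero)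
    open Bijection enumerate renaming (to to elem) using (injective; surjective)
    open import Algebra.Properties.Ring ring using ([y-z]x≈yx-zx)
    open import Algebra.Properties.Group +-group using (x∙y⁻¹≈ε⇒x≈y; x≈y⇒x∙y⁻¹≈ε)
    open import Algebra.Properties.Semiring.Exp semiring
    import Algebra.Properties.CommutativeSemiring.Binomial commutativeSemiring as Binomial
    import Algebra.Properties.Semiring.Mult semiring as Mult
    open import Algebra.Solver.Ring.NaturalCoefficients.Default commutativeSemiring using (solve; _:+_; _:*_; _:=_; con)
    open import Relation.Binary.Reasoning.Setoid setoid

    index : Carrier → Fin (suc M)
    index x = proj₁ (surjective x)

    elem-index : ∀ x → elem (index x) ≈ x
    elem-index x = proj₂ (surjective x) ≡.refl

    index-elem : ∀ i → index (elem i) ≡ i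
    index-elem i = injective (elem-index (elem i))

    index-cong : ∀ {x y} → x ≈ y → index x ≡ index y
    index-cong {x} {y} x≈y = injective (trans (elem-index x) (trans x≈y (sym (elem-index y))))

    infix 4 _≟_
    _≟_ : ∀ x y → Dec (x ≈ y)
    x ≟ y = map′ (λ i≡j → trans (sym (elem-index x)) (trans (reflexive (≡.cong elem i≡j)) (elem-index y)))
                 index-cong (index x Fin.≟ index y)

    -- Several orders of the same field are compared: the given one, its images under
    -- multiplications and translations, and later zero followed by the powers of a generator.
    record Enumeration (n : ℕ) : Set where
      field
        at        : Fin n → Carrier
        find      : Carrier → Fin n
        find-cong : ∀ {x y} → x ≈ y → find x ≡ find y
        at-find   : ∀ x → at (find x) ≈ x
        find-at   : ∀ i → find (at i) ≡ i

    standard : Enumeration (suc M)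
    standard = record { at = elem ; find = index ; find-cong = index-cong ; at-find = elem-index ; find-at = index-elem }

    twisted : (σ τ : Carrier → Carrier) → (∀ {x y} → x ≈ y → σ x ≈ σ y) → (∀ {x y} → x ≈ y → τ x ≈ τ y) →
      (∀ x → σ (τ x) ≈ x) → (∀ x → τ (σ x) ≈ x) → Enumeration (suc M)
    twisted σ τ σ-cong τ-cong στ τσ = record
      { at        = σ ∘ elem
      ; find      = index ∘ τ
      ; find-cong = index-cong ∘ τ-cong
      ; at-find   = λ x → trans (σ-cong (elem-index (τ x))) (στ x)
      ; find-at   = λ i → ≡.trans (index-cong (τσ (elem i))) (index-elem i)
      }

    module _ {c ℓ} (C : CommutativeMonoid c ℓ) where
      private module C = CommutativeMonoid C
      open MonoidSum C

      -- Stated for any commutative monoid because three occur: field products for Fermat, field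
      -- sums for the characteristic, integer sums for counting.
      sum-enumerations : ∀ {m n} (E : Enumeration m) (E′ : Enumeration n) (f : Carrier → C.Carrier) →
        (∀ {x y} → x ≈ y → f x C.≈ f y) → sum (f ∘ Enumeration.at E) C.≈ sum (f ∘ Enumeration.at E′)
      sum-enumerations E E′ f f-cong = C.sym (C.trans (∑-permute (f ∘ E′.at) π) (sum-cong-≋ (λ i → f-cong (E′.at-find (E.at i)))))
        where
        module E = Enumeration E
        module E′ = Enumeration E′
        π = permutation (E′.find ∘ E.at) (E.find ∘ E′.at)
          (λ i → ≡.trans (E′.find-cong (E.at-find (E′.at i))) (E′.find-at i))
          (λ i → ≡.trans (E.find-cong (E′.at-find (E.at i))) (E.find-at i))

    domain : ∀ {x y} → x * y ≈ 0# → ¬ x ≈ 0# → y ≈ 0#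
    domain {x} {y} xy≈0 x≉0 with inverses x x≉0
    ... | x⁻¹ , xx⁻¹≈1 = begin
      y               ≈⟨ *-identityˡ y ⟨
      1# * y          ≈⟨ *-congʳ xx⁻¹≈1 ⟨
      x * x⁻¹ * y     ≈⟨ solve 3 (λ x i y → (x :* i) :* y := i :* (x :* y)) refl x x⁻¹ y ⟩
      x⁻¹ * (x * y)   ≈⟨ *-congˡ xy≈0 ⟩
      x⁻¹ * 0#        ≈⟨ zeroʳ x⁻¹ ⟩
      0#              ∎

    *-cancelʳ : ∀ {x y z} → ¬ z ≈ 0# → x * z ≈ y * z → x ≈ y
    *-cancelʳ {x} {y} {z} z≉0 xz≈yz = x∙y⁻¹≈ε⇒x≈y x y (domain (trans (*-comm z (x - y)) (trans ([y-z]x≈yx-zx z x y) (x≈y⇒x∙y⁻¹≈ε xz≈yz))) z≉0)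

    *-cancelˡ : ∀ {x y z} → ¬ z ≈ 0# → z * x ≈ z * y → x ≈ y
    *-cancelˡ {x} {y} {z} z≉0 zx≈zy = *-cancelʳ z≉0 (trans (*-comm x z) (trans zx≈zy (*-comm z y)))

    product-≉0 : ∀ {x y} → ¬ x ≈ 0# → ¬ y ≈ 0# → ¬ x * y ≈ 0#
    product-≉0 x≉0 y≉0 xy≈0 = y≉0 (domain xy≈0 x≉0)

    pow-≉0 : ∀ {x} → ¬ x ≈ 0# → ∀ k → ¬ x ^ k ≈ 0#
    pow-≉0 x≉0 zero    = nontrivial
    pow-≉0 x≉0 (suc k) = product-≉0 x≉0 (pow-≉0 x≉0 k)

    1^k : ∀ k → 1# ^ k ≈ 1#
    1^k zero    = refl
    1^k (suc k) = trans (*-identityˡ (1# ^ k)) (1^k k)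

    pow≡^ : ∀ x k → pow F x k ≡ x ^ k
    pow≡^ x zero    = ≡.refl
    pow≡^ x (suc k) = ≡.cong (x *_) (pow≡^ x k)

    module Π = MonoidSum *-commutativeMonoid
    module ⊕ = MonoidSum +-commutativeMonoid

    -- Lets a product over the non-zero elements run over the whole field, with the factor 1 at
    -- zero.
    unlessZero : Carrier → Carrier → Carrier
    unlessZero a x with x ≟ 0#
    ... | yes _ = 1#
    ... | no _  = a

    unlessZero-≉ : ∀ a {x} → ¬ x ≈ 0# → unlessZero a x ≈ a
    unlessZero-≉ a {x} x≉0 with x ≟ 0#
    ... | yes x≈0 = contradiction x≈0 x≉0
    ... | no _    = refl

    unlessZero-≈ : ∀ a {x} → x ≈ 0# → unlessZero a x ≈ 1#
    unlessZero-≈ a {x} x≈0 with x ≟ 0#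
    ... | yes _  = refl
    ... | no x≉0 = contradiction x≈0 x≉0

    -- Multiplication by `a` permutes the non-zero elements; their product is therefore unchanged,
    -- yet gains the factor `a ^ M`, and it can be cancelled.
    fermat : ∀ {a} → ¬ a ≈ 0# → a ^ M ≈ 1#
    fermat {a} a≉0 with inverses a a≉0
    ... | a⁻¹ , aa⁻¹≈1 = begin
      a ^ M                                  ≈⟨ Π-h ⟨
      Π.sum (h ∘ elem)                       ≈⟨ *-cancelʳ P≉0 (trans (sym split) (trans shifted (sym (*-identityˡ _)))) ⟩
      1#                                     ∎
      where
      f h : Carrier → Carrier
      f x = unlessZero x x
      h = unlessZero a

      f-cong : ∀ {x y} → x ≈ y → f x ≈ f y
      f-cong {x} {y} x≈y with x ≟ 0#
      ... | yes x≈0 = sym (unlessZero-≈ y (trans (sym x≈y) x≈0))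
      ... | no  x≉0 = trans x≈y (sym (unlessZero-≉ y (λ y≈0 → x≉0 (trans x≈y y≈0))))

      f≉0 : ∀ x → ¬ f x ≈ 0#
      f≉0 x with x ≟ 0#
      ... | yes _   = nontrivial
      ... | no  x≉0 = x≉0

      Π≉0 : ∀ {n} (g : Fin n → Carrier) → (∀ i → ¬ g i ≈ 0#) → ¬ Π.sum g ≈ 0#
      Π≉0 {zero}  g g≉0 = nontrivial
      Π≉0 {suc n} g g≉0 = product-≉0 (g≉0 zero) (Π≉0 (g ∘ suc) (g≉0 ∘ suc))

      P≉0 : ¬ Π.sum (f ∘ elem) ≈ 0#
      P≉0 = Π≉0 (f ∘ elem) (f≉0 ∘ elem)

      f-* : ∀ x → f (a * x) ≈ h x * f x
      f-* x with x ≟ 0#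
      ... | yes x≈0 = trans (unlessZero-≈ (a * x) (trans (*-congˡ x≈0) (zeroʳ a))) (sym (*-identityˡ 1#))
      ... | no  x≉0 = unlessZero-≉ (a * x) (product-≉0 a≉0 x≉0)

      a⁻¹a : ∀ x → a⁻¹ * (a * x) ≈ x
      a⁻¹a x = trans (solve 3 (λ i a x → i :* (a :* x) := (a :* i) :* x) refl a⁻¹ a x) (trans (*-congʳ aa⁻¹≈1) (*-identityˡ x))

      aa⁻¹ : ∀ x → a * (a⁻¹ * x) ≈ x
      aa⁻¹ x = trans (sym (*-assoc a a⁻¹ x)) (trans (*-congʳ aa⁻¹≈1) (*-identityˡ x))

      shifted : Π.sum (λ i → f (a * elem i)) ≈ Π.sum (f ∘ elem)
      shifted = sum-enumerations *-commutativeMonoid (twisted (a *_) (a⁻¹ *_) *-congˡ *-congˡ aa⁻¹ a⁻¹a) standard f f-cong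

      split : Π.sum (λ i → f (a * elem i)) ≈ Π.sum (h ∘ elem) * Π.sum (f ∘ elem)
      split = trans (Π.sum-cong-≋ (λ i → f-* (elem i))) (Π.∑-distrib-+ (h ∘ elem) (f ∘ elem))

      0′ : Fin (suc M)
      0′ = index 0#

      Π-h : Π.sum (h ∘ elem) ≈ a ^ M
      Π-h = begin
        Π.sum (h ∘ elem)                                    ≈⟨ Π.sum-remove {i = 0′} (h ∘ elem) ⟩
        h (elem 0′) * Π.sum (λ j → h (elem (punchIn 0′ j))) ≈⟨ *-cong (unlessZero-≈ a (elem-index 0#)) (Π.sum-cong-≋ (λ j →
          unlessZero-≉ a (λ e≈0 → Fin.punchInᵢ≢i 0′ j (injective (trans e≈0 (sym (elem-index 0#))))))) ⟩
        1# * Π.sum {M} (λ _ → a)                            ≈⟨ *-identityˡ _ ⟩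
        Π.sum {M} (λ _ → a)                                 ≈⟨ Π.sum-replicate M ⟩
        a ^ M                                               ∎

    -- Translation by 1 permutes the field, so adding 1 to every element leaves the sum of all
    -- elements unchanged.
    order-annihilates : suc M Mult.× 1# ≈ 0#
    order-annihilates = begin
      suc M Mult.× 1#                                 ≈⟨ +-identityʳ _ ⟨
      suc M Mult.× 1# + 0#                            ≈⟨ +-congˡ (-‿inverseʳ s) ⟨
      suc M Mult.× 1# + (s - s)                       ≈⟨ +-assoc _ s (- s) ⟨
      suc M Mult.× 1# + s - s                         ≈⟨ +-congʳ (+-congʳ (⊕.sum-replicate (suc M))) ⟨
      ⊕.sum {suc M} (λ _ → 1#) + s - s                ≈⟨ +-congʳ (⊕.∑-distrib-+ (λ _ → 1#) elem) ⟨
      ⊕.sum (λ i → 1# + elem i) - s                   ≈⟨ +-congʳ (sum-enumerations +-commutativeMonoid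
        (twisted (1# +_) (- 1# +_) +-congˡ +-congˡ cancel₁ cancel₂) standard (λ x → x) (λ x≈y → x≈y)) ⟩
      s - s                                           ≈⟨ -‿inverseʳ s ⟩
      0#                                              ∎
      where
      s = ⊕.sum elem
      cancel₁ : ∀ x → 1# + (- 1# + x) ≈ x
      cancel₁ x = trans (sym (+-assoc 1# (- 1#) x)) (trans (+-congʳ (-‿inverseʳ 1#)) (+-identityˡ x))
      cancel₂ : ∀ x → - 1# + (1# + x) ≈ x
      cancel₂ x = trans (sym (+-assoc (- 1#) 1# x)) (trans (+-congʳ (-‿inverseˡ 1#)) (+-identityˡ x))

    characteristic : ∀ {p} e → suc M ≡ p ℕ.^ e → p Mult.× 1# ≈ 0#
    characteristic {p} e eq = go e (trans (Mult.×-congˡ (≡.sym eq)) order-annihilates)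
      where
      go : ∀ e → (p ℕ.^ e) Mult.× 1# ≈ 0# → p Mult.× 1# ≈ 0#
      go zero    1≈0 = contradiction (trans (sym (+-identityʳ 1#)) 1≈0) nontrivial
      go (suc e) p^e≈0 with p Mult.× 1# ≟ 0#
      ... | yes p≈0 = p≈0
      ... | no  p≉0 = go e (domain (trans (sym (Mult.×1-homo-* p (p ℕ.^ e))) p^e≈0) p≉0)

    additive-^ : ∀ m → (∀ x y → (x + y) ^ m ≈ x ^ m + y ^ m) → ∀ e x y → (x + y) ^ (m ℕ.^ e) ≈ x ^ (m ℕ.^ e) + y ^ (m ℕ.^ e)
    additive-^ m additive zero    x y = trans (*-identityʳ _) (sym (+-cong (*-identityʳ x) (*-identityʳ y)))
    additive-^ m additive (suc e) x y = begin
      (x + y) ^ (m ℕ.* m ℕ.^ e)                       ≈⟨ ^-assocʳ (x + y) m (m ℕ.^ e) ⟨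
      ((x + y) ^ m) ^ (m ℕ.^ e)                       ≈⟨ ^-congˡ (m ℕ.^ e) (additive x y) ⟩
      (x ^ m + y ^ m) ^ (m ℕ.^ e)                     ≈⟨ additive-^ m additive e (x ^ m) (y ^ m) ⟩
      (x ^ m) ^ (m ℕ.^ e) + (y ^ m) ^ (m ℕ.^ e)       ≈⟨ +-cong (^-assocʳ x m (m ℕ.^ e)) (^-assocʳ y m (m ℕ.^ e)) ⟩
      x ^ (m ℕ.* m ℕ.^ e) + y ^ (m ℕ.* m ℕ.^ e)       ∎

    module Characteristic {p-1 : ℕ} (pp : Prime (suc p-1)) (p≈0 : suc p-1 Mult.× 1# ≈ 0#) where
      p : ℕ
      p = suc p-1

      p∣n⇒n×x≈0 : ∀ {n} → p ∣ n → ∀ x → n Mult.× x ≈ 0#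
      p∣n⇒n×x≈0 (divides k ≡.refl) x = begin
        (k ℕ.* p) Mult.× x           ≈⟨ Mult.×-assocˡ x k p ⟨
        k Mult.× (p Mult.× x)        ≈⟨ Mult.×-congʳ k (begin
          p Mult.× x                 ≈⟨ Mult.×-congʳ p (*-identityˡ x) ⟨
          p Mult.× (1# * x)          ≈⟨ Mult.×-assoc-* p 1# x ⟨
          (p Mult.× 1#) * x          ≈⟨ *-congʳ p≈0 ⟩
          0# * x                     ≈⟨ zeroˡ x ⟩
          0#                         ∎) ⟩
        k Mult.× 0#                  ≈⟨ k×0 k ⟩
        0#                           ∎
        where
        k×0 : ∀ k → k Mult.× 0# ≈ 0#
        k×0 zero    = refl
        k×0 (suc k) = trans (+-identityˡ _) (k×0 k)

      frobenius : ∀ x y → (x + y) ^ p ≈ x ^ p + y ^ p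
      frobenius x y = begin
        (x + y) ^ suc p-1                       ≈⟨ Binomial.theorem (suc p-1) x y ⟩
        ⊕.sum t                                 ≈⟨ ⊕.sum-init-last t ⟩
        ⊕.sum (init t) + last t
                                                ≈⟨ +-cong (+-cong first (trans (⊕.sum-cong-≋ {p-1} middle) (⊕.sum-replicate-zero p-1))) final ⟩
        (y ^ suc p-1 + 0#) + x ^ suc p-1        ≈⟨ solve 2 (λ a b → (b :+ con 0) :+ a := a :+ b) refl (x ^ suc p-1) (y ^ suc p-1) ⟩
        x ^ suc p-1 + y ^ suc p-1               ∎
        where
        t : Fin (suc (suc p-1)) → Carrier
        t = Binomial.binomialTerm x y (suc p-1)
        first : t zero ≈ y ^ suc p-1
        first = trans (+-identityʳ _) (*-identityˡ _)
        middle : ∀ (j : Fin p-1) → t (Fin.inject₁ (suc j)) ≈ 0#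
        middle j = p∣n⇒n×x≈0 (prime-∣-C pp (ℕ.s≤s ℕ.z≤n)
          (≡.subst (ℕ._< suc p-1) (≡.sym (≡.cong suc (Fin.toℕ-inject₁ j))) (ℕ.s≤s (Fin.toℕ<n j)))) _
        final : t (Fin.fromℕ (suc p-1)) ≈ x ^ suc p-1
        final = begin
          (suc p-1 C toℕ (Fin.fromℕ (suc p-1))) Mult.× (x ^ toℕ (Fin.fromℕ (suc p-1)) * y ^ (suc p-1 ℕ.∸ toℕ (Fin.fromℕ (suc p-1))))
            ≡⟨ ≡.cong (λ w → (suc p-1 C w) Mult.× (x ^ w * y ^ (suc p-1 ℕ.∸ w))) (Fin.toℕ-fromℕ (suc p-1)) ⟩
          (suc p-1 C suc p-1) Mult.× (x ^ suc p-1 * y ^ (suc p-1 ℕ.∸ suc p-1))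
            ≡⟨ ≡.cong₂ (λ a b → a Mult.× (x ^ suc p-1 * y ^ b)) (nCn≡1 (suc p-1)) (ℕ.n∸n≡0 p-1) ⟩
          x ^ suc p-1 * 1# + 0#  ≈⟨ trans (+-identityʳ _) (*-identityʳ _) ⟩
          x ^ suc p-1            ∎

      frobenius-^ : ∀ e x y → (x + y) ^ (p ℕ.^ e) ≈ x ^ (p ℕ.^ e) + y ^ (p ℕ.^ e)
      frobenius-^ = additive-^ p frobenius

    -- f is the function of a monic polynomial of degree d, in Horner form.
    data Monic : ℕ → (Carrier → Carrier) → Set where
      one  : ∀ {f} → (∀ x → f x ≈ 1#) → Monic 0 f
      step : ∀ {d f g} → Monic d g → ∀ a → (∀ x → f x ≈ x * g x + a) → Monic (suc d) f

    monic-^ : ∀ d → Monic d (_^ d)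
    monic-^ zero    = one (λ _ → refl)
    monic-^ (suc d) = step (monic-^ d) 0# (λ x → sym (+-identityʳ _))

    monic-+const : ∀ {d f} → Monic (suc d) f → ∀ b → Monic (suc d) (λ x → f x + b)
    monic-+const (step m a eq) b = step m (a + b) (λ x → trans (+-congʳ (eq x)) (+-assoc _ a b))

    monic-+ : ∀ {d k f g} → Monic d f → Monic k g → k ℕ.< d → Monic d (λ x → f x + g x)
    monic-+ (step m a eq) (one eq′) _ = step m (a + 1#) (λ x → trans (+-cong (eq x) (eq′ x)) (+-assoc _ a 1#))
    monic-+ (step m a eq) (step m′ a′ eq′) (ℕ.s≤s k<d) = step (monic-+ m m′ k<d) (a + a′) (λ x → trans (+-cong (eq x) (eq′ x))
      (solve 5 (λ x g a g′ a′ → (x :* g :+ a) :+ (x :* g′ :+ a′) := x :* (g :+ g′) :+ (a :+ a′)) refl x _ a _ a′))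

    -- (f x - f a) / (x - a) is a monic polynomial in x.
    divided-difference : ∀ {d f} → Monic (suc d) f → ∀ a → ∃ λ h → Monic d h × (∀ x → f x + a * h x ≈ x * h x + f a)
    divided-difference {zero} {f} (step {g = g} (one g≈1) b eq) a = g , one g≈1 , λ x → begin
      f x + a * g x              ≈⟨ +-cong (eq x) (*-congˡ (trans (g≈1 x) (sym (g≈1 a)))) ⟩
      x * g x + b + a * g a      ≈⟨ trans (+-assoc _ _ _) (+-congˡ (trans (+-comm _ _) (sym (eq a)))) ⟩
      x * g x + f a              ∎
    divided-difference {suc d} {f} (step {g = g} m b eq) a with divided-difference m a
    ... | h , m′ , eq′ = (λ x → x * h x + g a) , step m′ (g a) (λ x → refl) , λ x → begin
      f x + a * (x * h x + g a)                 ≈⟨ +-congʳ (eq x) ⟩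
      x * g x + b + a * (x * h x + g a)         ≈⟨ solve 6 (λ x gx b a hx ga → (x :* gx :+ b) :+ a :* (x :* hx :+ ga) := x :* (gx :+ a :* hx) :+ (a :* ga :+ b)) refl x (g x) b a (h x) (g a) ⟩
      x * (g x + a * h x) + (a * g a + b)       ≈⟨ +-cong (*-congˡ (eq′ x)) (sym (eq a)) ⟩
      x * (x * h x + g a) + f a                 ∎

    -- Every root other than `a` is a root of the divided difference at `a`, whose degree is one
    -- less.
    root-bound : ∀ {d f} → Monic d f → ∀ {xs} → AllPairs (λ x y → ¬ x ≈ y) xs → All (λ x → f x ≈ 0#) xs → length xs ℕ.≤ d
    root-bound m [] [] = ℕ.z≤n
    root-bound (one f≈1) {x ∷ _} _ (fx≈0 ∷ _) = contradiction (trans (sym (f≈1 x)) fx≈0) nontrivial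
    root-bound {suc d} {f} m@(step _ _ _) {a ∷ xs} (a≉xs ∷ ds) (fa≈0 ∷ roots) with divided-difference m a
    ... | h , m′ , eq = ℕ.s≤s (root-bound m′ ds (All.zipWith root (a≉xs , roots)))
      where
      root : ∀ {x} → (¬ a ≈ x) × (f x ≈ 0#) → h x ≈ 0#
      root {x} (a≉x , fx≈0) with h x ≟ 0#
      ... | yes hx≈0 = hx≈0
      ... | no  hx≉0 = contradiction (*-cancelʳ hx≉0 (begin
        a * h x         ≈⟨ +-identityˡ _ ⟨
        0# + a * h x    ≈⟨ +-congʳ fx≈0 ⟨
        f x + a * h x   ≈⟨ eq x ⟩
        x * h x + f a   ≈⟨ +-congˡ fa≈0 ⟩
        x * h x + 0#    ≈⟨ +-identityʳ _ ⟩
        x * h x         ∎)) a≉x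

-- Primitive roots and discrete logarithms.

module PrimitiveRoots where
  open RamanujanSums using (prime-∣-prime; prime-∤⇒coprime; prime⇒2≤)
  open FiniteFields
  import Data.List.Properties as List
  open import Data.List.Relation.Unary.Unique.Propositional.Properties using (upTo⁺)
  open import Data.Nat.Induction using (<-rec)
  open import Data.Nat.Primality.Factorisation using (factorise)
  open import Relation.Binary.PropositionalEquality as ≡ using (_≡_; _≢_)

  -- The very list whose length is `ν m`, so that `2 ^ length (primesOf k)` is `W k` by definition.
  primesOf : ℕ → List ℕ
  primesOf m = filter (λ p → prime? p ×-dec (p ∣? m)) (upTo (suc m))

  primesOf-sound : ∀ m → All (λ p → Prime p × p ∣ m) (primesOf m)
  primesOf-sound m = All.all-filter (λ p → prime? p ×-dec (p ∣? m)) (upTo (suc m))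

  primesOf-distinct : ∀ m → AllPairs _≢_ (primesOf m)
  primesOf-distinct m = AllPairs.filter⁺ (λ p → prime? p ×-dec (p ∣? m)) (upTo⁺ (suc m))

  primesOf-complete : ∀ {m p} .{{_ : NonZero m}} → Prime p → p ∣ m → p ∈ primesOf m
  primesOf-complete {m} pp p∣m = ∈-filter⁺ (λ p → prime? p ×-dec (p ∣? m)) (∈-upTo⁺ (ℕ.s≤s (∣⇒≤ p∣m))) (pp , p∣m)

  prime-divisor : ∀ n → 2 ℕ.≤ n → ∃ λ p → Prime p × p ∣ n
  prime-divisor n@(suc _) 2≤n with factorise n
  ... | record { factors = [] ; isFactorisation = n≡1 } = contradiction 2≤n (ℕ.<⇒≱ (ℕ.s≤s (ℕ.≤-reflexive n≡1)))
  ... | record { factors = p ∷ ps ; isFactorisation = eq ; factorsPrime = pp ∷ _ } = p , pp , ≡.subst (p ∣_) (≡.sym eq) (m∣m*n _)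

  prime-∣-^ : ∀ {l p} a → Prime l → l ∣ p ℕ.^ a → l ∣ p
  prime-∣-^ zero    pl l∣1 = contradiction (≡.subst Prime (∣1⇒≡1 l∣1) pl) ¬prime[1]
  prime-∣-^ {l} {p} (suc a) pl l∣ with euclidsLemma p (p ℕ.^ a) pl l∣
  ... | inj₁ l∣p  = l∣p
  ... | inj₂ l∣pᵃ = prime-∣-^ a pl l∣pᵃ

  prime-part : ∀ {p} → Prime p → ∀ n → n ≢ 0 → ∃ λ a → ∃ λ m → n ≡ m ℕ.* p ℕ.^ a × ¬ p ∣ m
  prime-part {p} pp = <-rec _ go
    where
    go : ∀ n → (∀ {i} → i ℕ.< n → i ≢ 0 → ∃ λ a → ∃ λ m → i ≡ m ℕ.* p ℕ.^ a × ¬ p ∣ m) → n ≢ 0 → ∃ λ a → ∃ λ m → n ≡ m ℕ.* p ℕ.^ a × ¬ p ∣ m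
    go n rec n≢0 with p ∣? n
    ... | no  p∤n = 0 , n , ≡.sym (ℕ.*-identityʳ n) , p∤n
    ... | yes (divides k eq) with rec (ℕ.<-≤-trans (ℕ.m<m*n k p {{ℕ.≢-nonZero k≢0}} (prime⇒2≤ pp)) (ℕ.≤-reflexive (≡.sym eq))) k≢0
      where
      k≢0 : k ≢ 0
      k≢0 k≡0 = n≢0 (≡.trans eq (≡.cong (ℕ._* p) k≡0))
    ... | a , m , k≡ , p∤m = suc a , m , ≡.trans eq (≡.trans (≡.cong (ℕ._* p) k≡) (lemma m p (p ℕ.^ a))) , p∤m
      where
      lemma : ∀ m p w → m ℕ.* w ℕ.* p ≡ m ℕ.* (p ℕ.* w)
      lemma = ℕ.solve-∀

  injective⇒surjective : ∀ {n} (f : Fin n → Fin n) → (∀ {i j} → f i ≡ f j → i ≡ j) → ∀ y → ∃ λ i → f i ≡ y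
  injective⇒surjective {suc n} f inj y with Fin.any? (λ i → f i Fin.≟ y)
  ... | yes found = found
  ... | no  ¬found = contradiction (Fin.injective⇒≤ {f = λ i → punchOut (miss i)} (λ {i} {j} → inj ∘ Fin.punchOut-injective (miss i) (miss j))) ℕ.1+n≰n
    where
    miss : ∀ i → y ≢ f i
    miss i y≡fi = ¬found (i , ≡.sym y≡fi)

  ∣-∸⇒≡ : ∀ {m i j} → i ℕ.≤ j → j ℕ.< m → m ∣ j ℕ.∸ i → i ≡ j
  ∣-∸⇒≡ {m} {i} {j} i≤j j<m m∣ with j ℕ.∸ i in j-i≡
  ... | zero  = ℕ.≤-antisym i≤j (ℕ.m∸n≡0⇒m≤n j-i≡)
  ... | suc d = contradiction (∣⇒≤ m∣) (ℕ.<⇒≱ (≡.subst (ℕ._< m) j-i≡ (ℕ.≤-<-trans (ℕ.m∸n≤m j i) j<m)))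

  module Primitive {M : ℕ} .{{_ : NonZero M}} (F : FiniteField (suc M)) where
    open FiniteField F hiding (zero)
    open Field F
    open Bijection enumerate renaming (to to elem) using (injective)
    open import Algebra.Properties.Semiring.Exp semiring
    open import Algebra.Properties.CommutativeSemiring.Exp commutativeSemiring using (^-distrib-*)
    open import Algebra.Properties.Group +-group using (x≈y⇒x∙y⁻¹≈ε)
    open import Relation.Binary.Reasoning.Setoid setoid

    ^-* : ∀ x a b → x ^ (a ℕ.* b) ≈ (x ^ b) ^ a
    ^-* x a b = trans (^-congʳ x (ℕ.*-comm a b)) (sym (^-assocʳ x b a))

    ^≈1-* : ∀ {x a} → x ^ a ≈ 1# → ∀ b → x ^ (b ℕ.* a) ≈ 1#
    ^≈1-* {x} {a} xᵃ≈1 b = trans (^-* x b a) (trans (^-congˡ b xᵃ≈1) (1^k b))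

    ^≈1-gcd : ∀ {x a b} → x ^ a ≈ 1# → x ^ b ≈ 1# → x ^ gcd a b ≈ 1#
    ^≈1-gcd {x} {a} {b} xᵃ≈1 xᵇ≈1 with Bézout.identity (gcd-GCD a b)
    ... | Bézout.+- u v eq = begin
      x ^ gcd a b                       ≈⟨ *-identityʳ _ ⟨
      x ^ gcd a b * 1#                  ≈⟨ *-congˡ (^≈1-* xᵇ≈1 v) ⟨
      x ^ gcd a b * x ^ (v ℕ.* b)       ≈⟨ ^-homo-* x (gcd a b) (v ℕ.* b) ⟨
      x ^ (gcd a b ℕ.+ v ℕ.* b)         ≈⟨ ^-congʳ x eq ⟩
      x ^ (u ℕ.* a)                     ≈⟨ ^≈1-* xᵃ≈1 u ⟩
      1#                                ∎
    ... | Bézout.-+ u v eq = begin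
      x ^ gcd a b                       ≈⟨ *-identityʳ _ ⟨
      x ^ gcd a b * 1#                  ≈⟨ *-congˡ (^≈1-* xᵃ≈1 u) ⟨
      x ^ gcd a b * x ^ (u ℕ.* a)       ≈⟨ ^-homo-* x (gcd a b) (u ℕ.* a) ⟨
      x ^ (gcd a b ℕ.+ u ℕ.* a)         ≈⟨ ^-congʳ x eq ⟩
      x ^ (v ℕ.* b)                     ≈⟨ ^≈1-* xᵇ≈1 v ⟩
      1#                                ∎

    ^≈1-coprime : ∀ {x a b} → Coprime a b → x ^ a ≈ 1# → x ^ b ≈ 1# → x ≈ 1#
    ^≈1-coprime {x} {a} {b} cop xᵃ≈1 xᵇ≈1 = trans (sym (*-identityʳ x)) (trans (^-congʳ x (≡.sym (coprime⇒gcd≡1 cop))) (^≈1-gcd {x} {a} {b} xᵃ≈1 xᵇ≈1))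

    -- X^m - 1 has at most `m` roots, fewer than the `M` non-zero elements.
    nonroot : ∀ {m} → 0 ℕ.< m → m ℕ.< M → ∃ λ x → ¬ x ≈ 0# × ¬ x ^ m ≈ 1#
    nonroot {m@(suc _)} _ m<M with Fin.¬∀⟶∃¬ M (λ j → nz j ^ m ≈ 1#) (λ j → nz j ^ m ≟ 1#) notAll
      where
      0′ = index 0#
      nz : Fin M → Carrier
      nz j = elem (punchIn 0′ j)
      distinct : ∀ {i j} → i ≢ j → ¬ nz i ≈ nz j
      distinct i≢j eq = i≢j (Fin.punchIn-injective 0′ _ _ (injective eq))
      notAll : ¬ (∀ j → nz j ^ m ≈ 1#)
      notAll all = ℕ.<⇒≱ m<M (≡.subst (ℕ._≤ m) (List.length-tabulate nz)
        (root-bound (monic-+const (monic-^ m) (- 1#)) (AllPairs.tabulate⁺ distinct) (All.tabulate⁺ (λ j → x≈y⇒x∙y⁻¹≈ε (all j)))))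
    ... | j , ¬root = elem (punchIn (index 0#) j)
        , (λ x≈0 → Fin.punchInᵢ≢i (index 0#) j (injective (trans x≈0 (sym (elem-index 0#)))))
        , ¬root

    -- h has order divisible by the full power of l dividing M.
    Full : Carrier → ℕ → Set
    Full h l = ∀ k → M ≡ k ℕ.* l → ¬ h ^ k ≈ 1#

    M≢0 : M ≢ 0
    M≢0 = ℕ.≢-nonZero⁻¹ M

    extend : ∀ {p L h} → Prime p → p ∣ M → All (λ l → Prime l × l ∣ M) L → All (p ≢_) L → ¬ h ≈ 0# → All (Full h) L →
      ∃ λ z → ¬ z ≈ 0# × All (Full z) (p ∷ L)
    extend {p} {L} {h} pp (divides k₀ M≡k₀p) aL p≢L h≉0 full with prime-part pp M M≢0 | nonroot {k₀} (ℕ.n≢0⇒n>0 k₀≢0) k₀<M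
      where
      k₀≢0 : k₀ ≢ 0
      k₀≢0 k₀≡0 = M≢0 (≡.trans M≡k₀p (≡.cong (ℕ._* p) k₀≡0))
      k₀<M : k₀ ℕ.< M
      k₀<M = ≡.subst (k₀ ℕ.<_) (≡.sym M≡k₀p) (ℕ.m<m*n k₀ p {{ℕ.≢-nonZero k₀≢0}} (prime⇒2≤ pp))
    ... | zero , m , M≡ , p∤m | _ = contradiction (divides k₀ (≡.trans (≡.sym (≡.trans M≡ (ℕ.*-identityʳ m))) M≡k₀p)) p∤m
    ... | suc a , m , M≡ , p∤m | x , x≉0 , xᵏ≉1 = z , z≉0 , fullₚ ∷ All.zipWith (λ ((aₗ , p≢l) , fₗ) → fullₗ aₗ p≢l fₗ) (All.zip (aL , p≢L) , full)
      where
      instance _ = prime⇒nonZero pp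
      P = p ℕ.^ suc a
      -- As `M = m * P` with `P` the full power of `p`, the order of `h ^ P` is prime to `p` and
      -- stays full at the primes in `L`, while `x ^ m` has order dividing `P`, and exactly `P`
      -- because `x ^ k₀` is not 1.
      z = h ^ P * x ^ m
      z≉0 : ¬ z ≈ 0#
      z≉0 = product-≉0 (pow-≉0 h≉0 P) (pow-≉0 x≉0 m)
      z^ : ∀ k → z ^ k ≈ h ^ (P ℕ.* k) * x ^ (m ℕ.* k)
      z^ k = trans (^-distrib-* (h ^ P) (x ^ m) k) (*-cong (^-assocʳ h P k) (^-assocʳ x m k))

      fullₚ : Full z p
      fullₚ k M≡kp zᵏ≈1 = xᵏ≉1 (≡.subst (λ w → x ^ w ≈ 1#) k≡k₀ (^≈1-coprime (prime-∤⇒coprime pp p∤m)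
        (trans (^-assocʳ x k p) (trans (^-congʳ x (≡.sym M≡kp)) (fermat x≉0)))
        (begin
          (x ^ k) ^ m                       ≈⟨ ^-* x m k ⟨
          x ^ (m ℕ.* k)                     ≈⟨ *-identityˡ _ ⟨
          1# * x ^ (m ℕ.* k)                ≈⟨ *-congʳ (trans (^-congʳ h Pk≡) (^≈1-* (fermat h≉0) (p ℕ.^ a))) ⟨
          h ^ (P ℕ.* k) * x ^ (m ℕ.* k)     ≈⟨ z^ k ⟨
          z ^ k                             ≈⟨ zᵏ≈1 ⟩
          1#                                ∎)))
        where
        k≡k₀ : k ≡ k₀
        k≡k₀ = ℕ.*-cancelʳ-≡ k k₀ p (≡.trans (≡.sym M≡kp) M≡k₀p)
        lemma : ∀ p w k → p ℕ.* w ℕ.* k ≡ w ℕ.* (k ℕ.* p)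
        lemma = ℕ.solve-∀
        Pk≡ : P ℕ.* k ≡ p ℕ.^ a ℕ.* M
        Pk≡ = ≡.trans (lemma p (p ℕ.^ a) k) (≡.cong (p ℕ.^ a ℕ.*_) (≡.sym M≡kp))

      fullₗ : ∀ {l} → Prime l × l ∣ M → p ≢ l → Full h l → Full z l
      fullₗ {l} (pl , l∣M) p≢l full k M≡kl zᵏ≈1 with euclidsLemma m P pl (≡.subst (l ∣_) M≡ l∣M)
      ... | inj₂ l∣P = p≢l (≡.sym (prime-∣-prime pl pp (prime-∣-^ (suc a) pl l∣P)))
      ... | inj₁ (divides t m≡tl) = full k M≡kl (^≈1-coprime (prime-∤⇒coprime pl l∤P)
        (trans (^-assocʳ h k l) (trans (^-congʳ h (≡.sym M≡kl)) (fermat h≉0)))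
        (begin
          (h ^ k) ^ P                       ≈⟨ ^-* h P k ⟨
          h ^ (P ℕ.* k)                     ≈⟨ *-identityʳ _ ⟨
          h ^ (P ℕ.* k) * 1#                ≈⟨ *-congˡ (trans (^-congʳ x mk≡) (^≈1-* (fermat x≉0) t)) ⟨
          h ^ (P ℕ.* k) * x ^ (m ℕ.* k)     ≈⟨ z^ k ⟨
          z ^ k                             ≈⟨ zᵏ≈1 ⟩
          1#                                ∎))
        where
        l∤P : ¬ l ∣ P
        l∤P l∣P = p≢l (≡.sym (prime-∣-prime pl pp (prime-∣-^ (suc a) pl l∣P)))
        lemma : ∀ t l k → t ℕ.* l ℕ.* k ≡ t ℕ.* (k ℕ.* l)
        lemma = ℕ.solve-∀
        mk≡ : m ℕ.* k ≡ t ℕ.* M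
        mk≡ = ≡.trans (≡.cong (ℕ._* k) m≡tl) (≡.trans (lemma t l k) (≡.cong (t ℕ.*_) (≡.sym M≡kl)))

    full-for : ∀ {L} → All (λ l → Prime l × l ∣ M) L → AllPairs _≢_ L → ∃ λ h → ¬ h ≈ 0# × All (Full h) L
    full-for []               []         = 1# , nontrivial , []
    full-for ((pp , p∣M) ∷ aL) (p≢L ∷ dL) with full-for aL dL
    ... | h , h≉0 , full = extend pp p∣M aL p≢L h≉0 full

    primitive-root : ∃ λ g → ¬ g ≈ 0# × (∀ {l} → Prime l → l ∣ M → Full g l)
    primitive-root with full-for (primesOf-sound M) (primesOf-distinct M)
    ... | g , g≉0 , full = g , g≉0 , λ pl l∣M → All.lookup full (primesOf-complete pl l∣M)

    module Logarithm (g : Carrier) (g≉0 : ¬ g ≈ 0#) (full : ∀ {l} → Prime l → l ∣ M → Full g l) where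

      g^≉0 : ∀ k → ¬ g ^ k ≈ 0#
      g^≉0 = pow-≉0 g≉0

      -- If `gcd j M` were a proper divisor of `M`, a prime `l` dividing the quotient would give
      -- `g ^ (M / l) = 1`, against `Full`.
      g^j≈1⇒M∣j : ∀ {j} → g ^ j ≈ 1# → M ∣ j
      g^j≈1⇒M∣j {j} gʲ≈1 with gcd[m,n]∣n j M
      ... | divides zero          M≡0  = contradiction M≡0 M≢0
      ... | divides (suc zero)    M≡d  = ≡.subst (_∣ j) (≡.sym (≡.trans M≡d (ℕ.*-identityˡ _))) (gcd[m,n]∣m j M)
      ... | divides t@(suc (suc _)) M≡td with prime-divisor t (ℕ.s≤s (ℕ.s≤s ℕ.z≤n))
      ... | l , pl , divides r t≡rl = contradiction (^≈1-* {g} {gcd j M} (^≈1-gcd {g} {j} {M} gʲ≈1 (fermat g≉0)) r)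
          (full pl (divides (r ℕ.* gcd j M) M≡) (r ℕ.* gcd j M) M≡)
        where
        lemma : ∀ r l d → r ℕ.* l ℕ.* d ≡ r ℕ.* d ℕ.* l
        lemma = ℕ.solve-∀
        M≡ : M ≡ r ℕ.* gcd j M ℕ.* l
        M≡ = ≡.trans M≡td (≡.trans (≡.cong (ℕ._* gcd j M) t≡rl) (lemma r l (gcd j M)))

      g^-injective : ∀ {a b} → a ℕ.≤ b → g ^ a ≈ g ^ b → M ∣ b ℕ.∸ a
      g^-injective {a} {b} a≤b gᵃ≈gᵇ = g^j≈1⇒M∣j (sym (*-cancelˡ (g^≉0 a) (begin
        g ^ a * 1#               ≈⟨ *-identityʳ _ ⟩
        g ^ a                    ≈⟨ gᵃ≈gᵇ ⟩
        g ^ b                    ≈⟨ ^-congʳ g (≡.sym (ℕ.m+[n∸m]≡n a≤b)) ⟩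
        g ^ (a ℕ.+ (b ℕ.∸ a))    ≈⟨ ^-homo-* g a (b ℕ.∸ a) ⟩
        g ^ a * g ^ (b ℕ.∸ a)    ∎)))

      -- The field in the order 0, 1, g, g², ...: position 0 is taken by zero, so exponents are
      -- shifted by one.
      at : ℕ → Carrier
      at zero    = 0#
      at (suc j) = g ^ j

      at-injective-≤ : ∀ {i j} → i ℕ.≤ j → j ℕ.< suc M → at i ≈ at j → i ≡ j
      at-injective-≤ {zero}  {zero}  _ _ _ = ≡.refl
      at-injective-≤ {zero}  {suc j} _ _ 0≈ = contradiction (sym 0≈) (g^≉0 j)
      at-injective-≤ {suc i} {suc j} (ℕ.s≤s i≤j) (ℕ.s≤s j<M) eq = ≡.cong suc (∣-∸⇒≡ i≤j j<M (g^-injective i≤j eq))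

      at-injective : ∀ {i j} → i ℕ.< suc M → j ℕ.< suc M → at i ≈ at j → i ≡ j
      at-injective {i} {j} i< j< eq with ℕ.≤-total i j
      ... | inj₁ i≤j = at-injective-≤ i≤j j< eq
      ... | inj₂ j≤i = ≡.sym (at-injective-≤ j≤i i< (sym eq))

      at-index-injective : ∀ {i j : Fin (suc M)} → index (at (toℕ i)) ≡ index (at (toℕ j)) → i ≡ j
      at-index-injective {i} {j} eq = Fin.toℕ-injective (at-injective (Fin.toℕ<n i) (Fin.toℕ<n j)
        (trans (sym (elem-index _)) (trans (reflexive (≡.cong elem eq)) (elem-index _))))

      -- The positions below `suc M` hold distinct elements, so by counting they exhaust the field.
      log : ∀ x → ∃ λ i → index (at (toℕ i)) ≡ index x
      log x = injective⇒surjective (index ∘ at ∘ toℕ) at-index-injective (index x)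

      at-log : ∀ x → at (toℕ (proj₁ (log x))) ≈ x
      at-log x = trans (sym (elem-index _)) (trans (reflexive (≡.cong elem (proj₂ (log x)))) (elem-index x))

      logarithmic : Enumeration (suc M)
      logarithmic = record
        { at        = at ∘ toℕ
        ; find      = proj₁ ∘ log
        ; find-cong = λ {x} {y} x≈y → at-index-injective (≡.trans (proj₂ (log x)) (≡.trans (index-cong x≈y) (≡.sym (proj₂ (log y)))))
        ; at-find   = at-log
        ; find-at   = λ i → at-index-injective (proj₂ (log (at (toℕ i))))
        }

      discrete-log : ∀ {x} → ¬ x ≈ 0# → ∃ λ j → j ℕ.< M × x ≈ g ^ j
      discrete-log {x} x≉0 with proj₁ (log x) | at-log x
      ... | zero  | 0≈x = contradiction (sym 0≈x) x≉0
      ... | suc j | eq  = toℕ j , Fin.toℕ<n j , sym eq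

-- The trace-zero hyperplane as a Singer difference set.

module SingerDifferenceSet where
  open FiniteSums
  open RamanujanSums using (periodic-shift)
  open FiniteFields
  open PrimitiveRoots
  open import Data.Integer as ℤ using (ℤ; +_; 0ℤ; 1ℤ; +≤+)
  import Data.Integer.Properties as ℤ
  import Data.Integer.Tactic.RingSolver as ℤ
  open import Relation.Binary.PropositionalEquality as ≡ using (_≡_)
  import Algebra.Properties.CommutativeMonoid.Sum ℤ.+-0-commutativeMonoid as ⅀

  sum-toℕ : ∀ n f → ⅀.sum {n} (f ∘ toℕ) ≡ Σ< n f
  sum-toℕ zero    f = ≡.refl
  sum-toℕ (suc n) f = ≡.trans (≡.cong (ℤ._+_ (f 0)) (sum-toℕ n (f ∘ suc))) (≡.sym (Σ-head n f))

  Σ-term≤ : ∀ n {f} → (∀ x → 0ℤ ℤ.≤ f x) → ∀ {j} → j ℕ.< n → f j ℤ.≤ Σ< n f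
  Σ-term≤ (suc n) {f} 0≤f {j} j<1+n with j ℕ.≟ n
  ... | yes ≡.refl = ℤ.≤-trans (ℤ.≤-reflexive (≡.sym (ℤ.+-identityˡ (f n)))) (ℤ.+-monoˡ-≤ (f n) (Σ-nonneg n (λ x _ → 0≤f x)))
  ... | no  j≢n    = ℤ.≤-trans (Σ-term≤ n 0≤f (ℕ.≤∧≢⇒< (ℕ.<⇒≤pred j<1+n) j≢n))
    (ℤ.≤-trans (ℤ.≤-reflexive (≡.sym (ℤ.+-identityʳ (Σ< n f)))) (ℤ.+-monoʳ-≤ (Σ< n f) (0≤f n)))

  ind-mono : ∀ {P Q : Set} (d : Dec P) (e : Dec Q) → (P → Q) → ind d ℤ.≤ ind e
  ind-mono (yes p) (yes q) f = ℤ.≤-refl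
  ind-mono (yes p) (no ¬q) f = contradiction (f p) ¬q
  ind-mono (no ¬p) e       f = 0≤ind e

  ind-× : ∀ {P Q : Set} (d : Dec P) (e : Dec Q) → ind (d ×-dec e) ≡ ind d ℤ.* ind e
  ind-× (yes p) (yes q) = ≡.refl
  ind-× (yes p) (no ¬q) = ≡.refl
  ind-× (no ¬p) (yes q) = ≡.refl
  ind-× (no ¬p) (no ¬q) = ≡.refl

  1+-cancel-≤ : ∀ {i j} → 1ℤ ℤ.+ i ℤ.≤ 1ℤ ℤ.+ j → i ℤ.≤ j
  1+-cancel-≤ {i} {j} le = ≡.subst₂ ℤ._≤_ (lemma i) (lemma j) (ℤ.+-monoʳ-≤ (ℤ.- 1ℤ) le)
    where
    lemma : ∀ i → ℤ.- 1ℤ ℤ.+ (1ℤ ℤ.+ i) ≡ i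
    lemma = ℤ.solve-∀

  -- (q^n - 1)/(q - 1), the number of points of a projective space over F_q, as a geometric sum
  -- without division.
  geo : ℕ → ℕ → ℕ
  geo q zero    = 0
  geo q (suc n) = q ℕ.^ n ℕ.+ geo q n

  geo-spec : ∀ r n → suc r ℕ.^ n ≡ suc (r ℕ.* geo (suc r) n)
  geo-spec r zero    = ≡.cong suc (≡.sym (ℕ.*-zeroʳ r))
  geo-spec r (suc n) = begin
    q ℕ.* q ℕ.^ n                                ≡⟨ lemma₁ r (q ℕ.^ n) ⟩
    r ℕ.* q ℕ.^ n ℕ.+ q ℕ.^ n                    ≡⟨ ≡.cong (r ℕ.* q ℕ.^ n ℕ.+_) (geo-spec r n) ⟩
    r ℕ.* q ℕ.^ n ℕ.+ suc (r ℕ.* geo q n)        ≡⟨ lemma₂ r (q ℕ.^ n) (geo q n) ⟩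
    suc (r ℕ.* (q ℕ.^ n ℕ.+ geo q n))            ∎
    where
    open ≡.≡-Reasoning
    q = suc r
    lemma₁ : ∀ r w → (1 ℕ.+ r) ℕ.* w ≡ r ℕ.* w ℕ.+ w
    lemma₁ = ℕ.solve-∀
    lemma₂ : ∀ r w g → r ℕ.* w ℕ.+ (1 ℕ.+ r ℕ.* g) ≡ 1 ℕ.+ r ℕ.* (w ℕ.+ g)
    lemma₂ = ℕ.solve-∀

  geo-suc : ∀ q n → geo q (suc n) ≡ 1 ℕ.+ q ℕ.* geo q n
  geo-suc q zero    = ≡.cong suc (≡.sym (ℕ.*-zeroʳ q))
  geo-suc q (suc n) = ≡.trans (≡.cong (q ℕ.^ suc n ℕ.+_) (geo-suc q n)) (lemma q (q ℕ.^ n) (geo q n))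
    where
    lemma : ∀ q w g → q ℕ.* w ℕ.+ (1 ℕ.+ q ℕ.* g) ≡ 1 ℕ.+ q ℕ.* (w ℕ.+ g)
    lemma = ℕ.solve-∀

  module Singer {M : ℕ} .{{_ : NonZero M}} (F : FiniteField (suc M)) where
    open FiniteField F hiding (zero)
    open Field F
    open Primitive F
    open import Algebra.Properties.Semiring.Exp semiring
    open import Algebra.Properties.CommutativeSemiring.Exp commutativeSemiring using (^-distrib-*)
    open import Algebra.Properties.Group +-group using (∙-cancelʳ)
    open import Algebra.Properties.Ring ring using (x[y-z]≈xy-xz)
    open import Relation.Binary.Reasoning.Setoid setoid

    -- `suc r` plays the role of q, so `r` is the order of F_q^*.
    module Trace (r : ℕ) (frob : ∀ x y → (x + y) ^ suc r ≈ x ^ suc r + y ^ suc r) where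

      q : ℕ
      q = suc r

      tr : ℕ → Carrier → Carrier
      tr zero    x = 0#
      tr (suc i) x = x ^ (q ℕ.^ i) + tr i x

      trace≡tr : ∀ i x → trace F q i x ≡ tr i x
      trace≡tr zero    x = ≡.refl
      trace≡tr (suc i) x = ≡.cong₂ _+_ (pow≡^ x (q ℕ.^ i)) (trace≡tr i x)

      tr-cong : ∀ i {x y} → x ≈ y → tr i x ≈ tr i y
      tr-cong zero    x≈y = refl
      tr-cong (suc i) x≈y = +-cong (^-congˡ (q ℕ.^ i) x≈y) (tr-cong i x≈y)

      interchange : ∀ a b c d → (a + b) + (c + d) ≈ (a + c) + (b + d)
      interchange a b c d = trans (+-assoc a b (c + d)) (trans (+-congˡ (trans (sym (+-assoc b c d))
        (trans (+-congʳ (+-comm b c)) (+-assoc c b d)))) (sym (+-assoc a c (b + d))))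

      tr-+ : ∀ i x y → tr i (x + y) ≈ tr i x + tr i y
      tr-+ zero    x y = sym (+-identityˡ 0#)
      tr-+ (suc i) x y = trans (+-cong (additive-^ q frob i x y) (tr-+ i x y)) (interchange _ _ _ _)

      tr-minus : ∀ i x y → tr i x ≈ tr i y → tr i (x - y) ≈ 0#
      tr-minus i x y eq = ∙-cancelʳ (tr i y) _ _ (begin
        tr i (x - y) + tr i y     ≈⟨ tr-+ i (x - y) y ⟨
        tr i (x - y + y)          ≈⟨ tr-cong i (trans (+-assoc x (- y) y) (trans (+-congˡ (-‿inverseˡ y)) (+-identityʳ x))) ⟩
        tr i x                    ≈⟨ eq ⟩
        tr i y                    ≈⟨ +-identityˡ _ ⟨
        0# + tr i y               ∎)

      tr-* : ∀ i c x → c ^ q ≈ c → tr i (c * x) ≈ c * tr i x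
      tr-* zero    c x _  = sym (zeroʳ c)
      tr-* (suc i) c x eq = trans (+-cong (trans (^-distrib-* c x (q ℕ.^ i)) (*-congʳ (c^ i))) (tr-* i c x eq)) (sym (distribˡ c _ _))
        where
        c^ : ∀ i → c ^ (q ℕ.^ i) ≈ c
        c^ zero    = *-identityʳ c
        c^ (suc i) = trans (sym (^-assocʳ c q (q ℕ.^ i))) (trans (^-congˡ (q ℕ.^ i) eq) (c^ i))

      -- Raising to the power q shifts the summands by one place; the telescoped difference is
      -- stated without subtraction.
      tr-^q : ∀ i x → tr i x ^ q + x ≈ tr i x + x ^ (q ℕ.^ i)
      tr-^q zero    x = trans (+-congʳ (zeroˡ _)) (+-congˡ (sym (*-identityʳ x)))
      tr-^q (suc i) x = begin
        (x ^ (q ℕ.^ i) + tr i x) ^ q + x                    ≈⟨ +-congʳ (frob _ _) ⟩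
        (x ^ (q ℕ.^ i)) ^ q + tr i x ^ q + x                ≈⟨ +-assoc _ _ _ ⟩
        (x ^ (q ℕ.^ i)) ^ q + (tr i x ^ q + x)              ≈⟨ +-cong (trans (^-assocʳ x (q ℕ.^ i) q) (^-congʳ x (ℕ.*-comm (q ℕ.^ i) q))) (tr-^q i x) ⟩
        x ^ (q ℕ.* q ℕ.^ i) + (tr i x + x ^ (q ℕ.^ i))      ≈⟨ trans (+-comm _ _) (+-congʳ (+-comm _ _)) ⟩
        (x ^ (q ℕ.^ i) + tr i x) + x ^ (q ℕ.* q ℕ.^ i)      ∎

      -- The degree caps the number of trace zeros from above.
      tr-monic : 1 ℕ.≤ r → ∀ i → Monic (q ℕ.^ i) (tr (suc i))
      tr-monic 1≤r zero    = step (one (λ _ → refl)) 0# (λ x → +-congʳ (*-congˡ refl))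
      tr-monic 1≤r (suc i) = monic-+ (monic-^ (q ℕ.^ suc i)) (tr-monic 1≤r i) (ℕ.^-monoʳ-< q (ℕ.s≤s 1≤r) (ℕ.n<1+n i))

      module Hyperplane (1≤r : 1 ℕ.≤ r) (n′ : ℕ) (M+1≡ : suc M ≡ q ℕ.^ suc (suc n′))
        (g : Carrier) (g≉0 : ¬ g ≈ 0#) (full : ∀ {l} → Prime l → l ∣ M → Full g l) where

        open Logarithm g g≉0 full

        n : ℕ
        n = suc (suc n′)

        Q : ℕ
        Q = geo q n

        Tr : Carrier → Carrier
        Tr = tr n

        M≡rQ : M ≡ r ℕ.* Q
        M≡rQ = ℕ.suc-injective (≡.trans M+1≡ (geo-spec r n))

        x^q^n≈x : ∀ x → x ^ (q ℕ.^ n) ≈ x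
        x^q^n≈x x = trans (^-congʳ x (≡.sym M+1≡)) (x*x^M (x ≟ 0#))
          where
          x*x^M : Dec (x ≈ 0#) → x * x ^ M ≈ x
          x*x^M (yes x≈0) = trans (*-congʳ x≈0) (trans (zeroˡ _) (sym x≈0))
          x*x^M (no  x≉0) = trans (*-congˡ (fermat x≉0)) (*-identityʳ x)

        Tr^q≈Tr : ∀ x → Tr x ^ q ≈ Tr x
        Tr^q≈Tr x = ∙-cancelʳ x _ _ (trans (tr-^q n x) (+-congˡ (x^q^n≈x x)))

        -- v 0, …, v (q - 1) are the elements of the subfield F_q.
        v : ℕ → Carrier
        v zero    = 0#
        v (suc j) = g ^ (j ℕ.* Q)

        -- Being fixed amounts to `g ^ (b * r) = 1`, and `g` has order `r * Q`.
        fixed⇒Q∣ : ∀ b → (g ^ b) ^ q ≈ g ^ b → Q ∣ b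
        fixed⇒Q∣ b eq = *-cancelˡ-∣ r {{ℕ.>-nonZero 1≤r}} (≡.subst₂ _∣_ M≡rQ (ℕ.*-comm b r) (g^j≈1⇒M∣j {b ℕ.* r} (begin
          g ^ (b ℕ.* r)     ≈⟨ ^-assocʳ g b r ⟨
          (g ^ b) ^ r       ≈⟨ *-cancelˡ (g^≉0 b) (trans eq (sym (*-identityʳ (g ^ b)))) ⟩
          1#                ∎)))

        subfield : ∀ t → t ^ q ≈ t → ∃ λ a → a ℕ.< q × t ≈ v a
        subfield t t^q≈t = by-zero (t ≟ 0#)
          where
          from-divides : ∀ {b} → b ℕ.< M → t ≈ g ^ b → Q ∣ b → ∃ λ a → a ℕ.< q × t ≈ v a
          from-divides {b} b<M t≈gᵇ (divides j b≡jQ) =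
            suc j , ℕ.s≤s (ℕ.*-cancelʳ-< Q j r (≡.subst₂ ℕ._<_ b≡jQ M≡rQ b<M)) , trans t≈gᵇ (^-congʳ g b≡jQ)

          by-zero : Dec (t ≈ 0#) → ∃ λ a → a ℕ.< q × t ≈ v a
          by-zero (yes t≈0) = 0 , ℕ.z<s , t≈0
          by-zero (no  t≉0) = let b , b<M , t≈gᵇ = discrete-log t≉0 in
            from-divides b<M t≈gᵇ (fixed⇒Q∣ b (trans (^-congˡ q (sym t≈gᵇ)) (trans t^q≈t t≈gᵇ)))

        -- The sum over the field in logarithmic order, where invariance under F_q^* shows as
        -- periodicity of the exponent.
        SumF : (Carrier → ℤ) → ℤ
        SumF f = Σ< (suc M) (f ∘ at)

        -- Addition has no simple form on exponents, so the reindexing passes through the given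
        -- enumeration and back.
        SumF-translate : ∀ (f : Carrier → ℤ) → (∀ {x y} → x ≈ y → f x ≡ f y) → ∀ a → SumF (λ x → f (x - a)) ≡ SumF f
        SumF-translate f f-cong a = ≡.trans (≡.sym (sum-toℕ (suc M) (λ i → f (at i - a))))
          (≡.trans (sum-enumerations ℤ.+-0-commutativeMonoid logarithmic standard (λ x → f (x - a)) (λ x≈y → f-cong (+-congʳ x≈y)))
          (≡.trans (sum-enumerations ℤ.+-0-commutativeMonoid
            (twisted (_- a) (_+ a) +-congʳ +-congʳ
              (λ x → trans (+-assoc x a (- a)) (trans (+-congˡ (-‿inverseʳ a)) (+-identityʳ x)))
              (λ x → trans (+-assoc x (- a) a) (trans (+-congˡ (-‿inverseˡ a)) (+-identityʳ x)))) logarithmic f f-cong)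
          (sum-toℕ (suc M) (f ∘ at))))

        -- A pigeonhole substitute for rank-nullity: subtracting a fixed member maps a fibre
        -- injectively into the kernel, and at most `k₁ * k₂` fibres cover the field.
        module _ (k₁ k₂ : ℕ) {P : Carrier → ℕ → ℕ → Set} (P? : ∀ x a b → Dec (P x a b))
          {K : Carrier → Set} (K? : ∀ x → Dec (K x)) (K-cong : ∀ {x y} → x ≈ y → K x → K y)
          (cover : ∀ x → ∃ λ a → ∃ λ b → a ℕ.< k₁ × b ℕ.< k₂ × P x a b)
          (difference : ∀ {x y a b} → P x a b → P y a b → K (x - y)) where

          private
            κ : ℤ
            κ = SumF (λ x → ind (K? x))

          fibre≤kernel : ∀ a b → Σ< (suc M) (λ i → ind (P? (at i) a b)) ℤ.≤ κ
          fibre≤kernel a b with Fin.any? {n = suc M} (λ i → P? (at (toℕ i)) a b)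
          ... | no  empty = ℤ.≤-trans (ℤ.≤-reflexive (≡.trans (Σ-cong (suc M) (λ i i<n → ind-no (P? (at i) a b)
                  (λ Pi → empty (Fin.fromℕ< i<n , ≡.subst (λ j → P (at j) a b) (≡.sym (Fin.toℕ-fromℕ< i<n)) Pi)))) (Σ-zero (suc M))))
                (Σ-nonneg (suc M) (λ i _ → 0≤ind (K? (at i))))
          ... | yes (i₀ , Pi₀) = ℤ.≤-trans (Σ-mono (suc M) (λ i _ → ind-mono (P? (at i) a b) (K? (at i - at (toℕ i₀))) (λ Pi → difference Pi Pi₀)))
                (ℤ.≤-reflexive (SumF-translate (λ x → ind (K? x)) (λ {x} {y} x≈y → ind-cong (K? x) (K? y) (K-cong x≈y) (K-cong (sym x≈y))) (at (toℕ i₀))))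

          kernel-large : + suc M ℤ.≤ + k₁ ℤ.* (+ k₂ ℤ.* κ)
          kernel-large = ℤ.≤-trans (ℤ.≤-reflexive (≡.sym (≡.trans (Σ-const (suc M) 1ℤ) (ℤ.*-identityʳ (+ suc M)))))
            (ℤ.≤-trans (Σ-mono (suc M) (λ i _ → covered i))
            (ℤ.≤-trans (ℤ.≤-reflexive (≡.trans (Σ-swap (suc M) k₁ (λ i a → Σ< k₂ (λ b → ind (P? (at i) a b))))
                          (Σ-ext k₁ (λ a → Σ-swap (suc M) k₂ (λ i b → ind (P? (at i) a b))))))
            (ℤ.≤-trans (Σ-mono k₁ (λ a _ → ℤ.≤-trans (Σ-mono k₂ (λ b _ → fibre≤kernel a b)) (ℤ.≤-reflexive (Σ-const k₂ κ))))
            (ℤ.≤-reflexive (Σ-const k₁ (+ k₂ ℤ.* κ))))))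
            where
            covered : ∀ i → 1ℤ ℤ.≤ Σ< k₁ (λ a → Σ< k₂ (λ b → ind (P? (at i) a b)))
            covered i with cover (at i)
            ... | a , b , a< , b< , Pab = ℤ.≤-trans (ℤ.≤-reflexive (≡.sym (ind-yes (P? (at i) a b) Pab)))
              (ℤ.≤-trans (Σ-term≤ k₂ (λ b → 0≤ind (P? (at i) a b)) b<)
                         (Σ-term≤ k₁ {λ a → Σ< k₂ (λ b → ind (P? (at i) a b))} (λ a → Σ-nonneg k₂ (λ b _ → 0≤ind (P? (at i) a b))) a<))

        -- Turns a count by indicators into the duplicate-free list that `root-bound` takes; the
        -- recorded positions show that each new entry differs from the earlier ones.
        roots-listed : ∀ {P : Carrier → Set} (P? : ∀ x → Dec (P x)) m → m ℕ.≤ suc M →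
          ∃ λ xs → + length xs ≡ Σ< m (λ i → ind (P? (at i))) × AllPairs (λ x y → ¬ x ≈ y) xs × All P xs × All (λ x → ∃ λ j → j ℕ.< m × x ≡ at j) xs
        roots-listed P? zero    _   = [] , ≡.refl , [] , [] , []
        roots-listed P? (suc m) m<N with roots-listed P? m (ℕ.<⇒≤ m<N)
        ... | xs , len , distinct , roots , from with P? (at m)
        ... | no  _ = xs , ≡.trans len (≡.sym (ℤ.+-identityʳ _)) , distinct , roots , All.map (λ (j , j<m , eq) → j , ℕ.m<n⇒m<1+n j<m , eq) from
        ... | yes p = at m ∷ xs , ≡.trans (ℤ.+-comm 1ℤ (+ length xs)) (≡.cong (ℤ._+ 1ℤ) len)
            , All.map (λ { (j , j<m , ≡.refl) eq → ℕ.<-irrefl (≡.sym (at-injective m<N (ℕ.<-trans j<m m<N) eq)) j<m }) from ∷ distinct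
            , p ∷ roots
            , (m , ℕ.n<1+n m , ≡.refl) ∷ All.map (λ (j , j<m , eq) → j , ℕ.m<n⇒m<1+n j<m , eq) from

        D : ℕ → ℤ
        D x = ind (Tr (g ^ x) ≟ 0#)

        -- `g ^ Q` lies in F_q since `r * Q = M`, so it comes out of the trace.
        Tr-Q : ∀ x → Tr (g ^ (x ℕ.+ Q)) ≈ g ^ Q * Tr (g ^ x)
        Tr-Q x = trans (tr-cong n (trans (^-homo-* g x Q) (*-comm (g ^ x) (g ^ Q)))) (tr-* n (g ^ Q) (g ^ x) fixed)
          where
          fixed : (g ^ Q) ^ q ≈ g ^ Q
          fixed = begin
            g ^ Q * (g ^ Q) ^ r    ≈⟨ *-congˡ (^-assocʳ g Q r) ⟩
            g ^ Q * g ^ (Q ℕ.* r)  ≈⟨ *-congˡ (^-congʳ g (≡.trans (ℕ.*-comm Q r) (≡.sym M≡rQ))) ⟩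
            g ^ Q * g ^ M          ≈⟨ *-congˡ (fermat g≉0) ⟩
            g ^ Q * 1#             ≈⟨ *-identityʳ (g ^ Q) ⟩
            g ^ Q                  ∎

        D-periodic : Periodic Q D
        D-periodic x = ind-cong (Tr (g ^ (x ℕ.+ Q)) ≟ 0#) (Tr (g ^ x) ≟ 0#)
          (λ Tr≈0 → domain (trans (sym (Tr-Q x)) Tr≈0) (g^≉0 Q))
          (λ Tr≈0 → trans (Tr-Q x) (trans (*-congˡ Tr≈0) (zeroʳ (g ^ Q))))

        -- From affine to projective counts: zero contributes the 1, and the exponents below `M` run
        -- `r` times through the residues modulo `Q`.
        SumF-periodic : ∀ f → f 0# ≡ 1ℤ → Periodic Q (λ j → f (g ^ j)) → SumF f ≡ 1ℤ ℤ.+ + r ℤ.* Σ< Q (λ j → f (g ^ j))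
        SumF-periodic f f0≡1 per = ≡.trans (Σ-head M (f ∘ at)) (≡.cong₂ ℤ._+_ f0≡1
          (≡.trans (≡.cong (λ m → Σ< m (λ j → f (g ^ j))) M≡rQ) (Σ-periodic r Q (λ j → f (g ^ j)) per)))

        tr-0 : ∀ i → tr i 0# ≈ 0#
        tr-0 zero    = refl
        tr-0 (suc i) = trans (+-cong (0^q^i (q ℕ.^ i) (ℕ.m^n≢0 q i)) (tr-0 i)) (+-identityˡ 0#)
          where
          0^q^i : ∀ k → NonZero k → 0# ^ k ≈ 0#
          0^q^i (suc k) _ = zeroˡ (0# ^ k)

        scaled≤⇒≤ : ∀ {i a} → + (q ℕ.^ i) ℤ.≤ 1ℤ ℤ.+ + r ℤ.* a → + geo q i ℤ.≤ a
        scaled≤⇒≤ {i} {a} le = ℤ.*-cancelˡ-≤-pos (+ geo q i) a (+ r) {{ℤ.positive {+ r} (ℤ.+<+ 1≤r)}}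
          (1+-cancel-≤ {+ r ℤ.* + geo q i} {+ r ℤ.* a} (≡.subst (ℤ._≤ 1ℤ ℤ.+ + r ℤ.* a) (≡.trans (≡.cong +_ (geo-spec r i)) (≡.cong (ℤ._+_ 1ℤ) (ℤ.pos-* r (geo q i)))) le))

        ≤scaled⇒≤ : ∀ {i a} → 1ℤ ℤ.+ + r ℤ.* a ℤ.≤ + (q ℕ.^ i) → a ℤ.≤ + geo q i
        ≤scaled⇒≤ {i} {a} le = ℤ.*-cancelˡ-≤-pos a (+ geo q i) (+ r) {{ℤ.positive {+ r} (ℤ.+<+ 1≤r)}}
          (1+-cancel-≤ {+ r ℤ.* a} {+ r ℤ.* + geo q i} (≡.subst (1ℤ ℤ.+ + r ℤ.* a ℤ.≤_) (≡.trans (≡.cong +_ (geo-spec r i)) (≡.cong (ℤ._+_ 1ℤ) (ℤ.pos-* r (geo q i)))) le))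

        κ₁ : ℤ
        κ₁ = SumF (λ x → ind (Tr x ≟ 0#))

        κ₁≡ : κ₁ ≡ 1ℤ ℤ.+ + r ℤ.* Σ< Q D
        κ₁≡ = SumF-periodic (λ x → ind (Tr x ≟ 0#)) (ind-yes (Tr 0# ≟ 0#) (tr-0 n)) D-periodic

        q*i≤ : ∀ {a b} → + (q ℕ.* a) ℤ.≤ + q ℤ.* b → + a ℤ.≤ b
        q*i≤ {a} {b} le = ℤ.*-cancelˡ-≤-pos (+ a) b (+ q) (≡.subst (ℤ._≤ + q ℤ.* b) (ℤ.pos-* q a) le)

        -- The trace has at most q values; the second coordinate of the pigeonhole is a dummy with
        -- one value.
        κ₁-large : + (q ℕ.^ suc n′) ℤ.≤ κ₁
        κ₁-large = q*i≤ {q ℕ.^ suc n′} {κ₁} (≡.subst₂ ℤ._≤_ (≡.cong +_ M+1≡) (≡.cong (+ q ℤ.*_) (ℤ.*-identityˡ κ₁))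
          (kernel-large q 1 (λ x a _ → Tr x ≟ v a) (λ x → Tr x ≟ 0#) (λ x≈y → trans (sym (tr-cong n x≈y)))
            (λ x → let a , a<q , eq = subfield (Tr x) (Tr^q≈Tr x) in a , 0 , a<q , ℕ.z<s , eq)
            (λ {x} {y} ex ey → tr-minus n x y (trans ex (sym ey)))))

        κ₁-small : κ₁ ℤ.≤ + (q ℕ.^ suc n′)
        κ₁-small = let xs , len , distinct , roots , _ = roots-listed (λ x → Tr x ≟ 0#) (suc M) ℕ.≤-refl in
          ≡.subst (ℤ._≤ + (q ℕ.^ suc n′)) len (+≤+ (root-bound (tr-monic 1≤r (suc n′)) distinct roots))

        ΣD≡ : Σ< Q D ≡ + geo q (suc n′)
        ΣD≡ = ℤ.≤-antisym (≤scaled⇒≤ {suc n′} (≡.subst (ℤ._≤ + (q ℕ.^ suc n′)) κ₁≡ κ₁-small))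
                          (scaled≤⇒≤ {suc n′} (≡.subst (+ (q ℕ.^ suc n′) ℤ.≤_) κ₁≡ κ₁-large))

        module _ (z : ℕ) where

          K₂? : ∀ x → Dec (Tr x ≈ 0# × Tr (g ^ z * x) ≈ 0#)
          K₂? x = (Tr x ≟ 0#) ×-dec (Tr (g ^ z * x) ≟ 0#)

          κ₂ : ℤ
          κ₂ = SumF (λ x → ind (K₂? x))

          K₂-g^ : ∀ x → ind (K₂? (g ^ x)) ≡ D x ℤ.* D (x ℕ.+ z)
          K₂-g^ x = ≡.trans (ind-× (Tr (g ^ x) ≟ 0#) (Tr (g ^ z * g ^ x) ≟ 0#)) (≡.cong (D x ℤ.*_)
            (ind-cong (Tr (g ^ z * g ^ x) ≟ 0#) (Tr (g ^ (x ℕ.+ z)) ≟ 0#) (trans (sym (tr-cong n shift))) (trans (tr-cong n shift))))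
            where
            shift : g ^ z * g ^ x ≈ g ^ (x ℕ.+ z)
            shift = trans (*-comm (g ^ z) (g ^ x)) (sym (^-homo-* g x z))

          κ₂≡ : κ₂ ≡ 1ℤ ℤ.+ + r ℤ.* Σ< Q (λ x → D x ℤ.* D (x ℕ.+ z))
          κ₂≡ = ≡.trans (SumF-periodic (λ x → ind (K₂? x))
              (ind-yes (K₂? 0#) (tr-0 n , trans (tr-cong n (zeroʳ (g ^ z))) (tr-0 n)))
              (λ x → ≡.trans (K₂-g^ (x ℕ.+ Q)) (≡.trans (≡.cong₂ ℤ._*_ (D-periodic x) (periodic-shift {Q} {D} D-periodic z x)) (≡.sym (K₂-g^ x)))))
            (≡.cong (λ s → 1ℤ ℤ.+ + r ℤ.* s) (Σ-ext Q K₂-g^))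

          -- The pair of traces of `x` and `g ^ z * x` takes at most q² values.
          κ₂-large : + (q ℕ.^ n′) ℤ.≤ κ₂
          κ₂-large = q*i≤ {q ℕ.^ n′} {κ₂} (q*i≤ {q ℕ.* q ℕ.^ n′} {+ q ℤ.* κ₂} (≡.subst (ℤ._≤ + q ℤ.* (+ q ℤ.* κ₂)) (≡.cong +_ M+1≡)
            (kernel-large q q (λ x a b → (Tr x ≟ v a) ×-dec (Tr (g ^ z * x) ≟ v b)) K₂?
              (λ x≈y (e₁ , e₂) → trans (sym (tr-cong n x≈y)) e₁ , trans (sym (tr-cong n (*-congˡ x≈y))) e₂)
              (λ x → let a , a<q , e₁ = subfield (Tr x) (Tr^q≈Tr x) ; b , b<q , e₂ = subfield (Tr (g ^ z * x)) (Tr^q≈Tr (g ^ z * x)) in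
                a , b , a<q , b<q , e₁ , e₂)
              (λ {x} {y} (e₁ , e₂) (e₁′ , e₂′) → tr-minus n x y (trans e₁ (sym e₁′))
                , trans (tr-cong n (x[y-z]≈xy-xz (g ^ z) x y)) (tr-minus n (g ^ z * x) (g ^ z * y) (trans e₂ (sym e₂′)))))))

          -- Uniform in `z`: when `Q` divides `z` the two trace conditions coincide and the count is
          -- larger, hence an inequality.
          correlation≥ : + geo q n′ ℤ.≤ Σ< Q (λ x → D x ℤ.* D (x ℕ.+ z))
          correlation≥ = scaled≤⇒≤ {n′} (≡.subst (+ (q ℕ.^ n′) ℤ.≤_) κ₂≡ κ₂-large)

        -- The difference set relation. With `G = geo q n′` one has |D| = 1 + q G and Q = 1 + q |D|,
        -- so |D|² - Q G = |D| - G = 1 + r G = q^n′.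
        total≤ : Σ< Q D ℤ.* Σ< Q D ℤ.- + Q ℤ.* + geo q n′ ℤ.≤ + (q ℕ.^ n′)
        total≤ = ℤ.≤-reflexive (≡.trans (≡.cong₂ (λ s w → s ℤ.* s ℤ.- w ℤ.* + G) (≡.trans ΣD≡ A≡) Q≡)
          (≡.trans (lemma (+ r) (+ G)) (≡.sym (≡.trans (≡.cong +_ (geo-spec r n′)) (≡.cong (ℤ._+_ 1ℤ) (ℤ.pos-* r G))))))
          where
          G = geo q n′
          A≡ : + geo q (suc n′) ≡ 1ℤ ℤ.+ (1ℤ ℤ.+ + r) ℤ.* + G
          A≡ = ≡.trans (≡.cong +_ (geo-suc q n′)) (≡.cong (ℤ._+_ 1ℤ) (ℤ.pos-* q G))
          Q≡ : + Q ≡ 1ℤ ℤ.+ (1ℤ ℤ.+ + r) ℤ.* (1ℤ ℤ.+ (1ℤ ℤ.+ + r) ℤ.* + G)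
          Q≡ = ≡.trans (≡.cong +_ (geo-suc q (suc n′))) (≡.cong (ℤ._+_ 1ℤ) (≡.trans (ℤ.pos-* q (geo q (suc n′))) (≡.cong (+ q ℤ.*_) A≡)))
          lemma : ∀ r G → (1ℤ ℤ.+ (1ℤ ℤ.+ r) ℤ.* G) ℤ.* (1ℤ ℤ.+ (1ℤ ℤ.+ r) ℤ.* G) ℤ.- (1ℤ ℤ.+ (1ℤ ℤ.+ r) ℤ.* (1ℤ ℤ.+ (1ℤ ℤ.+ r) ℤ.* G)) ℤ.* G ≡ 1ℤ ℤ.+ r ℤ.* G
          lemma = ℤ.solve-∀

-- From sieve survivors to primitive elements.

module PrimitiveElements where
  open FiniteSums
  open RamanujanSums
  open Sieving
  open FiniteFields
  open PrimitiveRoots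
  open SingerDifferenceSet
  open import Data.Integer as ℤ using (+_; 0ℤ; +≤+)
  import Data.Integer.Properties as ℤ
  open import Data.Nat.DivMod using (_/_; m≡m%n+[m/n]*n; m*n/n≡m)
  open import Data.Rational as ℚ using (0ℚ; 1ℚ)
  open import Relation.Binary.PropositionalEquality as ≡ using (_≡_; _≢_)
  open import Data.Nat using (_^_; _∸_; _%_)

  -- An odd number of powers of an odd base has an odd sum; the induction adds two powers at a time.
  geo-odd : ∀ t i → ∃ λ h → geo (1 ℕ.+ 2 ℕ.* t) (1 ℕ.+ i ℕ.* 2) ≡ 1 ℕ.+ 2 ℕ.* h
  geo-odd t zero    = 0 , ≡.refl
  geo-odd t (suc i) with geo-odd t i
  ... | h , eq = 1 ℕ.+ 3 ℕ.* t ℕ.+ 2 ℕ.* t ℕ.* t ℕ.+ q ℕ.* q ℕ.* h , (begin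
    geo q (suc (suc j))                      ≡⟨ geo-suc q (suc j) ⟩
    1 ℕ.+ q ℕ.* geo q (suc j)                ≡⟨ ≡.cong (λ w → 1 ℕ.+ q ℕ.* w) (geo-suc q j) ⟩
    1 ℕ.+ q ℕ.* (1 ℕ.+ q ℕ.* geo q j)        ≡⟨ ≡.cong (λ w → 1 ℕ.+ q ℕ.* (1 ℕ.+ q ℕ.* w)) eq ⟩
    1 ℕ.+ q ℕ.* (1 ℕ.+ q ℕ.* (1 ℕ.+ 2 ℕ.* h)) ≡⟨ lemma t h ⟩
    1 ℕ.+ 2 ℕ.* (1 ℕ.+ 3 ℕ.* t ℕ.+ 2 ℕ.* t ℕ.* t ℕ.+ q ℕ.* q ℕ.* h) ∎)
    where
    open ≡.≡-Reasoning
    q = 1 ℕ.+ 2 ℕ.* t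
    j = 1 ℕ.+ i ℕ.* 2
    lemma : ∀ t h → 1 ℕ.+ (1 ℕ.+ 2 ℕ.* t) ℕ.* (1 ℕ.+ (1 ℕ.+ 2 ℕ.* t) ℕ.* (1 ℕ.+ 2 ℕ.* h))
      ≡ 1 ℕ.+ 2 ℕ.* (1 ℕ.+ 3 ℕ.* t ℕ.+ 2 ℕ.* t ℕ.* t ℕ.+ (1 ℕ.+ 2 ℕ.* t) ℕ.* (1 ℕ.+ 2 ℕ.* t) ℕ.* h)
    lemma = ℕ.solve-∀

  -- The shift j is the product of the primes dividing M but not a.
  coprime-translate : ∀ {M Q} .{{_ : NonZero M}} a → (∀ {l} → Prime l → l ∣ Q → ¬ l ∣ a) →
    ∃ λ j → ∀ {l} → Prime l → l ∣ M → ¬ l ∣ a ℕ.+ j ℕ.* Q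
  coprime-translate {M} {Q} a cop = product L , λ {l} pl l∣M l∣a+jQ → case l∣M pl l∣a+jQ (l ∣? a)
    where
    L = filter (λ l → ¬? (l ∣? a)) (primesOf M)
    case : ∀ {l} → l ∣ M → Prime l → l ∣ a ℕ.+ product L ℕ.* Q → ¬ Dec (l ∣ a)
    case {l} l∣M pl l∣ (no l∤a) = l∤a (∣-cancelʳ-+ (∣m⇒∣m*n Q (All.lookup (∣-product L)
      (∈-filter⁺ (λ l → ¬? (l ∣? a)) (primesOf-complete pl l∣M) l∤a))) l∣)
    -- A prime dividing `a` divides neither `Q`, by hypothesis, nor `product L`, whose prime factors
    -- do not divide `a`.
    case {l} l∣M pl l∣ (yes l∣a) with euclidsLemma (product L) Q pl (∣m+n∣m⇒∣n l∣ l∣a)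
    ... | inj₂ l∣Q = cop pl l∣Q l∣a
    ... | inj₁ l∣L = prime-∤-product pl (All.zipWith
        (λ { ((pr , _) , r∤a) l∣r → r∤a (≡.subst (_∣ a) (prime-∣-prime pl pr l∣r) l∣a) })
        (All.filter⁺ (λ l → ¬? (l ∣? a)) (primesOf-sound M) , All.all-filter (λ l → ¬? (l ∣? a)) (primesOf M))) l∣L

  module _ {M : ℕ} .{{_ : NonZero M}} (F : FiniteField (suc M)) where
    open FiniteField F hiding (zero)
    open Field F
    open Primitive F
    open Singer F
    open import Algebra.Properties.Semiring.Exp semiring renaming (_^_ to _↑_)

    -- Writing `ζ = g ^ b` gives `a ≡ b * d` modulo `M`, so a divisor `d` of `M` also divides `a`;
    -- any prime factor of `d` would then divide both.
    free-power : ∀ {g} (g≉0 : ¬ g ≈ 0#) (full : ∀ {l} → Prime l → l ∣ M → Full g l) {a} →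
      (∀ {l} → Prime l → l ∣ M → ¬ l ∣ a) → Free F M (g ↑ a)
    free-power {g} g≉0 full {a} cop d ζ d∣M gᵃ≈ζᵈ = d≡1 d d∣M d∣a
      where
      open Logarithm g g≉0 full

      d≢0 : d ≢ 0
      d≢0 ≡.refl = M≢0 (0∣⇒≡0 d∣M)

      0^ : ∀ d → d ≢ 0 → 0# ↑ d ≈ 0#
      0^ zero    d≢0 = contradiction ≡.refl d≢0
      0^ (suc d) _   = zeroˡ (0# ↑ d)

      ζ≉0 : ¬ ζ ≈ 0#
      ζ≉0 ζ≈0 = g^≉0 a (trans gᵃ≈ζᵈ (trans (reflexive (pow≡^ ζ d)) (trans (^-congˡ d ζ≈0) (0^ d d≢0))))

      d∣a : d ∣ a
      d∣a = let b , _ , ζ≈gᵇ = discrete-log ζ≉0 in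
        compare b (trans gᵃ≈ζᵈ (trans (reflexive (pow≡^ ζ d)) (trans (^-congˡ d ζ≈gᵇ) (^-assocʳ g b d)))) (ℕ.≤-total a (b ℕ.* d))
        where
        compare : ∀ b → g ↑ a ≈ g ↑ (b ℕ.* d) → a ℕ.≤ b ℕ.* d ⊎ b ℕ.* d ℕ.≤ a → d ∣ a
        compare b eq (inj₁ a≤bd) = ∣m+n∣m⇒∣n (≡.subst (d ∣_) (≡.sym (ℕ.m∸n+n≡m a≤bd)) (n∣m*n b)) (∣-trans d∣M (g^-injective a≤bd eq))
        compare b eq (inj₂ bd≤a) = ≡.subst (d ∣_) (ℕ.m∸n+n≡m bd≤a) (∣m∣n⇒∣m+n (∣-trans d∣M (g^-injective bd≤a (sym eq))) (n∣m*n b))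

      d≡1 : ∀ d → d ∣ M → d ∣ a → d ≡ 1
      d≡1 zero                0∣M _   = contradiction (0∣⇒≡0 0∣M) M≢0
      d≡1 (suc zero)          _   _   = ≡.refl
      d≡1 d@(suc (suc _)) d∣M d∣a = let l , pl , l∣d = prime-divisor d (ℕ.s≤s (ℕ.s≤s ℕ.z≤n)) in
        contradiction (∣-trans l∣d d∣a) (cop pl (∣-trans l∣d d∣M))

    module _ (r n′ : ℕ) (1≤r : 1 ℕ.≤ r) (M+1≡ : suc M ≡ suc r ^ suc (suc n′))
      (frob : ∀ x y → (x + y) ↑ suc r ≈ x ↑ suc r + y ↑ suc r) (odd : ∃ λ h → geo (suc r) (suc (suc n′)) ≡ 1 ℕ.+ 2 ℕ.* h) where

      module _ (g : Carrier) (g≉0 : ¬ g ≈ 0#) (full : ∀ {l} → Prime l → l ∣ M → Full g l) where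
        open Trace r frob
        open Hyperplane 1≤r n′ M+1≡ g g≉0 full

        -- x is the exponent of ξ² up to multiples of Q, so ξ = g ^ a with 2a ≡ x (mod Q).
        from-exponent : ∀ x → D x ≢ 0ℤ → (∀ {l} → Prime l → l ∣ Q → ¬ l ∣ x) → N₀-positive F q n M
        from-exponent x Dx≢0 cop = ξ , Logarithm.g^≉0 g g≉0 full a , free-power g≉0 full {a} (proj₂ translate) , Tr[ξ²]≈0
          where
          -- (Q + 1)/2, the inverse of 2 modulo `Q`; it exists because `Q` is odd.
          h = suc (proj₁ odd)

          Q+1≡2h : suc Q ≡ 2 ℕ.* h
          Q+1≡2h = ≡.trans (≡.cong suc (proj₂ odd)) (lemma (proj₁ odd))
            where
            lemma : ∀ h → 2 ℕ.+ 2 ℕ.* h ≡ 2 ℕ.* (1 ℕ.+ h)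
            lemma = ℕ.solve-∀

          half-coprime : ∀ {l} → Prime l → l ∣ Q → ¬ l ∣ x ℕ.* h
          half-coprime {l} pl l∣Q l∣xh with euclidsLemma x h pl l∣xh
          ... | inj₁ l∣x = cop pl l∣Q l∣x
          ... | inj₂ l∣h = ¬prime[1] (≡.subst Prime (∣1⇒≡1 (∣-cancelʳ-+ l∣Q (≡.subst (l ∣_) (≡.sym Q+1≡2h) (∣n⇒∣m*n 2 l∣h)))) pl)

          translate = coprime-translate {M} (x ℕ.* h) half-coprime
          j = proj₁ translate
          a = x ℕ.* h ℕ.+ j ℕ.* Q
          ξ = g ↑ a

          2a≡ : a ℕ.+ a ≡ x ℕ.+ (x ℕ.+ 2 ℕ.* j) ℕ.* Q
          2a≡ = ≡.trans (lemma₁ x h j Q) (≡.trans (≡.cong (λ w → x ℕ.* w ℕ.+ 2 ℕ.* j ℕ.* Q) (≡.sym Q+1≡2h)) (lemma₂ x j Q))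
            where
            lemma₁ : ∀ x h j Q → (x ℕ.* h ℕ.+ j ℕ.* Q) ℕ.+ (x ℕ.* h ℕ.+ j ℕ.* Q) ≡ x ℕ.* (2 ℕ.* h) ℕ.+ 2 ℕ.* j ℕ.* Q
            lemma₁ = ℕ.solve-∀
            lemma₂ : ∀ x j Q → x ℕ.* (1 ℕ.+ Q) ℕ.+ 2 ℕ.* j ℕ.* Q ≡ x ℕ.+ (x ℕ.+ 2 ℕ.* j) ℕ.* Q
            lemma₂ = ℕ.solve-∀

          D[2a]≡ : D (a ℕ.+ a) ≡ D x
          D[2a]≡ = ≡.trans (≡.cong D 2a≡) (periodic-* {Q} {D} D-periodic (x ℕ.+ 2 ℕ.* j) x)

          Tr≈0 : Tr (g ↑ (a ℕ.+ a)) ≈ 0#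
          Tr≈0 = ind≢0 (Tr (g ↑ (a ℕ.+ a)) ≟ 0#) (λ D≡0 → Dx≢0 (≡.trans (≡.sym D[2a]≡) D≡0))

          Tr[ξ²]≈0 : trace F q n (ξ * ξ) ≈ 0#
          Tr[ξ²]≈0 = trans (reflexive (trace≡tr n (ξ * ξ))) (trans (tr-cong n (sym (^-homo-* g a a))) Tr≈0)

        module _ (k : ℕ) (ps : List ℕ) (k≢0 : k ≢ 0) (pps : All Prime ps) (ps∤k : All (λ p → ¬ p ∣ k) ps)
          (radical : ∀ p → Prime p → (p ∣ k ℕ.* product ps → p ∣ Q) × (p ∣ Q → p ∣ k ℕ.* product ps)) where

          survives⇒coprime : ∀ {x} → All (λ p → ¬ p ∣ x) (primesOf k) → All (λ p → ¬ p ∣ x) ps → ∀ {l} → Prime l → l ∣ Q → ¬ l ∣ x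
          survives⇒coprime {x} ks∤x ps∤x {l} pl l∣Q l∣x with euclidsLemma k (product ps) pl (proj₂ (radical l pl) l∣Q)
          ... | inj₁ l∣k = All.lookup ks∤x (primesOf-complete {{ℕ.≢-nonZero k≢0}} pl l∣k) l∣x
          ... | inj₂ l∣ps = prime-∤-product pl (All.zipWith (λ (pr , r∤x) l∣r → r∤x (≡.subst (_∣ x) (prime-∣-prime pl pr l∣r) l∣x)) (pps , ps∤x)) l∣ps

          N₀-positive-from-sieve : 0ℚ ℚ.< 1ℚ ℚ.- sumRecip ps →
            ℕ→ℚ 2 ℚ.* (((ℕ→ℚ (length ps) ℚ.- 1ℚ) ℚ.* invℚ (1ℚ ℚ.- sumRecip ps) ℚ.+ ℕ→ℚ 2) ℚ.* ℕ→ℚ (W k)) ℚ.*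
              (((ℕ→ℚ (length ps) ℚ.- 1ℚ) ℚ.* invℚ (1ℚ ℚ.- sumRecip ps) ℚ.+ ℕ→ℚ 2) ℚ.* ℕ→ℚ (W k)) ℚ.< ℕ→ℚ (suc r ^ n′) →
            N₀-positive F q n M
          N₀-positive-from-sieve 0<δ bound =
            let x , _ , Dx≢0 , ks∤x , ps∤x = sieve Q {{Q≢0}} D (λ x → 0≤ind (Tr (g ↑ x) ≟ 0#)) D-periodic (+ geo (suc r) n′) (suc r ^ n′) (ℕ.m^n>0 (suc r) n′)
                  correlation≥ total≤ m≤ΣD (primesOf k) ps
                  (All.map proj₁ (primesOf-sound k)) pps (primesOf-distinct k)
                  (All.map (λ p∤k → All.map (λ { (_ , r∣k) ≡.refl → p∤k r∣k }) (primesOf-sound k)) ps∤k)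
                  (All.map (λ {p} (pp , p∣k) → proj₁ (radical p pp) (∣m⇒∣m*n (product ps) p∣k)) (primesOf-sound k))
                  (All.zipWith (λ {p} (pp , p∣) → proj₁ (radical p pp) (∣n⇒∣m*n k p∣)) (pps , ∣-product ps))
                  0<δ bound
            in from-exponent x Dx≢0 (survives⇒coprime ks∤x ps∤x)
            where
            Q≢0 : NonZero Q
            Q≢0 = ℕ.>-nonZero (ℕ.≤-trans (ℕ.m^n>0 q (suc n′)) (ℕ.m≤m+n (q ^ suc n′) (geo q (suc n′))))
            -- q^(n-2) is the leading term of the geometric sum |D|.
            m≤ΣD : + (suc r ^ n′) ℤ.≤ Σ< Q D
            m≤ΣD = ℤ.≤-trans (+≤+ (ℕ.m≤m+n (q ^ n′) (geo q n′))) (ℤ.≤-reflexive (≡.sym ΣD≡))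

  geo-odd-for : ∀ {q n} → q % 4 ≡ 1 → n % 2 ≡ 1 → ∃ λ h → geo q n ≡ 1 ℕ.+ 2 ℕ.* h
  geo-odd-for {q} {n} q%4≡1 n%2≡1 = ≡.subst₂ (λ q n → ∃ λ h → geo q n ≡ 1 ℕ.+ 2 ℕ.* h) (≡.sym q≡) (≡.sym n≡) (geo-odd (2 ℕ.* (q / 4)) (n / 2))
    where
    lemma : ∀ w → 1 ℕ.+ w ℕ.* 4 ≡ 1 ℕ.+ 2 ℕ.* (2 ℕ.* w)
    lemma = ℕ.solve-∀
    q≡ : q ≡ 1 ℕ.+ 2 ℕ.* (2 ℕ.* (q / 4))
    q≡ = ≡.trans (m≡m%n+[m/n]*n q 4) (≡.trans (≡.cong (ℕ._+ q / 4 ℕ.* 4) q%4≡1) (lemma (q / 4)))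
    n≡ : n ≡ 1 ℕ.+ n / 2 ℕ.* 2
    n≡ = ≡.trans (m≡m%n+[m/n]*n n 2) (≡.cong (ℕ._+ n / 2 ℕ.* 2) n%2≡1)

  prime-power-nontrivial : ∀ {r} → IsPrimePower (suc r) → 1 ℕ.≤ r
  prime-power-nontrivial {suc r} _ = ℕ.s≤s ℕ.z≤n
  prime-power-nontrivial {zero} (p , suc e , pp , _ , 1≡) = contradiction (≡.subst Prime (∣1⇒≡1 (≡.subst (p ∣_) (≡.sym 1≡) (m∣m*n (p ^ e)))) pp) ¬prime[1]

  divℕ-geo : ∀ r n → 1 ℕ.≤ r → divℕ (suc r ^ n ∸ 1) r ≡ geo (suc r) n
  divℕ-geo r@(suc _) n _ = ≡.trans (≡.cong (λ w → (w ∸ 1) / r) (geo-spec r n)) (≡.trans (≡.cong (_/ r) (ℕ.*-comm r (geo (suc r) n))) (m*n/n≡m (geo (suc r) n) r))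

  module _ {M : ℕ} (F : FiniteField (suc M)) where
    open FiniteField F
    open import Algebra.Properties.Semiring.Exp semiring renaming (_^_ to _↑_)

    frobenius-q : ∀ {q n} → IsPrimePower q → suc M ≡ q ^ n → ∀ x y → (x + y) ↑ q ≈ x ↑ q + y ↑ q
    frobenius-q (zero , e , pp , _ , _) _ = contradiction pp ¬prime[0]
    frobenius-q {n = n} (suc p-1 , e , pp , _ , ≡.refl) M+1≡ =
      Field.Characteristic.frobenius-^ F pp (Field.characteristic F (e ℕ.* n) (≡.trans M+1≡ (ℕ.^-*-assoc (suc p-1) e n))) e

  -- `q ^ n` does not reduce to a successor. The size is therefore a variable `N` with two
  -- equations, and matching on `refl` gives `F` the type `FiniteField (suc M)`.
  N₀-positive-of-geo : ∀ {N M} r n′ → N ≡ suc M → N ≡ suc r ^ suc (suc n′) → IsPrimePower (suc r) → suc r % 4 ≡ 1 → suc (suc n′) % 2 ≡ 1 →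
    (F : FiniteField N) (k : ℕ) (ps : List ℕ) → All Prime ps → All (λ p → ¬ p ∣ k) ps →
    IsRadicalOf (k ℕ.* product ps) (geo (suc r) (suc (suc n′))) → 0ℚ ℚ.< 1ℚ ℚ.- sumRecip ps →
    ℕ→ℚ 2 ℚ.* (((ℕ→ℚ (length ps) ℚ.- 1ℚ) ℚ.* invℚ (1ℚ ℚ.- sumRecip ps) ℚ.+ ℕ→ℚ 2) ℚ.* ℕ→ℚ (W k)) ℚ.*
      (((ℕ→ℚ (length ps) ℚ.- 1ℚ) ℚ.* invℚ (1ℚ ℚ.- sumRecip ps) ℚ.+ ℕ→ℚ 2) ℚ.* ℕ→ℚ (W k)) ℚ.< ℕ→ℚ (suc r ^ n′) →
    N₀-positive F (suc r) (suc (suc n′)) M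
  N₀-positive-of-geo {M = M} r n′ ≡.refl M+1≡ isPrimePower q%4≡1 n%2≡1 F k ps pps ps∤k (squareFree , radical) 0<δ bound =
    let g , g≉0 , full = Primitive.primitive-root {{M≢0}} F in
    N₀-positive-from-sieve {{M≢0}} F r n′ 1≤r M+1≡ (frobenius-q F {n = suc (suc n′)} isPrimePower M+1≡) (geo-odd-for {suc r} {suc (suc n′)} q%4≡1 n%2≡1) g g≉0 full k ps k≢0 pps ps∤k
      (λ p pp → Equivalence.to (radical p pp) , Equivalence.from (radical p pp)) 0<δ bound
    where
    1≤r : 1 ℕ.≤ r
    1≤r = prime-power-nontrivial isPrimePower
    M≢0 : NonZero M
    M≢0 = ℕ.>-nonZero (ℕ.≤-pred (≡.subst (2 ℕ.≤_) (≡.sym M+1≡)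
      (ℕ.≤-trans (ℕ.s≤s 1≤r) (ℕ.m≤m*n (suc r) (suc r ^ suc n′) {{ℕ.m^n≢0 (suc r) (suc n′)}}))))
    k≢0 : k ≢ 0
    -- The radical would be 0, which is divisible by the square of 2.
    k≢0 ≡.refl = squareFree 2 prime[2] (4 ∣0)

-- The criterion.

open PrimitiveElements using (prime-power-nontrivial; divℕ-geo; N₀-positive-of-geo)
open import Data.Nat using (_^_; _∸_; _%_)
open import Data.Rational using (0ℚ; 1ℚ; _+_; _-_; _*_; _<_)
open import Relation.Binary.PropositionalEquality using (_≡_; _≢_; refl; sym; subst)

theorem6p7 : (q n : ℕ) → IsPrimePower q → q % 4 ≡ 1 → Prime n → n % 2 ≡ 1
    → (F : FiniteField (q ^ n))
    → (k : ℕ) (ps : List ℕ) → All Prime ps → AllPairs _≢_ ps → All (λ p → ¬ (p ∣ k)) ps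
    → IsRadicalOf (k ℕ.* product ps) (divℕ (q ^ n ∸ 1) (q ∸ 1))
    → 0ℚ < 1ℚ - sumRecip ps
    → ℕ→ℚ 2 * (((ℕ→ℚ (length ps) - 1ℚ) * invℚ (1ℚ - sumRecip ps) + ℕ→ℚ 2) * ℕ→ℚ (W k)) * (((ℕ→ℚ (length ps) - 1ℚ) * invℚ (1ℚ - sumRecip ps) + ℕ→ℚ 2) * ℕ→ℚ (W k)) < ℕ→ℚ (q ^ (n ∸ 2))
    → N₀-positive F q n (q ^ n ∸ 1)
theorem6p7 zero _ _ ()
theorem6p7 (suc r) zero _ _ pn = contradiction pn ¬prime[0]
theorem6p7 (suc r) (suc zero) _ _ pn = contradiction pn ¬prime[1]
-- With `n` of this shape, `n ∸ 2` computes to `n′` and is the true exponent n - 2.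
theorem6p7 (suc r) n@(suc (suc n′)) isPrimePower q%4≡1 _ n%2≡1 F k ps pps _ ps∤k radical =
  N₀-positive-of-geo r n′ (sym (ℕ.suc-pred (suc r ^ n) {{ℕ.m^n≢0 (suc r) n}})) refl isPrimePower q%4≡1 n%2≡1 F k ps pps ps∤k
    (subst (IsRadicalOf (k ℕ.* product ps)) (divℕ-geo r n (prime-power-nontrivial isPrimePower)) radical)
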